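{- Let $\kappa,\lambda$ be partitions and $N=|\kappa|+|\lambda|$. There is a polynomial $B(k)$ (depending on $\kappa,\lambda$), of degree at most $2N$, such that for every integer $k\ge1$ for which both $\kappa$ and $\lambda$ fit inside the $k\times k$ square and $k^2\ge N$, \[ \dim\big(\lambda,\widetilde{\kappa}^{(k)}\big)=\dim\big(\kappa,\widetilde{\lambda}^{(k)}\big)=\frac{g_k\,B(k)}{k^2(k^2-1)\cdots(k^2-N+1)},\qquad g_k=(k^2)!\prod_{j=0}^{k-1}\frac{j!}{(j+k)!}. \]
   Context: For partitions $\mu,\nu$, $\dim(\mu,\nu)$ is the number of sequences $\mu=\mu^0\subset\mu^1\subset\cdots\subset\mu^m=\nu$ of Young diagrams each obtained from the previous by adding one box (the number of standard tableaux of skew shape $\nu/\mu$; $0$ if $\mu\not\subseteq\nu$). A partition $\kappa$ fits in the $k\times k$ square if $\ell(\kappa)\le k$ and $\kappa_1\le k$; then $\widetilde{\kappa}^{(k)}$ denotes the partition whose conjugate has parts $(k-\kappa_k,\dots,k-\kappa_1)$ (with $\kappa$ padded by zeros to length $k$), i.e. the complement of $\kappa$ in the $k\times k$ square rotated by $180^\circ$ and conjugated; $|\widetilde{\kappa}^{(k)}|=k^2-|\kappa|$. -}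

module Defs where

open import Data.Bool using (if_then_else_)
open import Data.Nat as ℕ using (ℕ; zero; suc; _+_; _*_; _∸_; _≤_; _<_; _<ᵇ_; _≤ᵇ_; _!)
open import Data.Nat.Properties using (_!≢0)
open import Data.Nat.ListAction using (sum)
open import Data.List using (List; []; _∷_; _++_; map; length; replicate; reverse; filter; upTo; foldr)
open import Data.List.Properties using (≡-dec)
open import Data.List.Relation.Unary.All using (All)
open import Data.List.Relation.Unary.Linked using (Linked)
open import Data.Integer using (+_)
open import Data.Rational as ℚ using (ℚ; _/_)
open import Relation.Nullary using (does)
import Data.Nat.Properties as ℕP

IsPartition : List ℕ → Set
IsPartition xs = Linked (λ a b → b ≤ a) xs × All (λ a → 0 < a) xs
  where open import Data.Product using (_×_)

size : List ℕ → ℕ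
size = sum

headOr0 : List ℕ → ℕ
headOr0 []      = 0
headOr0 (x ∷ _) = x

removeBox : List ℕ → List (List ℕ)
removeBox []       = []
removeBox (x ∷ xs) =
  (if headOr0 xs <ᵇ x then (if x ℕ.≡ᵇ 1 then xs ∷ [] else (ℕ.pred x ∷ xs) ∷ []) else [])
  ++ map (x ∷_) (removeBox xs)

dimAux : ℕ → List ℕ → List ℕ → ℕ
dimAux zero    μ ν = if does (≡-dec ℕP._≟_ μ ν) then 1 else 0
dimAux (suc m) μ ν = sum (map (dimAux m μ) (removeBox ν))

-- dim(μ,ν): number of chains μ = μ⁰ ⊂ … ⊂ μᵐ = ν adding one box at each step
dim : List ℕ → List ℕ → ℕ
dim μ ν = dimAux (size ν ∸ size μ) μ ν

FitsIn : ℕ → List ℕ → Set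
FitsIn k κ = length κ ≤ k × All (λ a → a ≤ k) κ
  where open import Data.Product using (_×_)

conj : List ℕ → List ℕ
conj ps = map (λ i → length (filter (λ a → suc i ℕ.≤? a) ps)) (upTo (headOr0 ps))

-- κ̃^(k): the partition whose conjugate is (k-κ_k, …, k-κ_1), κ padded by zeros to length k
tilde : ℕ → List ℕ → List ℕ
tilde k κ = conj (reverse (map (k ∸_) (κ ++ replicate (k ∸ length κ) 0)))

prodℚ : ℕ → (ℕ → ℚ) → ℚ
prodℚ zero    f = ℚ.1ℚ
prodℚ (suc n) f = prodℚ n f ℚ.* f n

g : ℕ → ℚ
g k = ((+ ((k * k) !)) / 1) ℚ.* prodℚ k (λ j → _/_ (+ (j !)) ((j + k) !) {{(j + k) !≢0}})

fallingSq : ℕ → ℕ → ℚ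
fallingSq k N = prodℚ N (λ i → (+ (k * k ∸ i)) / 1)

evalPoly : List ℚ → ℚ → ℚ
evalPoly []       x = ℚ.0ℚ
evalPoly (c ∷ cs) x = c ℚ.+ x ℚ.* evalPoly cs x

toℚ : ℕ → ℚ
toℚ n = (+ n) / 1

{-# OPTIONS --safe #-}
-- Let D(κ, λ) be the number of chains from λ to the complement of κ in the k × k square, rotated but not
-- conjugated, so that dim(λ, κ̃) = D(κ, λ′), where ′ denotes conjugation.
--
-- First let κ = ∅, so that D(∅, μ) = dim(μ, □), and let n = |μ|, d_μ = dim(∅, μ).  The Heisenberg relation
-- between adding and removing boxes, weighted by contents c, yields by induction on n
--   Σ (k² − c²) d_{μ⁺} = (n + 1)(k² − n) d_μ,   summed over the ways to add a box, of content c, to μ.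
-- Hence e(μ) = d_μ ∏ (k² − c²), the product over the boxes of μ, satisfies Σ e(μ⁺) = (n + 1)(k² − n) e(μ).  As
-- dim(μ, □) = Σ dim(μ⁺, □), and as e vanishes at all diagrams with k² boxes except □, the numbers e(μ) and
-- dim(μ, □) are proportional up to factorials.  Taking μ = ∅ shows that d_□² is (k²)!² / ∏ (k² − c²) over the
-- boxes of □, which is g_k²; so the hook length formula of the square comes for free.
--
-- In general, adding a vertical strip commutes with adding a box, so in D(κ, λ) a sum over strips of a given
-- size added to λ may be replaced by the sum over such strips added to κ.  If κ⁻ is κ without its first
-- column, adding strips of the size of that column to κ⁻ gives κ and diagrams with as many boxes and
-- more rows.  By induction D(κ, λ) is a combination of numbers D(∅, μ), with coefficients independent of k.

module Submission where

open import Defs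
open import Data.Bool using (Bool; true; false; if_then_else_; not; _∧_; _∨_)
open import Data.Bool.Properties using (∨-zeroʳ)
open import Data.Empty using (⊥-elim)
open import Data.Integer using (+_)
import Data.Integer as ℤ
import Data.Integer.Properties as ℤP
open import Data.List using (List; []; _∷_; _++_; map; length; replicate; reverse; filter; applyUpTo; applyDownFrom)
open import Data.List.Properties using (≡-dec)
import Data.List.Properties as LP
open import Data.List.Relation.Binary.Permutation.Propositional.Properties using (↭-reverse)
open import Data.List.Relation.Unary.All using (All; _∷_)
open import Data.List.Relation.Unary.Linked using (Linked; _∷_)
open import Data.Nat as ℕ using (ℕ; zero; suc; pred; _+_; _*_; _∸_; _≤_; _<_; _<ᵇ_; _≡ᵇ_; _!; z≤n; s≤s; _≤?_; _<?_)
open import Data.Nat.Coprimality using (Coprime)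
import Data.Nat.Coprimality as Coprimality
open import Data.Nat.ListAction using (sum)
open import Data.Nat.ListAction.Properties using (sum-++; sum-↭)
import Data.Nat.Properties as ℕP
open import Data.Nat.Tactic.RingSolver using () renaming (solve-∀ to ℕ-solve-∀)
open import Data.Product using (Σ; _×_; _,_; proj₁; proj₂)
open import Data.Maybe using (Maybe; just; nothing)
open import Data.Rational using (ℚ; 0ℚ; 1ℚ) renaming (_*_ to _*ℚ_)
import Data.Rational as ℚ
import Data.Rational.Properties as ℚP
open import Data.Rational.Unnormalised using (mkℚᵘ; *≡*)
import Data.Rational.Unnormalised.Properties as ℚᵘP
open import Data.Sum using (_⊎_; inj₁; inj₂)
open import Function using (_∘_)
open import Relation.Binary.Definitions using (tri<; tri≈; tri>)
open import Relation.Binary.PropositionalEquality using (_≡_; _≢_; refl; sym; trans; cong; cong₂; subst; module ≡-Reasoning)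
open import Relation.Nullary using (Dec; does; yes; no; ¬_)
open import Relation.Nullary.Decidable using (_×-dec_; dec-true; dec-false)
open import Tactic.RingSolver using (solve-∀)
open import Tactic.RingSolver.Core.AlmostCommutativeRing using (AlmostCommutativeRing; fromCommutativeRing)
open import Level using (0ℓ)
open ≡-Reasoning

-- The complement in D is only rotated because rotation by 180° takes vertical strips to vertical
-- strips: a strip can pass from one argument of D to the other and keep its kind, whereas
-- conjugation would make it horizontal. Conjugation is moved to λ once, at the end. The equality of
-- the two dimensions comes from the same exchange, applied to strips of a single box: it makes D
-- symmetric. The coefficients of the reduction must be the same for all k, although the diagrams
-- obtained from κ by adding strips may leave a small square. D is set to 0 for these, and the
-- exchange of strips stays valid; so one polynomial serves every k with k² ≥ N. In the same way
-- e(μ) vanishes as soon as μ does not fit. The bound 2N arises because each box of μ contributes to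
-- D(∅, μ) a factor k² - c² of degree 2 in k, while the exchange of strips preserves the total
-- number of boxes: every μ that occurs has exactly N of them.

ring : AlmostCommutativeRing 0ℓ 0ℓ
ring = fromCommutativeRing ℚP.+-*-commutativeRing zero?
  where
  zero? : ∀ x → Maybe (0ℚ ≡ x)
  zero? x with 0ℚ ℚP.≟ x
  ... | yes p = just p
  ... | no _  = nothing

-- Rational arithmetic

infixl 6 _⊕_ _⊖_
infixl 7 _⊛_

-- Opaque copies of the ring operations, which the unifier can treat as injective.
opaque
  _⊕_ _⊛_ _⊖_ : ℚ → ℚ → ℚ
  _⊕_ = ℚ._+_
  _⊛_ = ℚ._*_
  _⊖_ = ℚ._-_

opaque
  unfolding _⊕_

  +-identityˡ : ∀ p → 0ℚ ⊕ p ≡ p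
  +-identityˡ = ℚP.+-identityˡ

  +-identityʳ : ∀ p → p ⊕ 0ℚ ≡ p
  +-identityʳ = ℚP.+-identityʳ

  +-comm : ∀ p q → p ⊕ q ≡ q ⊕ p
  +-comm = ℚP.+-comm

  *-zeroʳ : ∀ p → p ⊛ 0ℚ ≡ 0ℚ
  *-zeroʳ = ℚP.*-zeroʳ

  *-zeroˡ : ∀ p → 0ℚ ⊛ p ≡ 0ℚ
  *-zeroˡ = ℚP.*-zeroˡ

  *-distribˡ-+ : ∀ p q r → p ⊛ (q ⊕ r) ≡ p ⊛ q ⊕ p ⊛ r
  *-distribˡ-+ = ℚP.*-distribˡ-+

  *-distribʳ-+ : ∀ r p q → (p ⊕ q) ⊛ r ≡ p ⊛ r ⊕ q ⊛ r
  *-distribʳ-+ = ℚP.*-distribʳ-+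

  interchange : ∀ a b c d → (a ⊕ b) ⊕ (c ⊕ d) ≡ (a ⊕ c) ⊕ (b ⊕ d)
  interchange = solve-∀ ring

-- Recursive, unlike `toℚ`, so that `ι (suc n)` unfolds to `1ℚ ⊕ ι n` and identities of the ring
-- solver apply to contents directly.
ι : ℕ → ℚ
ι zero    = 0ℚ
ι (suc n) = 1ℚ ⊕ ι n

-- Diagrams with a bound on the first row

-- Partitions in a form suited to recursion on rows: the rows below the first are again a diagram,
-- bounded by the first row. Rows of length zero are excluded, so that equal diagrams are equal
-- lists, as `dimAux` requires.
data Cap : ℕ → List ℕ → Set where
  []  : ∀ {c} → Cap c []
  _∷_ : ∀ {c x xs} → suc x ≤ c → Cap (suc x) xs → Cap c (suc x ∷ xs)

Cap-≤ : ∀ {c d xs} → c ≤ d → Cap c xs → Cap d xs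
Cap-≤ c≤d []       = []
Cap-≤ c≤d (p ∷ ps) = ℕP.≤-trans p c≤d ∷ ps

Cap-head : ∀ {c xs} → Cap c xs → headOr0 xs ≤ c
Cap-head []      = z≤n
Cap-head (p ∷ _) = p

Cap-headOr0 : ∀ {c xs} → Cap c xs → Cap (headOr0 xs) xs
Cap-headOr0 []       = []
Cap-headOr0 (_ ∷ ps) = ℕP.≤-refl ∷ ps

isPartition⇒Cap : ∀ {xs} → IsPartition xs → Cap (headOr0 xs) xs
isPartition⇒Cap {xs} (l , a) = go xs l a
  where
  go : ∀ xs → Linked (λ a b → b ≤ a) xs → All (λ a → 0 < a) xs → Cap (headOr0 xs) xs
  go []               _       _             = []
  go (suc x ∷ [])     _       _             = ℕP.≤-refl ∷ []
  go (zero ∷ [])      _       (() ∷ _)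
  go (suc x ∷ y ∷ ys) (p ∷ l) (_ ∷ a)       = ℕP.≤-refl ∷ Cap-≤ p (go (y ∷ ys) l a)

<ᵇ-true : ∀ {m n} → m < n → (m <ᵇ n) ≡ true
<ᵇ-true {zero}  {suc n} _       = refl
<ᵇ-true {suc m} {suc n} (s≤s p) = <ᵇ-true p

<ᵇ-false : ∀ {m n} → n ≤ m → (m <ᵇ n) ≡ false
<ᵇ-false {m}     {zero}  _       = refl
<ᵇ-false {suc m} {suc n} (s≤s p) = <ᵇ-false p

-- Sums over added and removed boxes

when : Bool → ℚ → ℚ
when true  z = z
when false z = 0ℚ

when-+ : ∀ b p q → when b (p ⊕ q) ≡ when b p ⊕ when b q
when-+ true  p q = refl
when-+ false p q = sym (+-identityˡ 0ℚ)

when-* : ∀ b p q → p ⊛ when b q ≡ when b (p ⊛ q)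
when-* true  p q = refl
when-* false p q = *-zeroʳ p

when-0 : ∀ b → when b 0ℚ ≡ 0ℚ
when-0 true  = refl
when-0 false = refl

-- The boxes that can be added to a diagram whose first row is the row number i of a larger diagram
-- and is bounded by c; the test function sees the content of the box and the enlarged diagram.
addΣ : ℕ → ℕ → (ℚ → List ℕ → ℚ) → List ℕ → ℚ
addΣ c i ψ []       = when (0 <ᵇ c) (ψ (ι 0 ⊖ ι i) (1 ∷ []))
addΣ c i ψ (x ∷ xs) = when (x <ᵇ c) (ψ (ι x ⊖ ι i) (suc x ∷ xs)) ⊕ addΣ x (suc i) (λ a ν → ψ a (x ∷ ν)) xs

-- The value at 0 is a default, kept out by the test in `remΣ`. A row of length 1 is deleted, so
-- that no zero row arises.
shrink : ℕ → List ℕ → List ℕ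
shrink 0             xs = 0 ∷ xs
shrink 1             xs = xs
shrink (suc (suc x)) xs = suc x ∷ xs

remΣ : (List ℕ → ℚ) → List ℕ → ℚ
remΣ φ []       = 0ℚ
remΣ φ (x ∷ xs) = when (headOr0 xs <ᵇ x) (φ (shrink x xs)) ⊕ remΣ (φ ∘ (x ∷_)) xs

addΣ-cong : ∀ c i {ψ ψ′} xs → (∀ a ν → ψ a ν ≡ ψ′ a ν) → addΣ c i ψ xs ≡ addΣ c i ψ′ xs
addΣ-cong c i []       h = cong (when (_ <ᵇ c)) (h _ _)
addΣ-cong c i (x ∷ xs) h = cong₂ _⊕_ (cong (when (_ <ᵇ c)) (h _ _)) (addΣ-cong x (suc i) xs (λ a ν → h a (x ∷ ν)))

remΣ-cong : ∀ {φ φ′} xs → (∀ ν → φ ν ≡ φ′ ν) → remΣ φ xs ≡ remΣ φ′ xs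
remΣ-cong []       h = refl
remΣ-cong (x ∷ xs) h = cong₂ _⊕_ (cong (when (_ <ᵇ x)) (h _)) (remΣ-cong xs (h ∘ (x ∷_)))

addΣ-+ : ∀ c i ψ ψ′ xs → addΣ c i (λ a ν → ψ a ν ⊕ ψ′ a ν) xs ≡ addΣ c i ψ xs ⊕ addΣ c i ψ′ xs
addΣ-+ c i ψ ψ′ []       = when-+ (0 <ᵇ c) _ _
addΣ-+ c i ψ ψ′ (x ∷ xs) = trans (cong₂ _⊕_ (when-+ (x <ᵇ c) _ _) (addΣ-+ x (suc i) _ _ xs)) (interchange (when (x <ᵇ c) _) (when (x <ᵇ c) _) _ _)

addΣ-0 : ∀ c i xs → addΣ c i (λ _ _ → 0ℚ) xs ≡ 0ℚ
addΣ-0 c i []       = when-0 (0 <ᵇ c)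
addΣ-0 c i (x ∷ xs) = trans (cong₂ _⊕_ (when-0 (x <ᵇ c)) (addΣ-0 x (suc i) xs)) (+-identityˡ 0ℚ)

addΣ-* : ∀ c i p ψ xs → addΣ c i (λ a ν → p ⊛ ψ a ν) xs ≡ p ⊛ addΣ c i ψ xs
addΣ-* c i p ψ []       = sym (when-* (0 <ᵇ c) p _)
addΣ-* c i p ψ (x ∷ xs) = trans (cong₂ _⊕_ (sym (when-* (x <ᵇ c) p _)) (addΣ-* x (suc i) p _ xs)) (sym (*-distribˡ-+ p (when (x <ᵇ c) _) _))

addΣ-when : ∀ c i b ψ xs → addΣ c i (λ a ν → when b (ψ a ν)) xs ≡ when b (addΣ c i ψ xs)
addΣ-when c i true  ψ xs = refl
addΣ-when c i false ψ xs = addΣ-0 c i xs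

remΣ-+ : ∀ φ φ′ xs → remΣ (λ ν → φ ν ⊕ φ′ ν) xs ≡ remΣ φ xs ⊕ remΣ φ′ xs
remΣ-+ φ φ′ []       = sym (+-identityˡ 0ℚ)
remΣ-+ φ φ′ (x ∷ xs) = trans (cong₂ _⊕_ (when-+ (headOr0 xs <ᵇ x) _ _) (remΣ-+ _ _ xs)) (interchange (when (headOr0 xs <ᵇ x) _) (when (headOr0 xs <ᵇ x) _) _ _)

remΣ-* : ∀ p φ xs → remΣ (λ ν → p ⊛ φ ν) xs ≡ p ⊛ remΣ φ xs
remΣ-* p φ []       = sym (*-zeroʳ p)
remΣ-* p φ (x ∷ xs) = trans (cong₂ _⊕_ (sym (when-* (headOr0 xs <ᵇ x) p _)) (remΣ-* p _ xs)) (sym (*-distribˡ-+ p (when (headOr0 xs <ᵇ x) _) _))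

when-≡0 : ∀ b {p} → p ≡ 0ℚ → when b p ≡ 0ℚ
when-≡0 b refl = when-0 b

remΣ-0 : ∀ xs → remΣ (λ _ → 0ℚ) xs ≡ 0ℚ
remΣ-0 []       = refl
remΣ-0 (x ∷ xs) = trans (cong₂ _⊕_ (when-0 (headOr0 xs <ᵇ x)) (remΣ-0 xs)) (+-identityˡ 0ℚ)

remΣ-when : ∀ b φ xs → remΣ (λ ν → when b (φ ν)) xs ≡ when b (remΣ φ xs)
remΣ-when true  φ xs = refl
remΣ-when false φ xs = remΣ-0 xs

-- The sum of w over the contents of the addable boxes minus that over the removable ones. The last
-- box of a row of length x lies in column x - 1, whence its content `ι x ⊖ ι (suc i)`.
diag : ℕ → ℕ → (ℚ → ℚ) → List ℕ → ℚ
diag c i w []       = when (0 <ᵇ c) (w (ι 0 ⊖ ι i))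
diag c i w (x ∷ xs) = when (x <ᵇ c) (w (ι x ⊖ ι i)) ⊖ when (headOr0 xs <ᵇ x) (w (ι x ⊖ ι (suc i))) ⊕ diag x (suc i) w xs

opaque
  unfolding _⊕_

  suc-content : ∀ x i → x ⊖ i ≡ (1ℚ ⊕ x) ⊖ (1ℚ ⊕ i)
  suc-content = solve-∀ ring

  private
    add-rem-arith : ∀ a b d r u v → (a ⊕ b) ⊕ (d ⊕ (r ⊕ u)) ≡ (v ⊕ d ⊕ (b ⊕ r)) ⊕ (a ⊖ v ⊕ u)
    add-rem-arith = solve-∀ ring

    distrib₃ : ∀ a b d f → a ⊛ f ⊖ b ⊛ f ⊕ d ⊛ f ≡ (a ⊖ b ⊕ d) ⊛ f
    distrib₃ = solve-∀ ring

content-suc : ∀ x i → ι x ⊖ ι i ≡ ι (suc x) ⊖ ι (suc i)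
content-suc x i = suc-content (ι x) (ι i)

-- If the new box makes the next row as long as the row to be shortened, it blocks the removal; in
-- the other order the shortened row blocks the addition. So the same pairs survive on both sides.
shrink-add : ∀ i (w : ℚ → ℚ) (φ : List ℕ → ℚ) x xs → Cap (suc x) xs →
  addΣ (suc x) (suc i) (λ a ν → w a ⊛ when (headOr0 ν <ᵇ suc x) (φ (shrink (suc x) ν))) xs
  ≡ when (headOr0 xs <ᵇ suc x) (addΣ x (suc i) (λ a ν → w a ⊛ φ (x ∷ ν)) xs)
shrink-add i w φ zero [] _ = *-zeroʳ (w _)
shrink-add i w φ zero (.1 ∷ xs) (s≤s z≤n ∷ _) = trans (cong₂ _⊕_ refl (trans (addΣ-cong 1 (suc (suc i)) xs (λ a ν → *-zeroʳ (w a))) (addΣ-0 1 (suc (suc i)) xs))) (+-identityˡ 0ℚ)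
shrink-add i w φ (suc x) [] _ = refl
shrink-add i w φ (suc x) (suc y ∷ ys) (p ∷ ps) with ℕP.m≤n⇒m<n∨m≡n p
... | inj₂ refl rewrite <ᵇ-false (ℕP.≤-refl {x}) =
  trans (cong₂ _⊕_ refl (trans (addΣ-cong _ (suc (suc i)) ys (λ a ν → *-zeroʳ (w a))) (addΣ-0 _ (suc (suc i)) ys))) (+-identityˡ 0ℚ)
... | inj₁ q rewrite <ᵇ-true q = cong₂ _⊕_ (when-* (y <ᵇ x) _ _) refl

-- Adding and removing a box commute, except that the added box may be the removed one: this is what diag counts.
add-rem : ∀ c i (w : ℚ → ℚ) (φ : List ℕ → ℚ) xs → Cap c xs →
  addΣ c i (λ a ν → w a ⊛ remΣ φ ν) xs
  ≡ remΣ (addΣ c i (λ a ν → w a ⊛ φ ν)) xs ⊕ diag c i w xs ⊛ φ xs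
add-rem c i w φ [] _ with 0 <ᵇ c
... | true  = trans (cong (w _ ⊛_) (+-identityʳ (φ []))) (sym (+-identityˡ _))
... | false = sym (trans (+-identityˡ _) (*-zeroˡ _))
add-rem c i w φ (suc x ∷ xs) (p ∷ ps) = begin
  when (suc x <ᵇ c) (w a₀ ⊛ (when (headOr0 xs <ᵇ suc (suc x)) (φ (suc x ∷ xs)) ⊕ R₁)) ⊕ addΣ (suc x) (suc i) (λ a ν → w a ⊛ remΣ φ (suc x ∷ ν)) xs
    ≡⟨ cong₂ _⊕_ (cong (λ b → when (suc x <ᵇ c) (w a₀ ⊛ (when b (φ (suc x ∷ xs)) ⊕ R₁))) (<ᵇ-true (s≤s (Cap-head ps)))) (trans (addΣ-cong (suc x) (suc i) xs (λ a ν → *-distribˡ-+ (w a) _ _)) (addΣ-+ (suc x) (suc i) _ _ xs)) ⟩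
  when (suc x <ᵇ c) (w a₀ ⊛ (φ (suc x ∷ xs) ⊕ R₁)) ⊕ (addΣ (suc x) (suc i) (λ a ν → w a ⊛ when (headOr0 ν <ᵇ suc x) (φ (shrink (suc x) ν))) xs ⊕ addΣ (suc x) (suc i) (λ a ν → w a ⊛ remΣ (φ ∘ (suc x ∷_)) ν) xs)
    ≡⟨ cong₂ _⊕_ (trans (cong (when (suc x <ᵇ c)) (*-distribˡ-+ (w a₀) _ _)) (when-+ (suc x <ᵇ c) _ _)) (cong₂ _⊕_ (shrink-add i w φ x xs ps) (add-rem (suc x) (suc i) w (φ ∘ (suc x ∷_)) xs ps)) ⟩
  (when (suc x <ᵇ c) (w a₀ ⊛ φ (suc x ∷ xs)) ⊕ when (suc x <ᵇ c) (w a₀ ⊛ R₁)) ⊕ (when (headOr0 xs <ᵇ suc x) A₁ ⊕ (R₂ ⊕ diag (suc x) (suc i) w xs ⊛ φ (suc x ∷ xs)))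
    -- The last argument is the term in which the box removed from the first row is put back. Only
    -- the order "remove, then add" contains it, so it is inserted there and subtracted again in
    -- `diag`.
    ≡⟨ add-rem-arith (when (suc x <ᵇ c) (w a₀ ⊛ φ (suc x ∷ xs))) (when (suc x <ᵇ c) (w a₀ ⊛ R₁)) (when (headOr0 xs <ᵇ suc x) A₁) R₂ (diag (suc x) (suc i) w xs ⊛ φ (suc x ∷ xs)) (when (headOr0 xs <ᵇ suc x) (w a₁ ⊛ φ (suc x ∷ xs))) ⟩
  (when (headOr0 xs <ᵇ suc x) (w a₁ ⊛ φ (suc x ∷ xs)) ⊕ when (headOr0 xs <ᵇ suc x) A₁ ⊕ (when (suc x <ᵇ c) (w a₀ ⊛ R₁) ⊕ R₂)) ⊕ (when (suc x <ᵇ c) (w a₀ ⊛ φ (suc x ∷ xs)) ⊖ when (headOr0 xs <ᵇ suc x) (w a₁ ⊛ φ (suc x ∷ xs)) ⊕ diag (suc x) (suc i) w xs ⊛ φ (suc x ∷ xs))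
    ≡⟨ cong₂ _⊕_ (cong₂ _⊕_ (trans (sym (when-+ (headOr0 xs <ᵇ suc x) _ _)) (first x xs p ps)) second) third ⟩
  remΣ (addΣ c i (λ a ν → w a ⊛ φ ν)) (suc x ∷ xs) ⊕ diag c i w (suc x ∷ xs) ⊛ φ (suc x ∷ xs) ∎
  where
  a₀ = ι (suc x) ⊖ ι i
  a₁ = ι (suc x) ⊖ ι (suc i)
  R₁ = remΣ (φ ∘ (suc (suc x) ∷_)) xs
  A₁ = addΣ x (suc i) (λ a ν → w a ⊛ φ (x ∷ ν)) xs
  R₂ = remΣ (addΣ (suc x) (suc i) (λ a ν → w a ⊛ φ (suc x ∷ ν))) xs
  -- The same box has the content `ι x ⊖ ι i` when it is put back and the content
  -- `ι (suc x) ⊖ ι (suc i)` when it is removed. If its row had length 1, it returns through the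
  -- clause of `addΣ` for the empty diagram.
  first : ∀ x xs → suc x ≤ c → Cap (suc x) xs → when (headOr0 xs <ᵇ suc x) (w (ι (suc x) ⊖ ι (suc i)) ⊛ φ (suc x ∷ xs) ⊕ addΣ x (suc i) (λ a ν → w a ⊛ φ (x ∷ ν)) xs) ≡ when (headOr0 xs <ᵇ suc x) (addΣ c i (λ a ν → w a ⊛ φ ν) (shrink (suc x) xs))
  first zero [] p _ rewrite <ᵇ-true p = trans (+-identityʳ _) (cong (λ a → w a ⊛ φ (1 ∷ [])) (sym (content-suc 0 i)))
  first zero (.1 ∷ xs) p (s≤s z≤n ∷ _) = refl
  first (suc x) xs p _ rewrite <ᵇ-true p = cong (λ a → when (headOr0 xs <ᵇ suc (suc x)) (w a ⊛ φ (suc (suc x) ∷ xs) ⊕ addΣ (suc x) (suc i) (λ a ν → w a ⊛ φ (suc x ∷ ν)) xs)) (sym (content-suc (suc x) i))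
  second : when (suc x <ᵇ c) (w a₀ ⊛ R₁) ⊕ R₂ ≡ remΣ (λ ν → addΣ c i (λ a ν → w a ⊛ φ ν) (suc x ∷ ν)) xs
  second = sym (trans (remΣ-+ _ _ xs) (cong (_⊕ R₂) (trans (remΣ-when (suc x <ᵇ c) _ xs) (cong (when (suc x <ᵇ c)) (remΣ-* (w a₀) _ xs)))))
  third : when (suc x <ᵇ c) (w a₀ ⊛ φ (suc x ∷ xs)) ⊖ when (headOr0 xs <ᵇ suc x) (w a₁ ⊛ φ (suc x ∷ xs)) ⊕ diag (suc x) (suc i) w xs ⊛ φ (suc x ∷ xs) ≡ diag c i w (suc x ∷ xs) ⊛ φ (suc x ∷ xs)
  third = trans (cong₂ (λ u v → u ⊖ v ⊕ diag (suc x) (suc i) w xs ⊛ φ (suc x ∷ xs)) (pull (suc x <ᵇ c) (w a₀)) (pull (headOr0 xs <ᵇ suc x) (w a₁))) (distrib₃ _ _ _ _)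
    where
    pull : ∀ b p → when b (p ⊛ φ (suc x ∷ xs)) ≡ when b p ⊛ φ (suc x ∷ xs)
    pull true  _ = refl
    pull false _ = sym (*-zeroˡ _)

-- Content moments

opaque
  unfolding _⊕_

  ι-+ : ∀ m n → ι (m + n) ≡ ι m ⊕ ι n
  ι-+ zero    n = sym (ℚP.+-identityˡ (ι n))
  ι-+ (suc m) n = trans (cong (1ℚ ℚ.+_) (ι-+ m n)) (sym (ℚP.+-assoc 1ℚ (ι m) (ι n)))

  ι-* : ∀ m n → ι (m * n) ≡ ι m ⊛ ι n
  ι-* zero    n = sym (ℚP.*-zeroˡ (ι n))
  ι-* (suc m) n = trans (ι-+ n (m * n)) (trans (cong (ι n ℚ.+_) (ι-* m n)) (expand (ι m) (ι n)))
    where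
    expand : ∀ a b → b ⊕ a ⊛ b ≡ (1ℚ ⊕ a) ⊛ b
    expand = solve-∀ ring

  private
    corner-keep : ∀ u v d → u ⊖ v ⊕ (d ⊕ 0ℚ) ≡ (u ⊖ v ⊕ d) ⊕ 0ℚ
    corner-keep = solve-∀ ring

    corner-move : ∀ u v d → u ⊖ v ⊕ (d ⊕ v) ≡ (u ⊖ 0ℚ ⊕ d) ⊕ 0ℚ
    corner-move = solve-∀ ring

    corner-keep′ : ∀ u v d → u ⊖ v ⊕ (d ⊕ 0ℚ) ≡ (0ℚ ⊖ v ⊕ d) ⊕ u
    corner-keep′ = solve-∀ ring

    corner-move′ : ∀ u v d → u ⊖ v ⊕ (d ⊕ v) ≡ (0ℚ ⊖ 0ℚ ⊕ d) ⊕ u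
    corner-move′ = solve-∀ ring

    square-corner₀ : ∀ K i → K ⊖ (0ℚ ⊖ i) ⊛ (0ℚ ⊖ i) ≡ K ⊖ i ⊛ i ⊖ (1ℚ ⊕ 1ℚ) ⊛ 0ℚ
    square-corner₀ = solve-∀ ring

    square-corner : ∀ K i x s →
      (K ⊖ (x ⊖ i) ⊛ (x ⊖ i)) ⊖ (K ⊖ (x ⊖ (1ℚ ⊕ i)) ⊛ (x ⊖ (1ℚ ⊕ i))) ⊕ (K ⊖ (1ℚ ⊕ i) ⊛ (1ℚ ⊕ i) ⊖ (1ℚ ⊕ 1ℚ) ⊛ s)
      ≡ K ⊖ i ⊛ i ⊖ (1ℚ ⊕ 1ℚ) ⊛ (x ⊕ s)
    square-corner = solve-∀ ring

corner : ℕ → (ℚ → ℚ) → List ℕ → ℚ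
corner i w []       = w (ι 0 ⊖ ι i)
corner i w (x ∷ xs) = w (ι x ⊖ ι i) ⊖ w (ι x ⊖ ι (suc i)) ⊕ corner (suc i) w xs

-- A row that cannot be extended and the row above it, which cannot be shortened, contribute the same
-- content with opposite signs, so that diag may be computed as if all rows were free.
diag-corner : ∀ c i w xs → Cap (suc c) xs →
  corner i w xs ≡ diag (suc c) i w xs ⊕ when (not (headOr0 xs <ᵇ suc c)) (w (ι (suc c) ⊖ ι i))
diag-corner c i w [] _ = sym (+-identityʳ _)
diag-corner c i w (suc x ∷ xs) (p ∷ ps) = trans (cong (λ z → w (ι (suc x) ⊖ ι i) ⊖ w (ι (suc x) ⊖ ι (suc i)) ⊕ z) (diag-corner x (suc i) w xs ps)) (split (headOr0 xs <ᵇ suc x) (ℕP.m≤n⇒m<n∨m≡n p))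
  where
  split : ∀ b → suc x < suc c ⊎ suc x ≡ suc c →
    w (ι (suc x) ⊖ ι i) ⊖ w (ι (suc x) ⊖ ι (suc i)) ⊕ (diag (suc x) (suc i) w xs ⊕ when (not b) (w (ι (suc x) ⊖ ι (suc i))))
    ≡ (when (x <ᵇ c) (w (ι (suc x) ⊖ ι i)) ⊖ when b (w (ι (suc x) ⊖ ι (suc i))) ⊕ diag (suc x) (suc i) w xs) ⊕ when (not (x <ᵇ c)) (w (ι (suc c) ⊖ ι i))
  split true  (inj₁ (s≤s q)) rewrite <ᵇ-true q = corner-keep _ _ _
  split false (inj₁ (s≤s q)) rewrite <ᵇ-true q = corner-move _ _ _
  split true  (inj₂ refl) rewrite <ᵇ-false (ℕP.≤-refl {x}) = corner-keep′ _ _ _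
  split false (inj₂ refl) rewrite <ᵇ-false (ℕP.≤-refl {x}) = corner-move′ _ _ _

-- Under the bound `suc c` the first row can always grow, so the correction in `diag-corner` is 0.
diag-free : ∀ c i w xs → Cap c xs → diag (suc c) i w xs ≡ corner i w xs
diag-free c i w xs ps = sym (trans (diag-corner c i w xs (Cap-≤ (ℕP.n≤1+n c) ps)) (trans (cong (λ b → diag (suc c) i w xs ⊕ when (not b) (w (ι (suc c) ⊖ ι i))) (<ᵇ-true (s≤s (Cap-head ps)))) (+-identityʳ _)))

-- A row of length x contributes 1 - 2(x - i). Passing from the square of i + 1 to that of i absorbs
-- all of this except -2x.
corner-square : ∀ K i xs → corner i (λ a → K ⊖ a ⊛ a) xs ≡ K ⊖ ι i ⊛ ι i ⊖ ι 2 ⊛ ι (size xs)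
corner-square K i []       = trans (square-corner₀ K (ι i)) (cong (λ z → K ⊖ ι i ⊛ ι i ⊖ (1ℚ ⊕ z) ⊛ 0ℚ) (sym (+-identityʳ 1ℚ)))
corner-square K i (x ∷ xs) = begin
  (K ⊖ (ι x ⊖ ι i) ⊛ (ι x ⊖ ι i)) ⊖ (K ⊖ (ι x ⊖ ι (suc i)) ⊛ (ι x ⊖ ι (suc i))) ⊕ corner (suc i) (λ a → K ⊖ a ⊛ a) xs
    ≡⟨ cong (λ z → (K ⊖ (ι x ⊖ ι i) ⊛ (ι x ⊖ ι i)) ⊖ (K ⊖ (ι x ⊖ ι (suc i)) ⊛ (ι x ⊖ ι (suc i))) ⊕ z) (trans (corner-square K (suc i) xs) (cong (λ z → K ⊖ ι (suc i) ⊛ ι (suc i) ⊖ (1ℚ ⊕ z) ⊛ ι (size xs)) (+-identityʳ 1ℚ))) ⟩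
  _
    ≡⟨ square-corner K (ι i) (ι x) (ι (size xs)) ⟩
  K ⊖ ι i ⊛ ι i ⊖ (1ℚ ⊕ 1ℚ) ⊛ (ι x ⊕ ι (size xs))
    ≡⟨ cong₂ (λ y z → K ⊖ ι i ⊛ ι i ⊖ (1ℚ ⊕ y) ⊛ z) (sym (+-identityʳ 1ℚ)) (sym (ι-+ x (size xs))) ⟩
  K ⊖ ι i ⊛ ι i ⊖ ι 2 ⊛ ι (x + size xs) ∎

-- Chain counts as sums over boxes

removeBox-remΣ : ∀ (f : List ℕ → ℕ) xs → ι (sum (map f (removeBox xs))) ≡ remΣ (ι ∘ f) xs
removeBox-remΣ f []       = refl
removeBox-remΣ f (x ∷ xs) = begin
  ι (sum (map f (first ++ map (x ∷_) (removeBox xs))))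
    ≡⟨ cong (ι ∘ sum) (LP.map-++ f first _) ⟩
  ι (sum (map f first ++ map f (map (x ∷_) (removeBox xs))))
    ≡⟨ cong ι (sum-++ (map f first) _) ⟩
  ι (sum (map f first) + sum (map f (map (x ∷_) (removeBox xs))))
    ≡⟨ ι-+ (sum (map f first)) _ ⟩
  ι (sum (map f first)) ⊕ ι (sum (map f (map (x ∷_) (removeBox xs))))
    ≡⟨ cong₂ _⊕_ (corner-box x (headOr0 xs <ᵇ x) refl) (trans (cong (ι ∘ sum) (sym (LP.map-∘ (removeBox xs)))) (removeBox-remΣ (f ∘ (x ∷_)) xs)) ⟩
  remΣ (ι ∘ f) (x ∷ xs) ∎
  where
  first = if headOr0 xs <ᵇ x then (if x ≡ᵇ 1 then xs ∷ [] else (pred x ∷ xs) ∷ []) else []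
  corner-box : ∀ x b → (headOr0 xs <ᵇ x) ≡ b → ι (sum (map f (if b then (if x ≡ᵇ 1 then xs ∷ [] else (pred x ∷ xs) ∷ []) else []))) ≡ when b (ι (f (shrink x xs)))
  corner-box x             false _ = refl
  corner-box 1             true  _ = cong ι (ℕP.+-identityʳ (f xs))
  corner-box (suc (suc x)) true  _ = cong ι (ℕP.+-identityʳ (f (suc x ∷ xs)))

Dim : ℕ → List ℕ → List ℕ → ℚ
Dim m μ ν = ι (dimAux m μ ν)

Dim-suc : ∀ m μ ν → Dim (suc m) μ ν ≡ remΣ (Dim m μ) ν
Dim-suc m μ ν = removeBox-remΣ (dimAux m μ) ν

remΣ-congCap : ∀ {c φ φ′} xs → Cap c xs → (∀ ν → Cap c ν → suc (size ν) ≡ size xs → φ ν ≡ φ′ ν) → remΣ φ xs ≡ remΣ φ′ xs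
remΣ-congCap []                 _        h = refl
remΣ-congCap {c} {φ} {φ′} (suc x ∷ xs) (p ∷ ps) h = cong₂ _⊕_ (shrunk x xs p ps h) (remΣ-congCap xs ps λ ν q e → h (suc x ∷ ν) (p ∷ q) (trans (cong suc (sym (ℕP.+-suc x (size ν)))) (cong (λ z → suc x + z) e)))
  where
  shrunk : ∀ x xs → suc x ≤ c → Cap (suc x) xs → (∀ ν → Cap c ν → suc (size ν) ≡ suc x + size xs → φ ν ≡ φ′ ν) →
           when (headOr0 xs <ᵇ suc x) (φ (shrink (suc x) xs)) ≡ when (headOr0 xs <ᵇ suc x) (φ′ (shrink (suc x) xs))
  shrunk zero    []             p _               h = h [] [] refl
  shrunk zero    (suc zero ∷ xs) p (s≤s z≤n ∷ _)  h = refl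
  shrunk (suc x) []             p _               h = h _ (ℕP.<⇒≤ p ∷ []) refl
  shrunk (suc x) (suc y ∷ ys)   p (q ∷ qs)        h with ℕP.m≤n⇒m<n∨m≡n q
  ... | inj₁ (s≤s r) rewrite <ᵇ-true r = h _ (ℕP.<⇒≤ p ∷ (r ∷ qs)) refl
  ... | inj₂ refl rewrite <ᵇ-false (ℕP.≤-refl {x}) = refl

addΣ-congCap : ∀ {c} i {ψ ψ′} xs → Cap c xs → (∀ a ν → Cap c ν → size ν ≡ suc (size xs) → ψ a ν ≡ ψ′ a ν) → addΣ c i ψ xs ≡ addΣ c i ψ′ xs
addΣ-congCap {zero}  i []           _        h = refl
addΣ-congCap {zero}  i (_ ∷ _)      (() ∷ _) h
addΣ-congCap {suc c} i []           _        h = h _ _ (s≤s z≤n ∷ []) refl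
addΣ-congCap {suc c} i {ψ} {ψ′} (suc x ∷ xs) (p ∷ ps) h = cong₂ _⊕_ (enlarged (ℕP.m≤n⇒m<n∨m≡n p)) (addΣ-congCap (suc i) xs ps λ a ν q e → h a (suc x ∷ ν) (p ∷ q) (trans (cong (λ z → suc x + z) e) (ℕP.+-suc (suc x) (size xs))))
  where
  enlarged : suc x < suc c ⊎ suc x ≡ suc c → when (x <ᵇ c) (ψ (ι (suc x) ⊖ ι i) (suc (suc x) ∷ xs)) ≡ when (x <ᵇ c) (ψ′ (ι (suc x) ⊖ ι i) (suc (suc x) ∷ xs))
  enlarged (inj₁ q) rewrite <ᵇ-true (ℕP.≤-pred q) = h _ _ (q ∷ Cap-≤ (ℕP.n≤1+n _) ps) refl
  enlarged (inj₂ refl) rewrite <ᵇ-false (ℕP.≤-refl {x}) = refl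

-- Once the addition is commuted past the removal that defines `Dim (suc n)`, the induction
-- hypothesis yields the value of t one step lower and the commutator yields γ n. Hence t is the
-- sequence of partial sums of γ. That the commutator depends on the size alone makes the induction
-- possible.
contentMoment : ∀ (w : ℚ → ℚ) (γ t : ℕ → ℚ) → (∀ μ → corner 0 w μ ≡ γ (size μ)) → t 0 ≡ γ 0 → (∀ n → t (suc n) ≡ t n ⊕ γ (suc n)) →
  ∀ n {c} μ → Cap c μ → size μ ≡ n → addΣ (suc c) 0 (λ a ν → w a ⊛ Dim (suc n) [] ν) μ ≡ t n ⊛ Dim n [] μ
contentMoment w γ t corner≡γ t₀ tₛ n {c} μ ps e = begin
  addΣ (suc c) 0 (λ a ν → w a ⊛ Dim (suc n) [] ν) μ
    ≡⟨ addΣ-cong (suc c) 0 μ (λ a ν → cong (w a ⊛_) (Dim-suc n [] ν)) ⟩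
  addΣ (suc c) 0 (λ a ν → w a ⊛ remΣ (Dim n []) ν) μ
    ≡⟨ add-rem (suc c) 0 w (Dim n []) μ (Cap-≤ (ℕP.n≤1+n c) ps) ⟩
  remΣ (addΣ (suc c) 0 (λ a ν → w a ⊛ Dim n [] ν)) μ ⊕ diag (suc c) 0 w μ ⊛ Dim n [] μ
    ≡⟨ cong (λ z → remΣ (addΣ (suc c) 0 (λ a ν → w a ⊛ Dim n [] ν)) μ ⊕ z ⊛ Dim n [] μ) (trans (diag-free c 0 w μ ps) (trans (corner≡γ μ) (cong γ e))) ⟩
  remΣ (addΣ (suc c) 0 (λ a ν → w a ⊛ Dim n [] ν)) μ ⊕ γ n ⊛ Dim n [] μ
    ≡⟨ lower n μ ps e ⟩
  t n ⊛ Dim n [] μ ∎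
  where
  lower : ∀ n μ → Cap c μ → size μ ≡ n → remΣ (addΣ (suc c) 0 (λ a ν → w a ⊛ Dim n [] ν)) μ ⊕ γ n ⊛ Dim n [] μ ≡ t n ⊛ Dim n [] μ
  lower zero    []      _  _ = trans (+-identityˡ _) (cong (_⊛ Dim 0 [] []) (sym t₀))
  lower zero    (_ ∷ _) (_ ∷ _) ()
  lower (suc n) μ       ps e = begin
    remΣ (addΣ (suc c) 0 (λ a ν → w a ⊛ Dim (suc n) [] ν)) μ ⊕ γ (suc n) ⊛ Dim (suc n) [] μ
      ≡⟨ cong (_⊕ γ (suc n) ⊛ Dim (suc n) [] μ) (remΣ-congCap μ ps (λ ν qs e′ → contentMoment w γ t corner≡γ t₀ tₛ n ν qs (ℕP.suc-injective (trans e′ e)))) ⟩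
    remΣ (λ ν → t n ⊛ Dim n [] ν) μ ⊕ γ (suc n) ⊛ Dim (suc n) [] μ
      ≡⟨ cong (_⊕ γ (suc n) ⊛ Dim (suc n) [] μ) (trans (remΣ-* (t n) (Dim n []) μ) (cong (t n ⊛_) (sym (Dim-suc n [] μ)))) ⟩
    t n ⊛ Dim (suc n) [] μ ⊕ γ (suc n) ⊛ Dim (suc n) [] μ
      ≡⟨ trans (sym (*-distribʳ-+ (Dim (suc n) [] μ) (t n) (γ (suc n)))) (cong (_⊛ Dim (suc n) [] μ) (sym (tₛ n))) ⟩
    t (suc n) ⊛ Dim (suc n) [] μ ∎

-- Chains to a fixed diagram

opaque
  unfolding _⊕_

  private
    box-arith : ∀ w θ → (1ℚ ⊛ w ⊛ 1ℚ) ⊛ θ ≡ 1ℚ ⊛ (w ⊛ θ)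
    box-arith = solve-∀ ring

    row-arith : ∀ r w d θ → (r ⊛ w ⊛ d) ⊛ θ ≡ (r ⊛ d) ⊛ (w ⊛ θ)
    row-arith = solve-∀ ring

  +-assoc : ∀ p q r → (p ⊕ q) ⊕ r ≡ p ⊕ (q ⊕ r)
  +-assoc = ℚP.+-assoc

  *-assoc : ∀ p q r → (p ⊛ q) ⊛ r ≡ p ⊛ (q ⊛ r)
  *-assoc = ℚP.*-assoc

  *-comm : ∀ p q → p ⊛ q ≡ q ⊛ p
  *-comm = ℚP.*-comm

  *-identityˡ : ∀ p → 1ℚ ⊛ p ≡ p
  *-identityˡ = ℚP.*-identityˡ

  *-identityʳ : ∀ p → p ⊛ 1ℚ ≡ p
  *-identityʳ = ℚP.*-identityʳ

  ι≡toℚ : ∀ n → ι n ≡ toℚ n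
  ι≡toℚ zero    = refl
  ι≡toℚ (suc n) = begin
    1ℚ ℚ.+ ι n                            ≡⟨ cong (1ℚ ℚ.+_) (trans (ι≡toℚ n) (ℚP.normalize-coprime {n} 1-coprime)) ⟩
    1ℚ ℚ.+ ℚ.mkℚ (+ n) 0 1-coprime        ≡⟨ cong (λ z → (+ 1 ℤ.+ z) ℚ./ 1) (ℤP.*-identityʳ (+ n)) ⟩
    toℚ (suc n) ∎
    where
    1-coprime : ∀ {n} → Coprime n 1
    1-coprime {n} = Coprimality.sym (Coprimality.1-coprimeTo n)

ι-pos : ∀ n → 0 < n → ℚ.Positive (ι n)
ι-pos n@(suc _) _ = subst ℚ.Positive (sym (ι≡toℚ n)) (ℚP.normalize-pos n 1)

opaque
  unfolding _⊕_

  *-cancelˡ-pos : ∀ r {p q} → ℚ.Positive r → r ⊛ p ≡ r ⊛ q → p ≡ q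
  *-cancelˡ-pos r {p} {q} r>0 e = ℚP.≤-antisym (ℚP.*-cancelˡ-≤-pos r {{r>0}} (ℚP.≤-reflexive e)) (ℚP.*-cancelˡ-≤-pos r {{r>0}} (ℚP.≤-reflexive (sym e)))

  pos-* : ∀ {p q} → ℚ.Positive p → ℚ.Positive q → ℚ.Positive (p ⊛ q)
  pos-* {p} {q} a b = ℚP.pos*pos⇒pos p {{a}} q {{b}}

!-pos : ∀ n → 0 < n !
!-pos n = ℕP.n≢0⇒n>0 (ℕP.m<n⇒n≢0 {0} (ℕP.1≤n! n))

rowProd : ℚ → ℕ → ℕ → ℚ
rowProd K i zero    = 1ℚ
rowProd K i (suc x) = rowProd K i x ⊛ (K ⊖ (ι x ⊖ ι i) ⊛ (ι x ⊖ ι i))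

contentProd : ℚ → ℕ → List ℕ → ℚ
contentProd K i []       = 1ℚ
contentProd K i (x ∷ xs) = rowProd K i x ⊛ contentProd K (suc i) xs

addΣ-contentProd : ∀ c i K θ xs → addΣ c i (λ _ ν → contentProd K i ν ⊛ θ ν) xs ≡ contentProd K i xs ⊛ addΣ c i (λ a ν → (K ⊖ a ⊛ a) ⊛ θ ν) xs
addΣ-contentProd c i K θ []       = trans (cong (when (0 <ᵇ c)) (box-arith _ _)) (sym (when-* (0 <ᵇ c) 1ℚ _))
addΣ-contentProd c i K θ (x ∷ xs) = begin
  when (x <ᵇ c) ((rowProd K i x ⊛ κ ⊛ contentProd K (suc i) xs) ⊛ θ (suc x ∷ xs)) ⊕ addΣ x (suc i) (λ _ ν → (rowProd K i x ⊛ contentProd K (suc i) ν) ⊛ θ (x ∷ ν)) xs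
    ≡⟨ cong₂ _⊕_ (trans (cong (when (x <ᵇ c)) (row-arith _ _ _ _)) (sym (when-* (x <ᵇ c) _ _)))
         (trans (addΣ-cong x (suc i) xs (λ _ ν → *-assoc _ _ _)) (trans (addΣ-* x (suc i) (rowProd K i x) _ xs)
         (trans (cong (rowProd K i x ⊛_) (addΣ-contentProd x (suc i) K (θ ∘ (x ∷_)) xs)) (sym (*-assoc _ _ _))))) ⟩
  (rowProd K i x ⊛ contentProd K (suc i) xs) ⊛ when (x <ᵇ c) (κ ⊛ θ (suc x ∷ xs)) ⊕ (rowProd K i x ⊛ contentProd K (suc i) xs) ⊛ addΣ x (suc i) (λ a ν → (K ⊖ a ⊛ a) ⊛ θ (x ∷ ν)) xs
    ≡⟨ sym (*-distribˡ-+ _ _ _) ⟩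
  contentProd K i (x ∷ xs) ⊛ addΣ c i (λ a ν → (K ⊖ a ⊛ a) ⊛ θ ν) (x ∷ xs) ∎
  where
  κ = K ⊖ (ι x ⊖ ι i) ⊛ (ι x ⊖ ι i)

≡ᵇ-refl : ∀ n → (n ≡ᵇ n) ≡ true
≡ᵇ-refl zero    = refl
≡ᵇ-refl (suc n) = ≡ᵇ-refl n

≢⇒≡ᵇ-false : ∀ {m n} → m ≢ n → (m ≡ᵇ n) ≡ false
≢⇒≡ᵇ-false {zero}  {zero}  h = ⊥-elim (h refl)
≢⇒≡ᵇ-false {zero}  {suc n} h = refl
≢⇒≡ᵇ-false {suc m} {zero}  h = refl
≢⇒≡ᵇ-false {suc m} {suc n} h = ≢⇒≡ᵇ-false (h ∘ cong suc)

Dim-0-∷ : ∀ x xs y ys → Dim 0 (x ∷ xs) (y ∷ ys) ≡ when (x ≡ᵇ y) (Dim 0 xs ys)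
Dim-0-∷ x xs y ys with x ≡ᵇ y
... | true  = refl
... | false = refl

Dim-0-≡ : ∀ xs → Dim 0 xs xs ≡ 1ℚ
Dim-0-≡ xs = trans (cong (λ b → ι (if b then 1 else 0)) (dec-true (≡-dec ℕP._≟_ xs xs) refl)) (+-identityʳ 1ℚ)

Dim-0-≢ : ∀ xs ys → xs ≢ ys → Dim 0 xs ys ≡ 0ℚ
Dim-0-≢ xs ys h = cong (λ b → ι (if b then 1 else 0)) (dec-false (≡-dec ℕP._≟_ xs ys) h)

-- Both sides ask whether ν is μ with one more box. The common bound c on μ and ν ensures that the
-- test in `addΣ` loses no such box.
remΣ-Dim₀ : ∀ c i μ ν → Cap c μ → Cap c ν → remΣ (Dim 0 μ) ν ≡ addΣ c i (λ _ μ′ → Dim 0 μ′ ν) μ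
remΣ-Dim₀ c i []       []                 _ _ = sym (when-0 (0 <ᵇ c))
remΣ-Dim₀ c i (x ∷ xs) []                 _ _ = sym (trans (cong₂ _⊕_ (when-0 (x <ᵇ c)) (addΣ-0 x (suc i) xs)) (+-identityˡ 0ℚ))
remΣ-Dim₀ c i []       (suc zero ∷ [])    _ (s≤s z≤n ∷ _) = +-identityʳ _
remΣ-Dim₀ c i []       (suc zero ∷ suc zero ∷ ys) _ (p ∷ s≤s z≤n ∷ _) =
  trans (+-identityˡ _) (trans (remΣ-0 (1 ∷ ys)) (sym (when-0 (0 <ᵇ c))))
remΣ-Dim₀ c i []       (suc (suc y) ∷ ys) _ _ = trans (cong₂ _⊕_ (when-0 (headOr0 ys <ᵇ suc (suc y))) (remΣ-0 ys)) (trans (+-identityˡ 0ℚ) (sym (when-0 (0 <ᵇ c))))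
remΣ-Dim₀ c i (suc x ∷ xs) (suc y ∷ ys) (p ∷ ps) (q ∷ qs) = cong₂ _⊕_ (head-box y ys q qs) tail-box
  where
  head-box : ∀ y ys → suc y ≤ c → Cap (suc y) ys → when (headOr0 ys <ᵇ suc y) (Dim 0 (suc x ∷ xs) (shrink (suc y) ys)) ≡ when (suc x <ᵇ c) (Dim 0 (suc (suc x) ∷ xs) (suc y ∷ ys))
  head-box zero    []                 q _             = sym (when-0 (suc x <ᵇ c))
  head-box zero    (suc zero ∷ ys)    q (s≤s z≤n ∷ _) = sym (when-0 (suc x <ᵇ c))
  head-box (suc y) ys                 q qs = go (x ℕP.≟ y) (≡-dec ℕP._≟_ xs ys)
    where
    go : Dec (x ≡ y) → Dec (xs ≡ ys) → when (headOr0 ys <ᵇ suc (suc y)) (Dim 0 (suc x ∷ xs) (suc y ∷ ys)) ≡ when (suc x <ᵇ c) (Dim 0 (suc (suc x) ∷ xs) (suc (suc y) ∷ ys))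
    go (no h) _ = trans (when-≡0 (headOr0 ys <ᵇ suc (suc y)) (Dim-0-≢ (suc x ∷ xs) (suc y ∷ ys) (h ∘ ℕP.suc-injective ∘ LP.∷-injectiveˡ)))
                    (sym (when-≡0 (suc x <ᵇ c) (Dim-0-≢ (suc (suc x) ∷ xs) (suc (suc y) ∷ ys) (h ∘ ℕP.suc-injective ∘ ℕP.suc-injective ∘ LP.∷-injectiveˡ))))
    go (yes refl) (yes refl) = cong₂ when (trans (<ᵇ-true (s≤s (Cap-head ps))) (sym (<ᵇ-true q))) (trans (Dim-0-≡ (suc x ∷ xs)) (sym (Dim-0-≡ (suc (suc x) ∷ xs))))
    go (yes refl) (no h) = trans (when-≡0 (headOr0 ys <ᵇ suc (suc x)) (Dim-0-≢ (suc x ∷ xs) (suc x ∷ ys) (h ∘ LP.∷-injectiveʳ))) (sym (when-≡0 (suc x <ᵇ c) (Dim-0-≢ (suc (suc x) ∷ xs) (suc (suc x) ∷ ys) (h ∘ LP.∷-injectiveʳ))))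
  tail-box : remΣ (λ ν → Dim 0 (suc x ∷ xs) (suc y ∷ ν)) ys ≡ addΣ (suc x) (suc i) (λ _ μ → Dim 0 (suc x ∷ μ) (suc y ∷ ys)) xs
  tail-box = begin
    remΣ (λ ν → Dim 0 (suc x ∷ xs) (suc y ∷ ν)) ys
      ≡⟨ trans (remΣ-cong ys (λ ν → Dim-0-∷ (suc x) xs (suc y) ν)) (remΣ-when (x ≡ᵇ y) _ ys) ⟩
    when (x ≡ᵇ y) (remΣ (Dim 0 xs) ys)
      ≡⟨ rest (x ℕP.≟ y) ⟩
    when (x ≡ᵇ y) (addΣ (suc x) (suc i) (λ _ μ → Dim 0 μ ys) xs)
      ≡⟨ sym (trans (addΣ-cong (suc x) (suc i) xs (λ _ ν → Dim-0-∷ (suc x) ν (suc y) ys)) (addΣ-when (suc x) (suc i) (x ≡ᵇ y) _ xs)) ⟩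
    addΣ (suc x) (suc i) (λ _ μ → Dim 0 (suc x ∷ μ) (suc y ∷ ys)) xs ∎
    where
    rest : Dec (x ≡ y) → when (x ≡ᵇ y) (remΣ (Dim 0 xs) ys) ≡ when (x ≡ᵇ y) (addΣ (suc x) (suc i) (λ _ μ → Dim 0 μ ys) xs)
    rest (yes refl) = cong (when (x ≡ᵇ x)) (remΣ-Dim₀ (suc x) (suc i) xs ys ps qs)
    rest (no h) rewrite ≢⇒≡ᵇ-false h = refl

remΣ-addΣ : ∀ c i (ψ : ℚ → List ℕ → List ℕ → ℚ) μ ν → remΣ (λ ν′ → addΣ c i (λ a μ′ → ψ a μ′ ν′) μ) ν ≡ addΣ c i (λ a μ′ → remΣ (ψ a μ′) ν) μ
remΣ-addΣ c i ψ μ []       = sym (addΣ-0 c i μ)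
remΣ-addΣ c i ψ μ (y ∷ ys) = trans (cong₂ _⊕_ (sym (addΣ-when c i (headOr0 ys <ᵇ y) _ μ)) (remΣ-addΣ c i (λ a μ′ ν → ψ a μ′ (y ∷ ν)) μ ys)) (sym (addΣ-+ c i _ _ μ))

-- `dimAux` peels boxes off the upper end of a chain, but the square has to stay fixed while μ
-- grows. The recursion is moved to the lower end; apart from the last step this is the exchange of
-- two sums over different diagrams.
Dim-suc′ : ∀ {c} i m μ ν → Cap c μ → Cap c ν → Dim (suc m) μ ν ≡ addΣ c i (λ _ μ′ → Dim m μ′ ν) μ
Dim-suc′ {c} i zero    μ ν p q = trans (Dim-suc 0 μ ν) (remΣ-Dim₀ c i μ ν p q)
Dim-suc′ {c} i (suc m) μ ν p q = begin
  Dim (suc (suc m)) μ ν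
    ≡⟨ Dim-suc (suc m) μ ν ⟩
  remΣ (Dim (suc m) μ) ν
    ≡⟨ remΣ-congCap ν q (λ ν′ q′ _ → Dim-suc′ i m μ ν′ p q′) ⟩
  remΣ (λ ν′ → addΣ c i (λ _ μ′ → Dim m μ′ ν′) μ) ν
    ≡⟨ remΣ-addΣ c i (λ _ → Dim m) μ ν ⟩
  addΣ c i (λ _ μ′ → remΣ (Dim m μ′) ν) μ
    ≡⟨ addΣ-cong c i μ (λ _ μ′ → sym (Dim-suc m μ′ ν)) ⟩
  addΣ c i (λ _ μ′ → Dim (suc m) μ′ ν) μ ∎

-- Chains to the square

weight : ℚ → List ℕ → ℚ
weight K μ = contentProd K 0 μ ⊛ Dim (size μ) [] μ

opaque
  unfolding _⊕_

  private
    γ-arith : ∀ K s → K ⊖ 0ℚ ⊛ 0ℚ ⊖ s ≡ K ⊖ s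
    γ-arith = solve-∀ ring

    t₀-arith : ∀ K → (1ℚ ⊕ 0ℚ) ⊛ (K ⊖ 0ℚ) ≡ K ⊖ (1ℚ ⊕ (1ℚ ⊕ 0ℚ)) ⊛ 0ℚ
    t₀-arith = solve-∀ ring

    tₛ-arith : ∀ K n → (1ℚ ⊕ (1ℚ ⊕ n)) ⊛ (K ⊖ (1ℚ ⊕ n)) ≡ (1ℚ ⊕ n) ⊛ (K ⊖ n) ⊕ (K ⊖ (1ℚ ⊕ (1ℚ ⊕ 0ℚ)) ⊛ (1ℚ ⊕ n))
    tₛ-arith = solve-∀ ring

    swap-arith : ∀ a b c → a ⊛ (b ⊛ c) ≡ b ⊛ (a ⊛ c)
    swap-arith = solve-∀ ring

    regroup₁ : ∀ n e f m r → n ⊛ (e ⊛ (f ⊛ (m ⊛ r))) ≡ (f ⊛ r) ⊛ (n ⊛ m ⊛ e)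
    regroup₁ = solve-∀ ring

    regroup₂ : ∀ e n r d → e ⊛ ((n ⊛ r) ⊛ d) ≡ n ⊛ (e ⊛ (r ⊛ d))
    regroup₂ = solve-∀ ring

    zero-factor : ∀ r a → r ⊛ (a ⊖ a) ≡ 0ℚ
    zero-factor = solve-∀ ring

    square-0 : ∀ a → a ⊛ a ≡ (a ⊖ 0ℚ) ⊛ (a ⊖ 0ℚ)
    square-0 = solve-∀ ring

    0-square : ∀ a → a ⊛ a ≡ (0ℚ ⊖ a) ⊛ (0ℚ ⊖ a)
    0-square = solve-∀ ring

opaque
  unfolding _⊕_

  sub-add : ∀ a b → a ⊕ b ⊖ a ≡ b
  sub-add = solve-∀ ring

sum-weight : ∀ K c μ → Cap c μ → addΣ (suc c) 0 (λ _ ν → weight K ν) μ ≡ ι (suc (size μ)) ⊛ (K ⊖ ι (size μ)) ⊛ weight K μ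
sum-weight K c μ ps = begin
  addΣ (suc c) 0 (λ _ ν → contentProd K 0 ν ⊛ Dim (size ν) [] ν) μ
    ≡⟨ addΣ-congCap 0 μ (Cap-≤ (ℕP.n≤1+n c) ps) (λ _ ν _ e → cong (λ n → contentProd K 0 ν ⊛ Dim n [] ν) e) ⟩
  addΣ (suc c) 0 (λ _ ν → contentProd K 0 ν ⊛ Dim (suc (size μ)) [] ν) μ
    ≡⟨ addΣ-contentProd (suc c) 0 K (Dim (suc (size μ)) []) μ ⟩
  contentProd K 0 μ ⊛ addΣ (suc c) 0 (λ a ν → (K ⊖ a ⊛ a) ⊛ Dim (suc (size μ)) [] ν) μ
    -- (n + 1)(K - n) is the closed form of the sum of K - 2j over j ≤ n.
    ≡⟨ cong (contentProd K 0 μ ⊛_) (contentMoment (λ a → K ⊖ a ⊛ a) (λ n → K ⊖ ι 2 ⊛ ι n) (λ n → ι (suc n) ⊛ (K ⊖ ι n))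
         (λ μ → trans (corner-square K 0 μ) (γ-arith K (ι 2 ⊛ ι (size μ)))) (t₀-arith K) (λ n → tₛ-arith K (ι n)) (size μ) μ ps refl) ⟩
  contentProd K 0 μ ⊛ (ι (suc (size μ)) ⊛ (K ⊖ ι (size μ)) ⊛ Dim (size μ) [] μ)
    ≡⟨ swap-arith _ _ _ ⟩
  ι (suc (size μ)) ⊛ (K ⊖ ι (size μ)) ⊛ weight K μ ∎

rowProd-0 : ∀ K i j x → K ≡ (ι j ⊖ ι i) ⊛ (ι j ⊖ ι i) → j < x → rowProd K i x ≡ 0ℚ
rowProd-0 K i j (suc x) e (s≤s p) with ℕP.m≤n⇒m<n∨m≡n p
... | inj₁ q    = trans (cong (_⊛ (K ⊖ (ι x ⊖ ι i) ⊛ (ι x ⊖ ι i))) (rowProd-0 K i j x e q)) (*-zeroˡ _)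
... | inj₂ refl = trans (cong (λ z → rowProd K i j ⊛ (z ⊖ (ι j ⊖ ι i) ⊛ (ι j ⊖ ι i))) e) (zero-factor _ _)

-- The first row then contains the box in column k, of content k.
contentProd-wide : ∀ k xs → k < headOr0 xs → contentProd (ι (k * k)) 0 xs ≡ 0ℚ
contentProd-wide k (x ∷ xs) p = trans (cong (_⊛ contentProd (ι (k * k)) 1 xs) (rowProd-0 (ι (k * k)) 0 k x (trans (ι-* k k) (square-0 (ι k))) p)) (*-zeroˡ _)

-- The number d counts the rows down to row k, whose first box has content -k.
contentProd-tall : ∀ {c} k i d xs → Cap c xs → i + d ≡ k → d < length xs → contentProd (ι (k * k)) i xs ≡ 0ℚ
contentProd-tall k i zero    (suc x ∷ xs) _        e _ = trans (cong (_⊛ contentProd (ι (k * k)) (suc i) xs) (rowProd-0 (ι (k * k)) i 0 (suc x)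
  (trans (ι-* k k) (trans (0-square (ι k)) (cong (λ z → (ι 0 ⊖ ι z) ⊛ (ι 0 ⊖ ι z)) (trans (sym e) (ℕP.+-identityʳ i))))) (s≤s z≤n))) (*-zeroˡ _)
contentProd-tall k i (suc d) (x ∷ xs)     (_ ∷ ps) e (s≤s p) = trans (cong (rowProd (ι (k * k)) i x ⊛_) (contentProd-tall k (suc i) d xs ps (trans (sym (ℕP.+-suc i d)) e) p)) (*-zeroʳ _)

square : ℕ → List ℕ
square k = replicate k k

size-≤ : ∀ {c} l xs → Cap c xs → length xs ≤ l → size xs ≤ l * c
size-≤ l       []       _        _       = z≤n
size-≤ (suc l) (x ∷ xs) (p ∷ ps) (s≤s q) = ℕP.+-mono-≤ p (size-≤ l xs (Cap-≤ p ps) q)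

full-rectangle : ∀ {c} l xs → Cap c xs → 0 < c → length xs ≤ l → size xs ≡ l * c → xs ≡ replicate l c
full-rectangle zero    []       _        _  _       _ = refl
full-rectangle {suc c} (suc l) [] _      _  _       ()
full-rectangle {c} (suc l) (x ∷ xs) (p ∷ ps) c>0 (s≤s q) e with ℕP.m≤n⇒m<n∨m≡n p
... | inj₂ refl = cong (c ∷_) (full-rectangle l xs ps c>0 q (ℕP.+-cancelˡ-≡ c _ _ e))
... | inj₁ r    = ⊥-elim (ℕP.<-irrefl e (ℕP.+-mono-<-≤ r (size-≤ l xs (Cap-≤ p ps) q)))

Cap-replicate : ∀ l c → 0 < c → Cap c (replicate l c)
Cap-replicate zero    c       _ = []
Cap-replicate (suc l) (suc c) p = ℕP.≤-refl ∷ Cap-replicate l (suc c) p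

size-replicate : ∀ l c → size (replicate l c) ≡ l * c
size-replicate zero    c = refl
size-replicate (suc l) c = cong (λ z → c + z) (size-replicate l c)

weight-top : ∀ {c} k μ → 0 < k → Cap c μ → size μ ≡ k * k → weight (ι (k * k)) μ ≡ weight (ι (k * k)) (square k) ⊛ Dim 0 μ (square k)
weight-top {c} k μ k>0 ps e with headOr0 μ ≤? k | length μ ≤? k
... | no h | _ = trans (trans (cong (_⊛ Dim (size μ) [] μ) (contentProd-wide k μ (ℕP.≰⇒> h))) (*-zeroˡ _))
  (sym (trans (cong (weight (ι (k * k)) (square k) ⊛_) (Dim-0-≢ μ (square k) λ { refl → h (Cap-head (Cap-replicate k k k>0)) })) (*-zeroʳ _)))
... | yes _ | no h = trans (trans (cong (_⊛ Dim (size μ) [] μ) (contentProd-tall k 0 k μ ps refl (ℕP.≰⇒> h))) (*-zeroˡ _))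
  (sym (trans (cong (weight (ι (k * k)) (square k) ⊛_) (Dim-0-≢ μ (square k) λ { refl → h (ℕP.≤-reflexive (LP.length-replicate k)) })) (*-zeroʳ _)))
... | yes p | yes q with full-rectangle k μ (Cap-≤ p (Cap-headOr0 ps)) k>0 q e
...   | refl = sym (trans (cong (weight (ι (k * k)) (square k) ⊛_) (Dim-0-≡ (square k))) (*-identityʳ _))

-- Induction on the number m of missing boxes. `weight` and the number of chains both determine
-- their value at μ from those at the enlarged diagrams, up to the factor of `sum-weight`, which is
-- n + 1 times the number of missing boxes. The former goes into `size μ !`, the latter into `m !`.
weight-Dim : ∀ m {c} k μ → 0 < k → k ≤ c → Cap c μ → size μ + m ≡ k * k →
  weight (ι (k * k)) μ ⊛ (ι ((k * k) !) ⊛ ι (m !)) ≡ weight (ι (k * k)) (square k) ⊛ (ι (size μ !) ⊛ Dim m μ (square k))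
weight-Dim zero    k μ k>0 k≤c ps e = begin
  weight K μ ⊛ (F ⊛ (1ℚ ⊕ 0ℚ))
    ≡⟨ cong₂ (λ x y → x ⊛ (F ⊛ y)) (weight-top k μ k>0 ps e′) (+-identityʳ 1ℚ) ⟩
  (weight K (square k) ⊛ Dim 0 μ (square k)) ⊛ (F ⊛ 1ℚ)
    ≡⟨ cong ((weight K (square k) ⊛ Dim 0 μ (square k)) ⊛_) (trans (*-identityʳ F) (cong (λ n → ι (n !)) (sym e′))) ⟩
  (weight K (square k) ⊛ Dim 0 μ (square k)) ⊛ ι (size μ !)
    ≡⟨ trans (*-assoc _ _ _) (cong (weight K (square k) ⊛_) (*-comm _ _)) ⟩
  weight K (square k) ⊛ (ι (size μ !) ⊛ Dim 0 μ (square k)) ∎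
  where
  K = ι (k * k)
  F = ι ((k * k) !)
  e′ = trans (sym (ℕP.+-identityʳ (size μ))) e
weight-Dim (suc m) {c} k μ k>0 k≤c ps e = *-cancelˡ-pos (ι (suc n)) (ι-pos (suc n) (s≤s z≤n)) (begin
  ι (suc n) ⊛ (weight K μ ⊛ (F ⊛ ι (suc m !)))
    ≡⟨ cong (λ z → ι (suc n) ⊛ (weight K μ ⊛ (F ⊛ z))) (ι-* (suc m) (m !)) ⟩
  ι (suc n) ⊛ (weight K μ ⊛ (F ⊛ (ι (suc m) ⊛ ι (m !))))
    ≡⟨ regroup₁ _ _ _ _ _ ⟩
  (F ⊛ ι (m !)) ⊛ (ι (suc n) ⊛ ι (suc m) ⊛ weight K μ)
    -- Since n + suc m = k², the number of missing boxes is the factor `K ⊖ ι n`.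
    ≡⟨ cong (λ z → (F ⊛ ι (m !)) ⊛ (ι (suc n) ⊛ z ⊛ weight K μ)) (sym (trans (cong (λ z → ι z ⊖ ι n) (sym e)) (trans (cong (_⊖ ι n) (ι-+ n (suc m))) (sub-add (ι n) (ι (suc m)))))) ⟩
  (F ⊛ ι (m !)) ⊛ (ι (suc n) ⊛ (K ⊖ ι n) ⊛ weight K μ)
    ≡⟨ cong ((F ⊛ ι (m !)) ⊛_) (sym (sum-weight K c μ ps)) ⟩
  (F ⊛ ι (m !)) ⊛ addΣ (suc c) 0 (λ _ ν → weight K ν) μ
    ≡⟨ sym (addΣ-* (suc c) 0 (F ⊛ ι (m !)) (λ _ → weight K) μ) ⟩
  addΣ (suc c) 0 (λ _ ν → (F ⊛ ι (m !)) ⊛ weight K ν) μ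
    ≡⟨ addΣ-congCap 0 μ ps′ (λ _ ν q s → trans (*-comm _ _) (trans (weight-Dim m k ν k>0 (ℕP.m≤n⇒m≤1+n k≤c) q (trans (cong (_+ m) s) (trans (sym (ℕP.+-suc n m)) e))) (trans (sym (*-assoc _ _ _)) (cong (λ z → (weight K (square k) ⊛ ι (z !)) ⊛ Dim m ν (square k)) s)))) ⟩
  addΣ (suc c) 0 (λ _ ν → (weight K (square k) ⊛ ι (suc n !)) ⊛ Dim m ν (square k)) μ
    ≡⟨ addΣ-* (suc c) 0 (weight K (square k) ⊛ ι (suc n !)) (λ _ ν → Dim m ν (square k)) μ ⟩
  (weight K (square k) ⊛ ι (suc n !)) ⊛ addΣ (suc c) 0 (λ _ ν → Dim m ν (square k)) μ
    ≡⟨ cong₂ (λ x y → (weight K (square k) ⊛ x) ⊛ y) (ι-* (suc n) (n !)) (sym (Dim-suc′ 0 m μ (square k) ps′ (Cap-≤ (ℕP.m≤n⇒m≤1+n k≤c) (Cap-replicate k k k>0)))) ⟩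
  (weight K (square k) ⊛ (ι (suc n) ⊛ ι (n !))) ⊛ Dim (suc m) μ (square k)
    ≡⟨ trans (*-assoc _ _ _) (regroup₂ _ _ _ _) ⟩
  ι (suc n) ⊛ (weight K (square k) ⊛ (ι (n !) ⊛ Dim (suc m) μ (square k))) ∎)
  where
  n = size μ
  K = ι (k * k)
  F = ι ((k * k) !)
  ps′ = Cap-≤ (ℕP.n≤1+n c) ps

-- The hook length formula of the square

opaque
  unfolding _⊕_

  /-* : ∀ a b .{{_ : ℕ.NonZero b}} → (+ a ℚ./ b) ⊛ ι b ≡ ι a
  /-* a b@(suc b-1) = begin
    (+ a ℚ./ b) ℚ.* ι b          ≡⟨ cong ((+ a ℚ./ b) ℚ.*_) (ι≡toℚ b) ⟩
    (+ a ℚ./ b) ℚ.* (+ b ℚ./ 1)  ≡⟨ ℚP.toℚᵘ-injective (ℚᵘP.≃-trans (ℚP.toℚᵘ-homo-* (+ a ℚ./ b) (+ b ℚ./ 1))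
                                      (ℚᵘP.≃-trans (ℚᵘP.*-cong (ℚP.toℚᵘ-fromℚᵘ (mkℚᵘ (+ a) b-1)) (ℚP.toℚᵘ-fromℚᵘ (mkℚᵘ (+ b) 0)))
                                      (ℚᵘP.≃-trans (*≡* cross) (ℚᵘP.≃-sym (ℚP.toℚᵘ-fromℚᵘ (mkℚᵘ (+ a) 0)))))) ⟩
    + a ℚ./ 1                    ≡⟨ sym (ι≡toℚ a) ⟩
    ι a ∎
    where
    cross : (+ a ℤ.* + b) ℤ.* + 1 ≡ + a ℤ.* (+ (b * 1))
    cross = trans (ℤP.*-identityʳ _) (cong (λ z → + a ℤ.* + z) (sym (ℕP.*-identityʳ b)))

  square-injective : ∀ {p q} → ℚ.Positive p → ℚ.Positive q → p ⊛ p ≡ q ⊛ q → p ≡ q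
  square-injective {p} {q} p>0 q>0 e with ℚP.<-cmp p q
  ... | tri< p<q _ _ = ⊥-elim (ℚP.<-irrefl e (ℚP.<-trans (ℚP.*-monoʳ-<-pos p {{p>0}} p<q) (ℚP.*-monoˡ-<-pos q {{q>0}} p<q)))
  ... | tri≈ _ p≡q _ = p≡q
  ... | tri> _ _ q<p = ⊥-elim (ℚP.<-irrefl (sym e) (ℚP.<-trans (ℚP.*-monoʳ-<-pos q {{q>0}} q<p) (ℚP.*-monoˡ-<-pos p {{p>0}} q<p)))

  prodℚ-⊛ : ∀ n f h → prodℚ n f ⊛ prodℚ n h ≡ prodℚ n (λ i → f i ⊛ h i)
  prodℚ-⊛ zero    f h = refl
  prodℚ-⊛ (suc n) f h = trans (exchange (prodℚ n f) (f n) (prodℚ n h) (h n)) (cong (ℚ._* (f n ℚ.* h n)) (prodℚ-⊛ n f h))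
    where
    exchange : ∀ a b c d → (a ⊛ b) ⊛ (c ⊛ d) ≡ (a ⊛ c) ⊛ (b ⊛ d)
    exchange = solve-∀ ring

  prodℚ-head : ∀ n f → prodℚ (suc n) f ≡ f 0 ⊛ prodℚ n (f ∘ suc)
  prodℚ-head zero    f = trans (ℚP.*-identityˡ (f 0)) (sym (ℚP.*-identityʳ (f 0)))
  prodℚ-head (suc n) f = trans (cong (ℚ._* f (suc n)) (prodℚ-head n f)) (ℚP.*-assoc (f 0) _ _)

  prodℚ-last : ∀ n f → prodℚ (suc n) f ≡ prodℚ n f ⊛ f n
  prodℚ-last n f = refl

  prodℚ-pos : ∀ n f → (∀ i → ℚ.Positive (f i)) → ℚ.Positive (prodℚ n f)
  prodℚ-pos zero    f h = _
  prodℚ-pos (suc n) f h = pos-* {prodℚ n f} {f n} (prodℚ-pos n f h) (h n)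

  private
    row-step : ∀ r u v y i → (r ⊛ (u ⊛ v)) ⊛ (y ⊛ i) ≡ (r ⊛ ((u ⊛ y) ⊛ i)) ⊛ v
    row-step = solve-∀ ring

    difference-of-squares : ∀ i i′ x → ((1ℚ ⊕ (i ⊕ i′)) ⊛ (1ℚ ⊕ (i ⊕ i′))) ⊖ (x ⊖ i) ⊛ (x ⊖ i)
      ≡ ((1ℚ ⊕ (i ⊕ i′)) ⊕ i ⊖ x) ⊛ (1ℚ ⊕ (i′ ⊕ x))
    difference-of-squares = solve-∀ ring

    pair-arith : ∀ r q q′ a a′ → ((r ⊛ q) ⊛ q′) ⊛ (a ⊛ a′) ≡ r ⊛ ((q ⊛ a) ⊛ (q′ ⊛ a′))
    pair-arith = solve-∀ ring

    scale-arith : ∀ c d q → (c ⊛ q) ⊛ q ⊛ (d ⊛ d) ≡ (c ⊛ d ⊛ d) ⊛ (q ⊛ q)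
    scale-arith = solve-∀ ring

    square-arith : ∀ f q → (f ⊛ f) ⊛ (q ⊛ q) ≡ (f ⊛ q) ⊛ (f ⊛ q)
    square-arith = solve-∀ ring

    final₁ : ∀ f d w m → f ⊛ (m ⊛ (d ⊛ w)) ≡ d ⊛ (w ⊛ (f ⊛ m))
    final₁ = solve-∀ ring

    final₂ : ∀ c d n f → d ⊛ ((c ⊛ d) ⊛ (n ⊛ f)) ≡ (c ⊛ d ⊛ d) ⊛ (n ⊛ f)
    final₂ = solve-∀ ring

    final₃ : ∀ l m n f → (l ⊛ m) ⊛ (n ⊛ f) ≡ m ⊛ (f ⊛ l ⊛ n)
    final₃ = solve-∀ ring

prodℚ-cong : ∀ n {f h} → (∀ i → i < n → f i ≡ h i) → prodℚ n f ≡ prodℚ n h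
prodℚ-cong zero    e = refl
prodℚ-cong (suc n) e = cong₂ ℚ._*_ (prodℚ-cong n (λ i p → e i (ℕP.m≤n⇒m≤1+n p))) (e n ℕP.≤-refl)

prodℚ-1 : ∀ n → prodℚ n (λ _ → 1ℚ) ≡ 1ℚ
prodℚ-1 zero    = refl
prodℚ-1 (suc n) = trans (ℚP.*-identityʳ _) (prodℚ-1 n)

prodℚ-reverse : ∀ n f → prodℚ n f ≡ prodℚ n (λ i → f (n ∸ suc i))
prodℚ-reverse zero    f = refl
prodℚ-reverse (suc n) f = begin
  prodℚ (suc n) f                               ≡⟨ prodℚ-last n f ⟩
  prodℚ n f ⊛ f n                               ≡⟨ trans (*-comm _ _) (cong (f n ⊛_) (prodℚ-reverse n f)) ⟩
  f n ⊛ prodℚ n (λ i → f (n ∸ suc i))           ≡⟨ sym (prodℚ-head n (λ i → f (n ∸ i))) ⟩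
  prodℚ (suc n) (λ i → f (n ∸ i)) ∎

contentProd-replicate : ∀ K c i l → contentProd K i (replicate l c) ≡ prodℚ l (λ r → rowProd K (i + r) c)
contentProd-replicate K c i zero    = refl
contentProd-replicate K c i (suc l) = trans (cong₂ _⊛_ (cong (λ z → rowProd K z c) (sym (ℕP.+-identityʳ i))) (trans (contentProd-replicate K c (suc i) l) (prodℚ-cong l (λ r _ → cong (λ z → rowProd K z c) (sym (ℕP.+-suc i r))))))
  (sym (prodℚ-head l (λ r → rowProd K (i + r) c)))

-- k² − (x − i)² = (k + i − x)(k − i + x), so that each row of the square contributes two quotients of factorials.
rowProd-factorials : ∀ i i′ x y → x + y ≡ suc (i + i′) + i →
  rowProd (ι (suc (i + i′) * suc (i + i′))) i x ⊛ (ι (y !) ⊛ ι (i′ !)) ≡ ι ((suc (i + i′) + i) !) ⊛ ι ((i′ + x) !)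
rowProd-factorials i i′ zero    y refl = trans (*-identityˡ _) (cong (λ z → ι ((suc (i + i′) + i) !) ⊛ ι (z !)) (sym (ℕP.+-identityʳ i′)))
rowProd-factorials i i′ (suc x) y e = begin
  (R ⊛ (ι (k * k) ⊖ (ι x ⊖ ι i) ⊛ (ι x ⊖ ι i))) ⊛ (ι (y !) ⊛ ι (i′ !))
    ≡⟨ cong (λ z → (R ⊛ z) ⊛ (ι (y !) ⊛ ι (i′ !))) factor ⟩
  (R ⊛ (ι (suc y) ⊛ ι (suc (i′ + x)))) ⊛ (ι (y !) ⊛ ι (i′ !))
    ≡⟨ row-step _ _ _ _ _ ⟩
  (R ⊛ ((ι (suc y) ⊛ ι (y !)) ⊛ ι (i′ !))) ⊛ ι (suc (i′ + x))
    ≡⟨ cong (λ z → (R ⊛ (z ⊛ ι (i′ !))) ⊛ ι (suc (i′ + x))) (sym (ι-* (suc y) (y !))) ⟩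
  (R ⊛ (ι (suc y !) ⊛ ι (i′ !))) ⊛ ι (suc (i′ + x))
    ≡⟨ cong (_⊛ ι (suc (i′ + x))) (rowProd-factorials i i′ x (suc y) (trans (ℕP.+-suc x y) e)) ⟩
  (ι ((k + i) !) ⊛ ι ((i′ + x) !)) ⊛ ι (suc (i′ + x))
    ≡⟨ trans (*-assoc _ _ _) (cong (ι ((k + i) !) ⊛_) (trans (*-comm _ _) (trans (sym (ι-* (suc (i′ + x)) ((i′ + x) !))) (cong (λ z → ι (z !)) (sym (ℕP.+-suc i′ x)))))) ⟩
  ι ((k + i) !) ⊛ ι ((i′ + suc x) !) ∎
  where
  k = suc (i + i′)
  R = rowProd (ι (k * k)) i x
  ιk : ι k ≡ 1ℚ ⊕ (ι i ⊕ ι i′)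
  ιk = cong (1ℚ ⊕_) (ι-+ i i′)
  ιy : ι (suc y) ≡ (1ℚ ⊕ (ι i ⊕ ι i′)) ⊕ ι i ⊖ ι x
  ιy = trans (sym (sub-add (ι x) (ι (suc y)))) (cong (_⊖ ι x) (trans (sym (ι-+ x (suc y))) (trans (cong ι (trans (ℕP.+-suc x y) e)) (trans (ι-+ k i) (cong (_⊕ ι i) ιk)))))
  factor : ι (k * k) ⊖ (ι x ⊖ ι i) ⊛ (ι x ⊖ ι i) ≡ ι (suc y) ⊛ ι (suc (i′ + x))
  factor = trans (cong (_⊖ (ι x ⊖ ι i) ⊛ (ι x ⊖ ι i)) (trans (ι-* k k) (cong₂ _⊛_ ιk ιk)))
    (trans (difference-of-squares (ι i) (ι i′) (ι x)) (cong₂ _⊛_ (sym ιy) (cong (1ℚ ⊕_) (sym (ι-+ i′ x)))))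

quot : ℕ → ℕ → ℚ
quot k j = ℚ._/_ (+ (j !)) ((j + k) !) {{(j + k) ℕP.!≢0}}

quot-* : ∀ k j → quot k j ⊛ ι ((j + k) !) ≡ ι (j !)
quot-* k j = /-* (j !) ((j + k) !) {{(j + k) ℕP.!≢0}}

-- Row i yields the factors of `g` at i and at its mirror image k - 1 - i. Over all rows each factor
-- therefore occurs twice, and the square of `g` appears.
rowProd-quot : ∀ k i → i < k → rowProd (ι (k * k)) i k ⊛ quot k i ⊛ quot k (k ∸ suc i) ≡ 1ℚ
rowProd-quot k i i<k = *-cancelˡ-pos (ι ((i + k) !) ⊛ ι ((i′ + k) !)) (pos-* (ι-pos _ (!-pos (i + k))) (ι-pos _ (!-pos (i′ + k)))) (begin
  (ι ((i + k) !) ⊛ ι ((i′ + k) !)) ⊛ (rowProd (ι (k * k)) i k ⊛ quot k i ⊛ quot k i′)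
    ≡⟨ trans (*-comm _ _) (pair-arith _ _ _ _ _) ⟩
  rowProd (ι (k * k)) i k ⊛ ((quot k i ⊛ ι ((i + k) !)) ⊛ (quot k i′ ⊛ ι ((i′ + k) !)))
    ≡⟨ cong (rowProd (ι (k * k)) i k ⊛_) (cong₂ _⊛_ (quot-* k i) (quot-* k i′)) ⟩
  rowProd (ι (k * k)) i k ⊛ (ι (i !) ⊛ ι (i′ !))
    -- The case x = k, y = i of `rowProd-factorials`, with k written as `suc (i + i′)`.
    ≡⟨ subst (λ k → rowProd (ι (k * k)) i k ⊛ (ι (i !) ⊛ ι (i′ !)) ≡ ι ((k + i) !) ⊛ ι ((i′ + k) !)) (ℕP.m+[n∸m]≡n i<k) (rowProd-factorials i i′ (suc (i + i′)) i refl) ⟩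
  ι ((k + i) !) ⊛ ι ((i′ + k) !)
    ≡⟨ trans (cong (λ z → ι (z !) ⊛ ι ((i′ + k) !)) (ℕP.+-comm k i)) (sym (*-identityʳ _)) ⟩
  (ι ((i + k) !) ⊛ ι ((i′ + k) !)) ⊛ 1ℚ ∎)
  where
  i′ = k ∸ suc i

contentProd-square : ∀ k → contentProd (ι (k * k)) 0 (square k) ⊛ prodℚ k (quot k) ⊛ prodℚ k (quot k) ≡ 1ℚ
contentProd-square k = begin
  contentProd K 0 (square k) ⊛ prodℚ k (quot k) ⊛ prodℚ k (quot k)
    ≡⟨ cong₂ (λ x y → x ⊛ prodℚ k (quot k) ⊛ y) (contentProd-replicate K k 0 k) (prodℚ-reverse k (quot k)) ⟩
  prodℚ k (λ i → rowProd K i k) ⊛ prodℚ k (quot k) ⊛ prodℚ k (λ i → quot k (k ∸ suc i))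
    ≡⟨ trans (cong (_⊛ prodℚ k (λ i → quot k (k ∸ suc i))) (prodℚ-⊛ k _ _)) (prodℚ-⊛ k _ _) ⟩
  prodℚ k (λ i → rowProd K i k ⊛ quot k i ⊛ quot k (k ∸ suc i))
    ≡⟨ trans (prodℚ-cong k (rowProd-quot k)) (prodℚ-1 k) ⟩
  1ℚ ∎
  where
  K = ι (k * k)

weight-square : ∀ k → 0 < k → ι ((k * k) !) ⊛ ι ((k * k) !) ≡ contentProd (ι (k * k)) 0 (square k) ⊛ Dim (k * k) [] (square k) ⊛ Dim (k * k) [] (square k)
weight-square k k>0 = begin
  F ⊛ F
    ≡⟨ sym (trans (cong (_⊛ (F ⊛ F)) (trans (*-identityˡ _) (+-identityʳ 1ℚ))) (*-identityˡ _)) ⟩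
  weight (ι (k * k)) [] ⊛ (F ⊛ F)
    ≡⟨ weight-Dim (k * k) k [] k>0 ℕP.≤-refl [] refl ⟩
  weight (ι (k * k)) (square k) ⊛ (ι 1 ⊛ D)
    ≡⟨ cong₂ _⊛_ (cong (λ z → contentProd (ι (k * k)) 0 (square k) ⊛ Dim z [] (square k)) (size-replicate k k)) (trans (cong (_⊛ D) (+-identityʳ 1ℚ)) (*-identityˡ D)) ⟩
  contentProd (ι (k * k)) 0 (square k) ⊛ D ⊛ D ∎
  where
  F = ι ((k * k) !)
  D = Dim (k * k) [] (square k)

opaque
  unfolding _⊕_

  g≡⊛ : ∀ k → g k ≡ ι ((k * k) !) ⊛ prodℚ k (quot k)
  g≡⊛ k = cong (_*ℚ prodℚ k (quot k)) (sym (ι≡toℚ ((k * k) !)))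

0-not-pos : ¬ ℚ.Positive 0ℚ
0-not-pos ()

Dim-square : ∀ k → 0 < k → Dim (k * k) [] (square k) ≡ g k
Dim-square k k>0 = square-injective D>0 g>0 (begin
  D ⊛ D
    ≡⟨ sym (trans (cong (_⊛ (D ⊛ D)) (contentProd-square k)) (*-identityˡ _)) ⟩
  C ⊛ q ⊛ q ⊛ (D ⊛ D)
    ≡⟨ scale-arith C D q ⟩
  (C ⊛ D ⊛ D) ⊛ (q ⊛ q)
    ≡⟨ cong (_⊛ (q ⊛ q)) (sym (weight-square k k>0)) ⟩
  (F ⊛ F) ⊛ (q ⊛ q)
    ≡⟨ square-arith F q ⟩
  (F ⊛ q) ⊛ (F ⊛ q)
    ≡⟨ cong₂ _⊛_ (sym (g≡⊛ k)) (sym (g≡⊛ k)) ⟩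
  g k ⊛ g k ∎)
  where
  F = ι ((k * k) !)
  D = Dim (k * k) [] (square k)
  C = contentProd (ι (k * k)) 0 (square k)
  q = prodℚ k (quot k)
  F>0 : ℚ.Positive F
  F>0 = ι-pos _ (!-pos (k * k))
  g>0 : ℚ.Positive (g k)
  g>0 = subst ℚ.Positive (sym (g≡⊛ k)) (pos-* F>0 (prodℚ-pos k (quot k) (λ j → ℚP.normalize-pos (j !) ((j + k) !) {{(j + k) ℕP.!≢0}} {{j ℕP.!≢0}})))
  -- No chain is exhibited: if the count were 0, `weight-square` would make the square of (k²)!
  -- vanish.
  D>0 : ℚ.Positive D
  D>0 = ι-pos (dimAux (k * k) [] (square k)) (ℕP.n≢0⇒n>0 λ d≡0 → 0-not-pos (subst ℚ.Positive (trans (weight-square k k>0) (trans (cong (λ z → C ⊛ D ⊛ ι z) d≡0) (*-zeroʳ _))) (pos-* F>0 F>0)))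

fallingSq-! : ∀ k n m → n + m ≡ k * k → fallingSq k n ⊛ ι (m !) ≡ ι ((k * k) !)
fallingSq-! k zero    m refl = *-identityˡ _
fallingSq-! k (suc n) m e = begin
  fallingSq k (suc n) ⊛ ι (m !)
    ≡⟨ cong (_⊛ ι (m !)) (prodℚ-last n (λ i → toℚ (k * k ∸ i))) ⟩
  fallingSq k n ⊛ toℚ (k * k ∸ n) ⊛ ι (m !)
    ≡⟨ trans (*-assoc _ _ _) (cong (fallingSq k n ⊛_) (trans (cong (_⊛ ι (m !)) (trans (sym (ι≡toℚ (k * k ∸ n))) (cong ι (trans (cong (_∸ n) (sym e′)) (ℕP.m+n∸m≡n n (suc m)))))) (sym (ι-* (suc m) (m !))))) ⟩
  fallingSq k n ⊛ ι (suc m !)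
    ≡⟨ fallingSq-! k n (suc m) e′ ⟩
  ι ((k * k) !) ∎
  where
  e′ = trans (ℕP.+-suc n m) e

-- `weight-Dim` still involves the content product C of the square. A further factor D completes it
-- to C ⊛ D ⊛ D, the square of (k²)!, so that C disappears and D, which is `g k`, remains. Of the
-- two factorials, one cancels and the other splits into `fallingSq` and `m !`.
Dim-to-square : ∀ m {c} k μ → 0 < k → k ≤ c → Cap c μ → size μ + m ≡ k * k →
  Dim m μ (square k) ⊛ fallingSq k (size μ) ⊛ ι (size μ !) ≡ g k ⊛ weight (ι (k * k)) μ
Dim-to-square m k μ k>0 k≤c ps e = *-cancelˡ-pos M (ι-pos _ (!-pos m)) (*-cancelˡ-pos F (ι-pos _ (!-pos (k * k))) (sym (begin
  F ⊛ (M ⊛ (g k ⊛ W))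
    ≡⟨ cong (λ z → F ⊛ (M ⊛ (z ⊛ W))) (sym (Dim-square k k>0)) ⟩
  F ⊛ (M ⊛ (D ⊛ W))
    ≡⟨ final₁ F D W M ⟩
  D ⊛ (W ⊛ (F ⊛ M))
    ≡⟨ cong (D ⊛_) (weight-Dim m k μ k>0 k≤c ps e) ⟩
  D ⊛ (weight (ι (k * k)) (square k) ⊛ (ι (size μ !) ⊛ f))
    ≡⟨ cong (λ z → D ⊛ ((C ⊛ Dim z [] (square k)) ⊛ (ι (size μ !) ⊛ f))) (size-replicate k k) ⟩
  D ⊛ ((C ⊛ D) ⊛ (ι (size μ !) ⊛ f))
    ≡⟨ final₂ C D _ f ⟩
  (C ⊛ D ⊛ D) ⊛ (ι (size μ !) ⊛ f)
    ≡⟨ trans (cong (_⊛ (ι (size μ !) ⊛ f)) (sym (weight-square k k>0))) (*-assoc _ _ _) ⟩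
  F ⊛ (F ⊛ (ι (size μ !) ⊛ f))
    ≡⟨ cong (F ⊛_) (trans (cong (_⊛ (ι (size μ !) ⊛ f)) (sym (fallingSq-! k (size μ) m e))) (final₃ _ M _ f)) ⟩
  F ⊛ (M ⊛ (f ⊛ fallingSq k (size μ) ⊛ ι (size μ !))) ∎)))
  where
  F = ι ((k * k) !)
  M = ι (m !)
  D = Dim (k * k) [] (square k)
  C = contentProd (ι (k * k)) 0 (square k)
  W = weight (ι (k * k)) μ
  f = Dim m μ (square k)

-- Vertical strips

-- Sums over the vertical strips of size r that can be added to a diagram while its first row stays bounded by c.
stripΣ : ℕ → ℕ → (List ℕ → ℚ) → List ℕ → ℚ
stripΣ c zero    φ xs       = φ xs
stripΣ c (suc r) φ []       = when (0 <ᵇ c) (stripΣ 1 r (φ ∘ (1 ∷_)) [])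
stripΣ c (suc r) φ (x ∷ xs) = when (x <ᵇ c) (stripΣ (suc x) r (φ ∘ (suc x ∷_)) xs) ⊕ stripΣ x (suc r) (φ ∘ (x ∷_)) xs

stripΣ-cong : ∀ c r {φ φ′} xs → (∀ ν → φ ν ≡ φ′ ν) → stripΣ c r φ xs ≡ stripΣ c r φ′ xs
stripΣ-cong c zero    xs       h = h xs
stripΣ-cong c (suc r) []       h = cong (when (0 <ᵇ c)) (stripΣ-cong 1 r [] (λ ν → h (1 ∷ ν)))
stripΣ-cong c (suc r) (x ∷ xs) h = cong₂ _⊕_ (cong (when (x <ᵇ c)) (stripΣ-cong (suc x) r xs (λ ν → h (suc x ∷ ν)))) (stripΣ-cong x (suc r) xs (λ ν → h (x ∷ ν)))

stripΣ-+ : ∀ c r φ φ′ xs → stripΣ c r (λ ν → φ ν ⊕ φ′ ν) xs ≡ stripΣ c r φ xs ⊕ stripΣ c r φ′ xs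
stripΣ-+ c zero    φ φ′ xs       = refl
stripΣ-+ c (suc r) φ φ′ []       = trans (cong (when (0 <ᵇ c)) (stripΣ-+ 1 r (φ ∘ (1 ∷_)) (φ′ ∘ (1 ∷_)) [])) (when-+ (0 <ᵇ c) _ _)
stripΣ-+ c (suc r) φ φ′ (x ∷ xs) = trans (cong₂ _⊕_ (trans (cong (when (x <ᵇ c)) (stripΣ-+ (suc x) r (φ ∘ (suc x ∷_)) (φ′ ∘ (suc x ∷_)) xs)) (when-+ (x <ᵇ c) _ _)) (stripΣ-+ x (suc r) (φ ∘ (x ∷_)) (φ′ ∘ (x ∷_)) xs)) (interchange _ _ _ _)

stripΣ-0 : ∀ c r xs → stripΣ c r (λ _ → 0ℚ) xs ≡ 0ℚ
stripΣ-0 c zero    xs       = refl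
stripΣ-0 c (suc r) []       = when-≡0 (0 <ᵇ c) (stripΣ-0 1 r [])
stripΣ-0 c (suc r) (x ∷ xs) = trans (cong₂ _⊕_ (when-≡0 (x <ᵇ c) (stripΣ-0 (suc x) r xs)) (stripΣ-0 x (suc r) xs)) (+-identityˡ 0ℚ)

stripΣ-when : ∀ c r b φ xs → stripΣ c r (λ ν → when b (φ ν)) xs ≡ when b (stripΣ c r φ xs)
stripΣ-when c r true  φ xs = refl
stripΣ-when c r false φ xs = stripΣ-0 c r xs

-- A strip adds at most one box to the first row, so all bounds above its present length act alike.
stripΣ-free : ∀ {c d} r φ xs → headOr0 xs < c → headOr0 xs < d → stripΣ c r φ xs ≡ stripΣ d r φ xs
stripΣ-free zero    φ xs       p q = refl
stripΣ-free (suc r) φ []       p q rewrite <ᵇ-true p | <ᵇ-true q = refl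
stripΣ-free (suc r) φ (x ∷ xs) p q rewrite <ᵇ-true p | <ᵇ-true q = refl

stripΣ-congCap : ∀ {c} r {φ φ′} xs → Cap c xs → (∀ ν → Cap c ν → size ν ≡ r + size xs → φ ν ≡ φ′ ν) → stripΣ c r φ xs ≡ stripΣ c r φ′ xs
stripΣ-congCap         zero    xs           ps       h = h xs ps refl
stripΣ-congCap {zero}  (suc r) []           _        h = refl
stripΣ-congCap {suc c} (suc r) []           _        h = stripΣ-congCap r [] [] (λ ν q e → h (1 ∷ ν) (s≤s z≤n ∷ q) (cong suc e))
stripΣ-congCap {c} (suc r) {φ} {φ′} (suc x ∷ xs) (p ∷ ps) h = cong₂ _⊕_ (enlarged (ℕP.m≤n⇒m<n∨m≡n p))
  (stripΣ-congCap (suc r) xs ps (λ ν q e → h (suc x ∷ ν) (p ∷ q) (trans (cong (λ z → suc x + z) e) (exchange (suc x) (suc r) (size xs)))))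
  where
  exchange : ∀ a b c → a + (b + c) ≡ b + (a + c)
  exchange a b c = trans (sym (ℕP.+-assoc a b c)) (trans (cong (_+ c) (ℕP.+-comm a b)) (ℕP.+-assoc b a c))
  enlarged : suc x < c ⊎ suc x ≡ c → when (suc x <ᵇ c) (stripΣ (suc (suc x)) r (φ ∘ (suc (suc x) ∷_)) xs) ≡ when (suc x <ᵇ c) (stripΣ (suc (suc x)) r (φ′ ∘ (suc (suc x) ∷_)) xs)
  enlarged (inj₁ q) = cong (when (suc x <ᵇ c)) (stripΣ-congCap r xs (Cap-≤ (ℕP.n≤1+n _) ps)
    (λ ν s e → h (suc (suc x) ∷ ν) (q ∷ s) (trans (cong (λ z → suc (suc x) + z) e) (cong suc (exchange (suc x) r (size xs))))))
  enlarged (inj₂ refl) rewrite <ᵇ-false (ℕP.≤-refl {x}) = refl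

stripΣ-1 : ∀ c i φ xs → stripΣ c 1 φ xs ≡ addΣ c i (λ _ → φ) xs
stripΣ-1 c i φ []       = refl
stripΣ-1 c i φ (x ∷ xs) = cong₂ _⊕_ refl (stripΣ-1 x (suc i) (φ ∘ (x ∷_)) xs)

stripΣ-addΣ : ∀ c r d i (ψ : List ℕ → List ℕ → ℚ) κ μ →
  stripΣ c r (λ κ′ → addΣ d i (λ _ μ′ → ψ κ′ μ′) μ) κ ≡ addΣ d i (λ _ μ′ → stripΣ c r (λ κ′ → ψ κ′ μ′) κ) μ
stripΣ-addΣ c r d i ψ κ []       = stripΣ-when c r (0 <ᵇ d) _ κ
stripΣ-addΣ c r d i ψ κ (x ∷ xs) = trans (stripΣ-+ c r _ _ κ) (cong₂ _⊕_ (stripΣ-when c r (x <ᵇ d) _ κ) (stripΣ-addΣ c r x (suc i) (λ κ′ μ′ → ψ κ′ (x ∷ μ′)) κ xs))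

private
  Add : ℕ → ℕ → (List ℕ → ℚ) → List ℕ → ℚ
  Add c i φ = addΣ c i (λ _ → φ)

  expand-Add : ∀ d c r i φ y ys → stripΣ c r (λ zs → Add d i φ (y ∷ zs)) ys ≡ when (y <ᵇ d) (stripΣ c r (φ ∘ (suc y ∷_)) ys) ⊕ stripΣ c r (Add y (suc i) (φ ∘ (y ∷_))) ys
  expand-Add d c r i φ y ys = trans (stripΣ-+ c r _ _ ys) (cong (_⊕ stripΣ c r (Add y (suc i) (φ ∘ (y ∷_))) ys) (stripΣ-when c r (y <ᵇ d) _ ys))

  expand-strip : ∀ c r i φ x y ys → Add x i (λ zs → stripΣ c (suc r) φ (y ∷ zs)) ys ≡ when (y <ᵇ c) (Add x i (stripΣ (suc y) r (φ ∘ (suc y ∷_))) ys) ⊕ Add x i (stripΣ y (suc r) (φ ∘ (y ∷_))) ys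
  expand-strip c r i φ x y ys = trans (addΣ-+ x i _ _ ys) (cong (_⊕ Add x i (stripΣ y (suc r) (φ ∘ (y ∷_))) ys) (addΣ-when x i (y <ᵇ c) _ ys))

opaque
  unfolding _⊕_

  private
    -- The indices count the boxes that the first row receives from the strip and the single box
    -- together. For one box either of the two may be its source, and only the sum of both cases is
    -- the same in both orders.
    strip-arith : ∀ b b′ p₂ q₂ a₁ s₁ t₁ u₁ a₀ u₀ → p₂ ≡ q₂ → a₁ ⊕ s₁ ≡ t₁ ⊕ u₁ → a₀ ≡ u₀ →
      when b (when b′ p₂ ⊕ a₁) ⊕ (when b s₁ ⊕ a₀) ≡ when b (when b′ q₂ ⊕ t₁) ⊕ (when b u₁ ⊕ u₀)
    strip-arith true b′ p₂ q₂ a₁ s₁ t₁ u₁ a₀ u₀ refl e refl = trans (pull (when b′ p₂) a₁ s₁ a₀) (trans (cong (λ z → when b′ p₂ ⊕ z ⊕ a₀) e) (sym (pull (when b′ p₂) t₁ u₁ a₀)))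
      where
      pull : ∀ p a s c → (p ⊕ a) ⊕ (s ⊕ c) ≡ p ⊕ (a ⊕ s) ⊕ c
      pull = solve-∀ ring
    strip-arith false b′ p₂ q₂ a₁ s₁ t₁ u₁ a₀ u₀ refl e refl = refl

    strip-arith′ : ∀ b p₂ q₂ a₁ s₁ t₁ u₁ v₁ a₀ u₀ w₀ → p₂ ≡ q₂ → a₁ ⊕ s₁ ≡ t₁ ⊕ u₁ → a₀ ≡ u₀ →
      (when b p₂ ⊕ a₁ ⊕ (s₁ ⊕ a₀)) ⊕ (when b v₁ ⊕ w₀) ≡ (t₁ ⊕ w₀) ⊕ (when b (when b q₂ ⊕ v₁) ⊕ (u₁ ⊕ u₀))
    strip-arith′ true p₂ q₂ a₁ s₁ t₁ u₁ v₁ a₀ u₀ w₀ refl e refl = trans (pull p₂ a₁ s₁ a₀ v₁ w₀) (trans (cong (λ z → p₂ ⊕ z ⊕ a₀ ⊕ v₁ ⊕ w₀) e) (push p₂ t₁ u₁ a₀ v₁ w₀))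
      where
      pull : ∀ p a s c v w → (p ⊕ a ⊕ (s ⊕ c)) ⊕ (v ⊕ w) ≡ p ⊕ (a ⊕ s) ⊕ c ⊕ v ⊕ w
      pull = solve-∀ ring
      push : ∀ p t u c v w → p ⊕ (t ⊕ u) ⊕ c ⊕ v ⊕ w ≡ (t ⊕ w) ⊕ ((p ⊕ v) ⊕ (u ⊕ c))
      push = solve-∀ ring
    strip-arith′ false p₂ q₂ a₁ s₁ t₁ u₁ v₁ a₀ u₀ w₀ refl e refl = trans (pull a₁ s₁ a₀ w₀) (trans (cong (λ z → z ⊕ a₀ ⊕ w₀) e) (push t₁ u₁ a₀ w₀))
      where
      pull : ∀ a s c w → (0ℚ ⊕ a ⊕ (s ⊕ c)) ⊕ (0ℚ ⊕ w) ≡ (a ⊕ s) ⊕ c ⊕ w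
      pull = solve-∀ ring
      push : ∀ t u c w → (t ⊕ u) ⊕ c ⊕ w ≡ (t ⊕ w) ⊕ (0ℚ ⊕ (u ⊕ c))
      push = solve-∀ ring

    strip-arith₀ : ∀ b b′ p q a t → p ≡ q → a ≡ t → when b (when b′ p ⊕ a) ≡ when b (when b′ q ⊕ t)
    strip-arith₀ b b′ p q a t refl refl = refl

    strip-arith₀′ : ∀ b p q a t → p ≡ q → a ≡ t → (when b p ⊕ a) ⊕ when b t ≡ t ⊕ when b (when b q ⊕ t)
    strip-arith₀′ true  p q a t refl refl = +-comm (p ⊕ a) a
    strip-arith₀′ false p q a t refl refl = lemma a
      where
      lemma : ∀ a → (0ℚ ⊕ a) ⊕ 0ℚ ≡ a ⊕ 0ℚ
      lemma = solve-∀ ring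

-- The induction on the rows runs jointly with strip-add′, which accounts for the row above having received
-- exactly one box, either from the strip or as the added box.
strip-add  : ∀ x r i φ xs → Cap x xs → stripΣ x r (Add x i φ) xs ≡ Add x i (stripΣ x r φ) xs
strip-add′ : ∀ x r i φ xs → Cap x xs →
  stripΣ (suc x) r (Add (suc x) i φ) xs ⊕ stripΣ x (suc r) φ xs ≡ stripΣ (suc x) (suc r) φ xs ⊕ Add x i (stripΣ (suc x) r φ) xs
strip-add-[] : ∀ r i φ → stripΣ 1 r (Add 1 i φ) [] ≡ stripΣ 1 (suc r) φ []

strip-add-[] zero    i φ = refl
strip-add-[] (suc r) i φ = trans (strip-add 1 (suc r) i φ [] []) (+-identityˡ _)

strip-add x zero    i φ xs       _  = refl
strip-add x (suc r) i φ []       _  = trans (cong (when (0 <ᵇ x)) (expand-Add x 1 r i φ 1 []))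
  (strip-arith₀ (0 <ᵇ x) (1 <ᵇ x) _ _ _ _ (stripΣ-free r (φ ∘ (2 ∷_)) [] (s≤s z≤n) (s≤s z≤n)) (strip-add-[] r (suc i) (φ ∘ (1 ∷_))))
strip-add x (suc r) i φ (y ∷ ys) (p ∷ ps) = begin
  when (y <ᵇ x) (stripΣ (suc y) r (λ zs → Add x i φ (suc y ∷ zs)) ys) ⊕ stripΣ y (suc r) (λ zs → Add x i φ (y ∷ zs)) ys
    ≡⟨ cong₂ _⊕_ (cong (when (y <ᵇ x)) (expand-Add x (suc y) r i φ (suc y) ys)) (expand-Add x y (suc r) i φ y ys) ⟩
  _
    ≡⟨ strip-arith (y <ᵇ x) (suc y <ᵇ x) _ _ _ _ _ _ _ _ (stripΣ-free r (φ ∘ (suc (suc y) ∷_)) ys (s≤s (Cap-head ps)) (s≤s (ℕP.m≤n⇒m≤1+n (Cap-head ps))))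
         (strip-add′ y r (suc i) (φ ∘ (suc y ∷_)) ys ps) (strip-add y (suc r) (suc i) (φ ∘ (y ∷_)) ys ps) ⟩
  _
    ≡⟨ cong₂ _⊕_ refl (sym (expand-strip x r (suc i) φ y y ys)) ⟩
  Add x i (stripΣ x (suc r) φ) (y ∷ ys) ∎

strip-add′ x zero    i φ xs       _  = trans (+-comm _ _) (trans (cong₂ _⊕_ (stripΣ-1 x i φ xs) (sym (stripΣ-1 (suc x) i φ xs))) (+-comm _ _))
strip-add′ x (suc r) i φ []       _  = trans (cong (_⊕ when (0 <ᵇ x) (stripΣ 1 (suc r) (φ ∘ (1 ∷_)) [])) (expand-Add (suc x) 1 r i φ 1 []))
  (strip-arith₀′ (0 <ᵇ x) _ _ _ _ (stripΣ-free r (φ ∘ (2 ∷_)) [] (s≤s z≤n) (s≤s z≤n)) (strip-add-[] r (suc i) (φ ∘ (1 ∷_))))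
strip-add′ x (suc r) i φ (y ∷ ys) (p ∷ ps) = begin
  when (y <ᵇ suc x) (stripΣ (suc y) r (λ zs → Add (suc x) i φ (suc y ∷ zs)) ys) ⊕ stripΣ y (suc r) (λ zs → Add (suc x) i φ (y ∷ zs)) ys ⊕ stripΣ x (suc (suc r)) φ (y ∷ ys)
    ≡⟨ cong (_⊕ stripΣ x (suc (suc r)) φ (y ∷ ys)) (cong₂ _⊕_ (trans (inside _) (expand-Add (suc x) (suc y) r i φ (suc y) ys))
         (trans (expand-Add (suc x) y (suc r) i φ y ys) (cong (_⊕ stripΣ y (suc r) (Add y (suc i) (φ ∘ (y ∷_))) ys) (inside _)))) ⟩
  _
    ≡⟨ strip-arith′ (y <ᵇ x) _ _ _ _ _ _ _ _ _ _ (stripΣ-free r (φ ∘ (suc (suc y) ∷_)) ys (s≤s (Cap-head ps)) (s≤s (ℕP.m≤n⇒m≤1+n (Cap-head ps))))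
         (strip-add′ y r (suc i) (φ ∘ (suc y ∷_)) ys ps) (strip-add y (suc r) (suc i) (φ ∘ (y ∷_)) ys ps) ⟩
  _
    ≡⟨ cong₂ _⊕_ (cong (_⊕ stripΣ y (suc (suc r)) (φ ∘ (y ∷_)) ys) (sym (inside _))) (cong₂ _⊕_ refl (sym (trans (expand-strip (suc x) r (suc i) φ y y ys) (cong (_⊕ Add y (suc i) (stripΣ y (suc r) (φ ∘ (y ∷_))) ys) (inside _))))) ⟩
  when (y <ᵇ suc x) (stripΣ (suc y) (suc r) (φ ∘ (suc y ∷_)) ys) ⊕ stripΣ y (suc (suc r)) (φ ∘ (y ∷_)) ys ⊕ Add x i (stripΣ (suc x) (suc r) φ) (y ∷ ys) ∎
  where
  inside : ∀ a → when (y <ᵇ suc x) a ≡ a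
  inside a = cong (λ b → when b a) (<ᵇ-true (s≤s p))

-- Complements in the square

at : List ℕ → ℕ → ℕ
at []       _       = 0
at (x ∷ xs) zero    = x
at (x ∷ xs) (suc i) = at xs i

at-head : ∀ {c} xs i → Cap c xs → at xs i ≤ c
at-head []       i       _        = z≤n
at-head (x ∷ xs) zero    (p ∷ ps) = p
at-head (x ∷ xs) (suc i) (p ∷ ps) = ℕP.≤-trans (at-head xs i ps) p

at-antitone : ∀ {c} xs i j → Cap c xs → i ≤ j → at xs j ≤ at xs i
at-antitone []       i       j       _        _       = z≤n
at-antitone (x ∷ xs) zero    zero    _        _       = ℕP.≤-refl
at-antitone (x ∷ xs) zero    (suc j) (_ ∷ ps) _       = at-head xs j ps
at-antitone (x ∷ xs) (suc i) (suc j) (_ ∷ ps) (s≤s q) = at-antitone xs i j ps q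

at-beyond : ∀ xs i → length xs ≤ i → at xs i ≡ 0
at-beyond []       i       _       = refl
at-beyond (x ∷ xs) (suc i) (s≤s p) = at-beyond xs i p

at-0⇒length : ∀ {c} xs i → Cap c xs → at xs i ≡ 0 → length xs ≤ i
at-0⇒length []       i       _        _ = z≤n
at-0⇒length (x ∷ xs) zero    (_ ∷ _)  ()
at-0⇒length (x ∷ xs) (suc i) (_ ∷ ps) e = s≤s (at-0⇒length xs i ps e)

at-injective : ∀ {c d} xs ys → Cap c xs → Cap d ys → (∀ i → at xs i ≡ at ys i) → xs ≡ ys
at-injective []       []       _        _        h = refl
at-injective []       (y ∷ ys) _        (_ ∷ _)  h with () ← h 0
at-injective (x ∷ xs) []       (_ ∷ _)  _        h with () ← h 0
at-injective (x ∷ xs) (y ∷ ys) (_ ∷ ps) (_ ∷ qs) h = cong₂ _∷_ (h 0) (at-injective xs ys ps qs (h ∘ suc))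

-- On weakly decreasing rows, cutting at the first zero loses no box.
trim : List ℕ → List ℕ
trim []           = []
trim (zero ∷ xs)  = []
trim (suc x ∷ xs) = suc x ∷ trim xs

antitone-0 : ∀ (f : ℕ → ℕ) → (∀ i → f (suc i) ≤ f i) → f 0 ≡ 0 → ∀ i → f i ≡ 0
antitone-0 f anti e zero    = e
antitone-0 f anti e (suc i) = ℕP.n≤0⇒n≡0 (ℕP.≤-trans (anti i) (ℕP.≤-reflexive (antitone-0 f anti e i)))

sum-0 : ∀ (f : ℕ → ℕ) n → (∀ i → f i ≡ 0) → sum (applyUpTo f n) ≡ 0
sum-0 f zero    h = refl
sum-0 f (suc n) h = cong₂ _+_ (h 0) (sum-0 (f ∘ suc) n (h ∘ suc))

trim-Cap : ∀ {c} (f : ℕ → ℕ) n → (∀ i → f (suc i) ≤ f i) → f 0 ≤ c → Cap c (trim (applyUpTo f n))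
trim-Cap f zero    anti p = []
trim-Cap f (suc n) anti p with f 0 in e
... | zero  = []
... | suc x = p ∷ trim-Cap (f ∘ suc) n (anti ∘ suc) (subst (f 1 ≤_) e (anti 0))

at-trim-< : ∀ (f : ℕ → ℕ) n i → (∀ i → f (suc i) ≤ f i) → i < n → at (trim (applyUpTo f n)) i ≡ f i
at-trim-< f (suc n) i anti p with f 0 in e
at-trim-< f (suc n) i       anti p       | zero  = sym (antitone-0 f anti e i)
at-trim-< f (suc n) zero    anti p       | suc x = sym e
at-trim-< f (suc n) (suc i) anti (s≤s p) | suc x = at-trim-< (f ∘ suc) n i (anti ∘ suc) p

length-trim : ∀ xs → length (trim xs) ≤ length xs
length-trim []           = z≤n
length-trim (zero ∷ xs)  = z≤n
length-trim (suc x ∷ xs) = s≤s (length-trim xs)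

size-trim : ∀ (f : ℕ → ℕ) n → (∀ i → f (suc i) ≤ f i) → size (trim (applyUpTo f n)) ≡ sum (applyUpTo f n)
size-trim f zero    anti = refl
size-trim f (suc n) anti with f 0 in e
... | zero  = sym (sum-0 (f ∘ suc) n (antitone-0 f anti e ∘ suc))
... | suc x = cong (λ z → suc x + z) (size-trim (f ∘ suc) n (anti ∘ suc))

applyUpTo-reflect : ∀ (f : ℕ → ℕ) n → applyUpTo (λ i → f (n ∸ suc i)) n ≡ applyDownFrom f n
applyUpTo-reflect f zero    = refl
applyUpTo-reflect f (suc n) = cong (f n ∷_) (applyUpTo-reflect f n)

sum-applyDownFrom : ∀ (f : ℕ → ℕ) n → sum (applyDownFrom f n) ≡ sum (applyUpTo f n)
sum-applyDownFrom f n = trans (cong sum (sym (LP.reverse-applyUpTo f n))) (sum-↭ (↭-reverse (applyUpTo f n)))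

sum-∸ : ∀ (f : ℕ → ℕ) k n → (∀ i → f i ≤ k) → sum (applyUpTo (λ i → k ∸ f i) n) + sum (applyUpTo f n) ≡ n * k
sum-∸ f k zero    h = refl
sum-∸ f k (suc n) h = trans (shuffle (k ∸ f 0) _ (f 0) _) (cong₂ _+_ (ℕP.m∸n+n≡m (h 0)) (sum-∸ (f ∘ suc) k n (h ∘ suc)))
  where
  shuffle : ∀ a b c d → (a + b) + (c + d) ≡ (a + c) + (b + d)
  shuffle = ℕ-solve-∀

applyUpTo-at : ∀ κ k → length κ ≤ k → applyUpTo (at κ) k ≡ κ ++ replicate (k ∸ length κ) 0
applyUpTo-at []       zero    _       = refl
applyUpTo-at []       (suc k) _       = cong (0 ∷_) (applyUpTo-at [] k z≤n)
applyUpTo-at (x ∷ xs) (suc k) (s≤s p) = cong (x ∷_) (applyUpTo-at xs k p)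

sum-at : ∀ κ k → length κ ≤ k → sum (applyUpTo (at κ) k) ≡ size κ
sum-at []       zero    _       = refl
sum-at []       (suc k) _       = sum-at [] k z≤n
sum-at (x ∷ xs) (suc k) (s≤s p) = cong (λ z → x + z) (sum-at xs k p)

comp : ℕ → List ℕ → List ℕ
comp k κ = trim (applyUpTo (λ i → k ∸ at κ (k ∸ suc i)) k)

InBox : ℕ → List ℕ → Set
InBox k κ = headOr0 κ ≤ k × length κ ≤ k

inBox? : ∀ k κ → Dec (InBox k κ)
inBox? k κ = headOr0 κ ≤? k ×-dec length κ ≤? k

module _ {c} (k : ℕ) (κ : List ℕ) (ps : Cap c κ) where
  private
    row : ℕ → ℕ
    row i = k ∸ at κ (k ∸ suc i)

  row-antitone : ∀ i → k ∸ at κ (k ∸ suc (suc i)) ≤ k ∸ at κ (k ∸ suc i)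
  row-antitone i = ℕP.∸-monoʳ-≤ k (at-antitone κ _ _ ps (ℕP.∸-monoʳ-≤ k (ℕP.n≤1+n (suc i))))

  comp-Cap : Cap k (comp k κ)
  comp-Cap = trim-Cap row k row-antitone (ℕP.m∸n≤m k (at κ (k ∸ 1)))

  comp-length : length (comp k κ) ≤ k
  comp-length = subst (length (comp k κ) ≤_) (LP.length-applyUpTo row k) (length-trim (applyUpTo row k))

  comp-InBox : InBox k (comp k κ)
  comp-InBox = Cap-head comp-Cap , comp-length

  at-comp : ∀ i → i < k → at (comp k κ) i ≡ k ∸ at κ (k ∸ suc i)
  at-comp i p = at-trim-< row k i row-antitone p

  at-comp-≥ : ∀ i → k ≤ i → at (comp k κ) i ≡ 0
  at-comp-≥ i p = at-beyond (comp k κ) i (ℕP.≤-trans comp-length p)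

  size-comp : InBox k κ → size (comp k κ) + size κ ≡ k * k
  size-comp (p , q) = begin
    size (comp k κ) + size κ
      ≡⟨ cong₂ _+_ (trans (size-trim row k row-antitone) (trans (cong sum (applyUpTo-reflect (λ i → k ∸ at κ i) k)) (sum-applyDownFrom (λ i → k ∸ at κ i) k))) (sym (sum-at κ k q)) ⟩
    sum (applyUpTo (λ i → k ∸ at κ i) k) + sum (applyUpTo (at κ) k)
      ≡⟨ sum-∸ (at κ) k k (λ i → at-head κ i (Cap-≤ p (Cap-headOr0 ps))) ⟩
    k * k ∎

reflect-< : ∀ k i → i < k → k ∸ suc i < k
reflect-< (suc k) i (s≤s p) = s≤s (ℕP.m∸n≤m k i)

reflect-reflect : ∀ k i → i < k → k ∸ suc (k ∸ suc i) ≡ i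
reflect-reflect (suc k) i (s≤s p) = ℕP.m∸[m∸n]≡n p

comp-involutive : ∀ {c} k κ → Cap c κ → InBox k κ → comp k (comp k κ) ≡ κ
comp-involutive k κ ps (p , q) = at-injective _ _ (comp-Cap k (comp k κ) (comp-Cap k κ ps)) ps same
  where
  same : ∀ i → at (comp k (comp k κ)) i ≡ at κ i
  same i with i <? k
  ... | yes r = begin
    at (comp k (comp k κ)) i                ≡⟨ at-comp k (comp k κ) (comp-Cap k κ ps) i r ⟩
    k ∸ at (comp k κ) (k ∸ suc i)           ≡⟨ cong (k ∸_) (at-comp k κ ps (k ∸ suc i) (reflect-< k i r)) ⟩
    k ∸ (k ∸ at κ (k ∸ suc (k ∸ suc i)))    ≡⟨ cong (λ z → k ∸ (k ∸ at κ z)) (reflect-reflect k i r) ⟩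
    k ∸ (k ∸ at κ i)                        ≡⟨ ℕP.m∸[m∸n]≡n (ℕP.≤-trans (at-head κ i (Cap-headOr0 ps)) p) ⟩
    at κ i ∎
  ... | no r = trans (at-comp-≥ k (comp k κ) (comp-Cap k κ ps) i (ℕP.≮⇒≥ r)) (sym (at-beyond κ i (ℕP.≤-trans q (ℕP.≮⇒≥ r))))

-- Vertical strips between a diagram and a complement

vert : List ℕ → List ℕ → Bool
vert []       []       = true
vert []       (y ∷ ys) = (y ≡ᵇ 1) ∧ vert [] ys
vert (x ∷ xs) []       = false
vert (x ∷ xs) (y ∷ ys) = ((y ≡ᵇ x) ∨ (y ≡ᵇ suc x)) ∧ vert xs ys

Vert : List ℕ → List ℕ → Set
Vert xs ys = ∀ i → at xs i ≤ at ys i × at ys i ≤ suc (at xs i)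

≡ᵇ-true : ∀ {m n} → (m ≡ᵇ n) ≡ true → m ≡ n
≡ᵇ-true {zero}  {zero}  _ = refl
≡ᵇ-true {suc m} {suc n} e = cong suc (≡ᵇ-true e)

∧-true : ∀ {a b} → a ∧ b ≡ true → a ≡ true × b ≡ true
∧-true {true} {true} _ = refl , refl

∨-true : ∀ {a b} → a ∨ b ≡ true → a ≡ true ⊎ b ≡ true
∨-true {true}  _ = inj₁ refl
∨-true {false} e = inj₂ e

vert⇒Vert : ∀ xs ys → vert xs ys ≡ true → Vert xs ys
vert⇒Vert []       []       _ i       = z≤n , z≤n
vert⇒Vert []       (y ∷ ys) e zero    = z≤n , ℕP.≤-reflexive (≡ᵇ-true (proj₁ (∧-true {y ≡ᵇ 1} e)))
vert⇒Vert []       (y ∷ ys) e (suc i) = vert⇒Vert [] ys (proj₂ (∧-true {y ≡ᵇ 1} e)) i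
vert⇒Vert (x ∷ xs) (y ∷ ys) e (suc i) = vert⇒Vert xs ys (proj₂ (∧-true {(y ≡ᵇ x) ∨ (y ≡ᵇ suc x)} e)) i
vert⇒Vert (x ∷ xs) (y ∷ ys) e zero with ∨-true {y ≡ᵇ x} (proj₁ (∧-true {(y ≡ᵇ x) ∨ (y ≡ᵇ suc x)} e))
... | inj₁ h with refl ← ≡ᵇ-true {y} {x} h = ℕP.≤-refl , ℕP.n≤1+n x
... | inj₂ h with refl ← ≡ᵇ-true {y} {suc x} h = ℕP.n≤1+n x , ℕP.≤-refl

Vert⇒vert : ∀ {c d} xs ys → Cap c xs → Cap d ys → Vert xs ys → vert xs ys ≡ true
Vert⇒vert []       []               _        _        h = refl
Vert⇒vert []       (suc zero ∷ ys)  _        (_ ∷ qs) h = Vert⇒vert {0} [] ys [] qs (h ∘ suc)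
Vert⇒vert []       (suc (suc y) ∷ ys) _      (_ ∷ qs) h with s≤s () ← proj₂ (h 0)
Vert⇒vert (suc x ∷ xs) []           (_ ∷ ps) _        h with () ← proj₁ (h 0)
Vert⇒vert (suc x ∷ xs) (suc y ∷ ys) (_ ∷ ps) (_ ∷ qs) h = cong₂ _∧_ (near (ℕP.m≤n⇒m<n∨m≡n (proj₁ (h 0)))) (Vert⇒vert xs ys ps qs (h ∘ suc))
  where
  near : suc x < suc y ⊎ suc x ≡ suc y → (y ≡ᵇ x) ∨ (y ≡ᵇ suc x) ≡ true
  near (inj₂ refl) rewrite ≡ᵇ-refl x = refl
  near (inj₁ p) with refl ← ℕP.≤-antisym (proj₂ (h 0)) p rewrite ≡ᵇ-refl x = ∨-zeroʳ (suc x ≡ᵇ x)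

-- Rotating the square exchanges the diagrams and keeps rows as rows: the condition for row i of κ
-- is the reflected condition for row k - 1 - i of μ. Moreover μ fits in the square because it lies
-- inside the complement of κ.
Vert-comp : ∀ {c d} k κ μ → Cap c κ → Cap d μ → InBox k κ → Vert μ (comp k κ) → InBox k μ × Vert κ (comp k μ)
Vert-comp k κ μ ps qs (p , q) h = (at-0-head , at-0⇒length μ k qs (ℕP.n≤0⇒n≡0 (ℕP.≤-trans (proj₁ (h k)) (ℕP.≤-reflexive (at-comp-≥ k κ ps k ℕP.≤-refl))))) , strip
  where
  head≡at : ∀ xs → headOr0 xs ≡ at xs 0
  head≡at []      = refl
  head≡at (_ ∷ _) = refl
  at-0-head : headOr0 μ ≤ k
  at-0-head = subst (_≤ k) (sym (head≡at μ)) (ℕP.≤-trans (proj₁ (h 0)) (at-head (comp k κ) 0 (comp-Cap k κ ps)))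
  strip : Vert κ (comp k μ)
  strip i with i <? k
  ... | no r rewrite at-comp-≥ k μ qs i (ℕP.≮⇒≥ r) | at-beyond κ i (ℕP.≤-trans q (ℕP.≮⇒≥ r)) = z≤n , z≤n
  ... | yes r with h (k ∸ suc i)
  ...   | (u , v) rewrite at-comp k μ qs i r | at-comp k κ ps (k ∸ suc i) (reflect-< k i r) | reflect-reflect k i r =
    ℕP.m+n≤o⇒m≤o∸n _ (subst (_≤ k) (ℕP.+-comm (at μ (k ∸ suc i)) (at κ i)) (ℕP.m≤o∸n⇒m+n≤o (at μ (k ∸ suc i)) κi≤k u)) ,
    ℕP.m≤n+o⇒m∸n≤o k (at μ (k ∸ suc i)) (ℕP.≤-trans (ℕP.≤-trans (ℕP.m≤n+m∸n k (at κ i)) (ℕP.+-monoʳ-≤ (at κ i) v)) (ℕP.≤-reflexive (move (at κ i) (at μ (k ∸ suc i)))))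
    where
    κi≤k : at κ i ≤ k
    κi≤k = ℕP.≤-trans (at-head κ i (Cap-headOr0 ps)) p
    move : ∀ a b → a + suc b ≡ b + suc a
    move = ℕ-solve-∀

vert⇒size : ∀ {c d} xs ys → Cap c xs → Cap d ys → vert xs ys ≡ true → size xs ≤ size ys
vert⇒size []       ys       _        _        _ = z≤n
vert⇒size (x ∷ xs) (y ∷ ys) (_ ∷ ps) (_ ∷ qs) e = ℕP.+-mono-≤ (proj₁ (vert⇒Vert (x ∷ xs) (y ∷ ys) e 0))
  (vert⇒size xs ys ps qs (proj₂ (∧-true {(y ≡ᵇ x) ∨ (y ≡ᵇ suc x)} e)))

¬true⇒false : ∀ {b} → b ≢ true → b ≡ false
¬true⇒false {true}  h = ⊥-elim (h refl)
¬true⇒false {false} h = refl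

private
  -- The part of a strip sum in which the first row grows, with value 0 for r = 0, so that empty and
  -- nonempty strips split alike.
  shiftΣ : ℕ → ℕ → (List ℕ → ℚ) → ℕ → List ℕ → ℚ
  shiftΣ c zero    φ x xs = 0ℚ
  shiftΣ c (suc r) φ x xs = when (x <ᵇ c) (stripΣ (suc x) r (φ ∘ (suc x ∷_)) xs)

  stripΣ-∷ : ∀ c r φ x xs → stripΣ c r φ (x ∷ xs) ≡ shiftΣ c r φ x xs ⊕ stripΣ x r (φ ∘ (x ∷_)) xs
  stripΣ-∷ c zero    φ x xs = sym (+-identityˡ _)
  stripΣ-∷ c (suc r) φ x xs = refl

-- A strip is determined by the enlarged diagram, so ys is met at most once; the sizes guarantee
-- that a vertical strip between xs and ys has r boxes.
stripΣ-indicator : ∀ {c} r xs ys → Cap c xs → Cap c ys → size ys ≡ r + size xs → stripΣ c r (λ zs → Dim 0 zs ys) xs ≡ when (vert xs ys) 1ℚ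
stripΣ-indicator zero    []       []       _ _ _ = Dim-0-≡ []
stripΣ-indicator (suc r) []       []       _ _ ()
stripΣ-indicator zero    []       (y ∷ ys) _ (_ ∷ _) ()
stripΣ-indicator {suc c} (suc r) [] (suc y ∷ ys) _ (_ ∷ qs) e = begin
  stripΣ 1 r (λ zs → Dim 0 (1 ∷ zs) (suc y ∷ ys)) []
    ≡⟨ trans (stripΣ-cong 1 r [] (λ zs → Dim-0-∷ 1 zs (suc y) ys)) (stripΣ-when 1 r (0 ≡ᵇ y) _ []) ⟩
  when (0 ≡ᵇ y) (stripΣ 1 r (λ zs → Dim 0 zs ys) [])
    ≡⟨ go y qs e ⟩
  when (vert [] (suc y ∷ ys)) 1ℚ ∎
  where
  go : ∀ y → Cap (suc y) ys → suc y + size ys ≡ suc r + 0 → when (0 ≡ᵇ y) (stripΣ 1 r (λ zs → Dim 0 zs ys) []) ≡ when (vert [] (suc y ∷ ys)) 1ℚ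
  go zero    qs e = stripΣ-indicator r [] ys [] qs (ℕP.suc-injective e)
  go (suc y) qs e = refl
stripΣ-indicator r (x ∷ xs) [] (_ ∷ _) _ e = ⊥-elim (ℕP.0≢1+n (trans e (ℕP.+-suc r _)))
stripΣ-indicator {c} r (suc x ∷ xs) (suc y ∷ ys) (p ∷ ps) (q ∷ qs) e =
  trans (stripΣ-∷ c r (λ zs → Dim 0 zs (suc y ∷ ys)) (suc x) xs) (go r e (y ℕP.≟ x) (y ℕP.≟ suc x))
  where
  unequal : ∀ z → suc y ≢ z → ∀ c r → stripΣ c r (λ zs → Dim 0 (z ∷ zs) (suc y ∷ ys)) xs ≡ 0ℚ
  unequal z y≢z c r = trans (stripΣ-cong c r xs (λ zs → Dim-0-≢ (z ∷ zs) (suc y ∷ ys) (y≢z ∘ sym ∘ LP.∷-injectiveˡ))) (stripΣ-0 c r xs)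
  equal : ∀ c r → stripΣ c r (λ zs → Dim 0 (suc y ∷ zs) (suc y ∷ ys)) xs ≡ stripΣ c r (λ zs → Dim 0 zs ys) xs
  equal c r = stripΣ-cong c r xs (λ zs → trans (Dim-0-∷ (suc y) zs (suc y) ys) (cong (λ b → when b (Dim 0 zs ys)) (≡ᵇ-refl y)))
  unshifted : ∀ r → y ≢ suc x → shiftΣ c r (λ zs → Dim 0 zs (suc y ∷ ys)) (suc x) xs ≡ 0ℚ
  unshifted zero    h = refl
  unshifted (suc r) h = when-≡0 (suc x <ᵇ c) (unequal (suc (suc x)) (h ∘ ℕP.suc-injective) (suc (suc x)) r)
  go : ∀ r → suc y + size ys ≡ r + (suc x + size xs) → Dec (y ≡ x) → Dec (y ≡ suc x) →
    shiftΣ c r (λ zs → Dim 0 zs (suc y ∷ ys)) (suc x) xs ⊕ stripΣ (suc x) r (λ zs → Dim 0 (suc x ∷ zs) (suc y ∷ ys)) xs ≡ when (vert (suc x ∷ xs) (suc y ∷ ys)) 1ℚ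
  go r e (yes refl) _ = begin
    _ ≡⟨ cong₂ _⊕_ (unshifted r (ℕP.1+n≢n ∘ sym)) (equal (suc y) r) ⟩
    0ℚ ⊕ stripΣ (suc y) r (λ zs → Dim 0 zs ys) xs ≡⟨ +-identityˡ _ ⟩
    stripΣ (suc y) r (λ zs → Dim 0 zs ys) xs ≡⟨ stripΣ-indicator r xs ys ps qs (ℕP.+-cancelˡ-≡ (suc y) _ _ (trans e (move r (suc y) (size xs)))) ⟩
    when (vert xs ys) 1ℚ ≡⟨ cong (λ b → when ((b ∨ (y ≡ᵇ suc y)) ∧ vert xs ys) 1ℚ) (sym (≡ᵇ-refl y)) ⟩
    when (vert (suc y ∷ xs) (suc y ∷ ys)) 1ℚ ∎
    where
    move : ∀ a b c → a + (b + c) ≡ b + (a + c)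
    move = ℕ-solve-∀
  -- An empty strip cannot lengthen the first row. That `vert` fails too is seen from the sizes: the
  -- lower rows would have to lose a box.
  go zero e (no h) (yes refl) = trans (cong₂ _⊕_ refl (unequal (suc x) (h ∘ ℕP.suc-injective) (suc x) zero)) (trans (+-identityˡ _)
    (sym (cong (λ b → when b 1ℚ) (¬true⇒false (λ t → ℕP.<-irrefl (sym (ℕP.suc-injective e)) (s≤s (ℕP.+-monoʳ-≤ x (vert⇒size xs ys ps qs (proj₂ (∧-true {(suc x ≡ᵇ x) ∨ (x ≡ᵇ x)} t))))))))))
  go (suc r) e (no h) (yes refl) = begin
    _ ≡⟨ cong₂ _⊕_ (trans (cong₂ when (<ᵇ-true q) (equal (suc (suc x)) r)) (stripΣ-indicator r xs ys (Cap-≤ (ℕP.n≤1+n _) ps) qs (ℕP.+-cancelˡ-≡ (suc (suc x)) _ _ (trans e (move r x (size xs))))))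
           (unequal (suc x) (h ∘ ℕP.suc-injective) (suc x) (suc r)) ⟩
    when (vert xs ys) 1ℚ ⊕ 0ℚ ≡⟨ +-identityʳ _ ⟩
    when (vert xs ys) 1ℚ ≡⟨ cong (λ b → when (b ∧ vert xs ys) 1ℚ) (sym (trans (cong ((suc x ≡ᵇ x) ∨_) (≡ᵇ-refl x)) (∨-zeroʳ (suc x ≡ᵇ x)))) ⟩
    when (vert (suc x ∷ xs) (suc (suc x) ∷ ys)) 1ℚ ∎
    where
    move : ∀ r x s → suc r + (suc x + s) ≡ suc (suc x) + (r + s)
    move = ℕ-solve-∀
  go r e (no h) (no h′) = trans (cong₂ _⊕_ (unshifted r h′) (unequal (suc x) (h ∘ ℕP.suc-injective) (suc x) r)) (trans (+-identityˡ _)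
    (sym (cong₂ (λ a b → when ((a ∨ b) ∧ vert xs ys) 1ℚ) (≢⇒≡ᵇ-false h) (≢⇒≡ᵇ-false h′))))

-- Unlike in tilde, the complement of κ is not conjugated; the count is 0 if κ does not fit in the square.
chains : ℕ → ℕ → List ℕ → List ℕ → ℚ
chains k m κ μ = when (does (inBox? k κ)) (Dim m μ (comp k κ))

chains-suc : ∀ {c} k m κ μ → k ≤ c → Cap c κ → Cap c μ → chains k (suc m) κ μ ≡ addΣ c 0 (λ _ → chains k m κ) μ
chains-suc {c} k m κ μ k≤c ps qs = trans (cong (when b) (Dim-suc′ 0 m μ (comp k κ) qs (Cap-≤ k≤c (comp-Cap k κ ps)))) (sym (addΣ-when c 0 b _ μ))
  where b = does (inBox? k κ)

chains-0-comm : ∀ {c d} k κ μ → Cap c κ → Cap d μ → chains k 0 κ μ ≡ chains k 0 μ κ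
chains-0-comm k κ μ ps qs = go (inBox? k κ) (inBox? k μ) (≡-dec ℕP._≟_ μ (comp k κ))
  where
  go : (d : Dec (InBox k κ)) (d′ : Dec (InBox k μ)) → Dec (μ ≡ comp k κ) → when (does d) (Dim 0 μ (comp k κ)) ≡ when (does d′) (Dim 0 κ (comp k μ))
  go (no _)  (no _)  _      = refl
  go (yes p) (no q)  _      = Dim-0-≢ μ (comp k κ) λ { refl → q (comp-InBox k κ ps) }
  go (no p)  (yes q) _      = sym (Dim-0-≢ κ (comp k μ) λ { refl → p (comp-InBox k μ qs) })
  go (yes p) (yes q) (no h) = trans (Dim-0-≢ μ (comp k κ) h) (sym (Dim-0-≢ κ (comp k μ) λ { refl → h (sym (comp-involutive k μ qs q)) }))
  go (yes p) (yes q) (yes refl) = trans (Dim-0-≡ μ) (sym (trans (cong (Dim 0 κ) (comp-involutive k κ ps p)) (Dim-0-≡ κ)))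

-- With no steps left, the strip must fill the gap between μ and the complement of κ, a condition
-- that `Vert-comp` shows to be symmetric.
strip-chains-0 : ∀ {c} r k κ μ → k ≤ c → Cap c κ → Cap c μ → r + (size κ + size μ) ≡ k * k →
  stripΣ c r (chains k 0 κ) μ ≡ stripΣ c r (λ κ′ → chains k 0 κ′ μ) κ
strip-chains-0 {c} r k κ μ k≤c ps qs e = begin
  stripΣ c r (chains k 0 κ) μ
    ≡⟨ half κ μ ps qs e ⟩
  when (does (inBox? k κ)) (when (vert μ (comp k κ)) 1ℚ)
    ≡⟨ symmetric (inBox? k κ) (inBox? k μ) ⟩
  when (does (inBox? k μ)) (when (vert κ (comp k μ)) 1ℚ)
    ≡⟨ sym (half μ κ qs ps (trans (cong (λ z → r + z) (ℕP.+-comm (size μ) (size κ))) e)) ⟩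
  stripΣ c r (chains k 0 μ) κ
    ≡⟨ stripΣ-congCap r κ ps (λ κ′ rs _ → chains-0-comm k μ κ′ qs rs) ⟩
  stripΣ c r (λ κ′ → chains k 0 κ′ μ) κ ∎
  where
  half : ∀ κ μ → Cap c κ → Cap c μ → r + (size κ + size μ) ≡ k * k → stripΣ c r (chains k 0 κ) μ ≡ when (does (inBox? k κ)) (when (vert μ (comp k κ)) 1ℚ)
  half κ μ ps qs e = trans (stripΣ-when c r (does (inBox? k κ)) _ μ) (inside (inBox? k κ))
    where
    inside : (d : Dec (InBox k κ)) → when (does d) (stripΣ c r (λ ν → Dim 0 ν (comp k κ)) μ) ≡ when (does d) (when (vert μ (comp k κ)) 1ℚ)
    inside (no _)  = refl
    inside (yes p) = stripΣ-indicator r μ (comp k κ) qs (Cap-≤ k≤c (comp-Cap k κ ps))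
      (ℕP.+-cancelʳ-≡ (size κ) _ _ (trans (size-comp k κ ps p) (trans (sym e) (move r (size κ) (size μ)))))
      where
      move : ∀ a b c → a + (b + c) ≡ a + c + b
      move = ℕ-solve-∀
  bool-ext : ∀ {a b} → (a ≡ true → b ≡ true) → (b ≡ true → a ≡ true) → when a 1ℚ ≡ when b 1ℚ
  bool-ext {true}  {b}     f g = cong (λ b → when b 1ℚ) (sym (f refl))
  bool-ext {false} {true}  f g with () ← g refl
  bool-ext {false} {false} f g = refl
  to : ∀ {κ μ} → Cap c κ → Cap c μ → InBox k κ → vert μ (comp k κ) ≡ true → InBox k μ × vert κ (comp k μ) ≡ true
  to {κ} {μ} ps qs p t with Vert-comp k κ μ ps qs p (vert⇒Vert μ (comp k κ) t)
  ... | q , h = q , Vert⇒vert κ (comp k μ) ps (comp-Cap k μ qs) h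
  symmetric : (d : Dec (InBox k κ)) (d′ : Dec (InBox k μ)) → when (does d) (when (vert μ (comp k κ)) 1ℚ) ≡ when (does d′) (when (vert κ (comp k μ)) 1ℚ)
  symmetric (no _)  (no _)  = refl
  symmetric (yes p) (yes q) = bool-ext (proj₂ ∘ to ps qs p) (proj₂ ∘ to qs ps q)
  symmetric (yes p) (no q)  = cong (λ b → when b 1ℚ) (¬true⇒false (q ∘ proj₁ ∘ to ps qs p))
  symmetric (no p)  (yes q) = sym (cong (λ b → when b 1ℚ) (¬true⇒false (p ∘ proj₁ ∘ to qs ps q)))

-- A chain enlarges μ and leaves κ alone. So `strip-add` carries the strip on μ to the end of the
-- chain, where it can be handed to κ.
strip-chains : ∀ {c} r k m κ μ → k ≤ c → Cap c κ → Cap c μ → r + (size κ + size μ) + m ≡ k * k →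
  stripΣ c r (chains k m κ) μ ≡ stripΣ c r (λ κ′ → chains k m κ′ μ) κ
strip-chains r k zero    κ μ k≤c ps qs e = strip-chains-0 r k κ μ k≤c ps qs (trans (sym (ℕP.+-identityʳ _)) e)
strip-chains {c} r k (suc m) κ μ k≤c ps qs e = begin
  stripΣ c r (chains k (suc m) κ) μ
    ≡⟨ stripΣ-congCap r μ qs (λ ν q _ → chains-suc k m κ ν k≤c ps q) ⟩
  stripΣ c r (addΣ c 0 (λ _ → chains k m κ)) μ
    ≡⟨ strip-add c r 0 (chains k m κ) μ qs ⟩
  addΣ c 0 (λ _ → stripΣ c r (chains k m κ)) μ
    ≡⟨ addΣ-congCap 0 μ qs (λ _ ν q s → strip-chains r k m κ ν k≤c ps q (trans (cong (λ z → r + (size κ + z) + m) s) (trans (move r (size κ) (size μ) m) e))) ⟩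
  addΣ c 0 (λ _ μ′ → stripΣ c r (λ κ′ → chains k m κ′ μ′) κ) μ
    ≡⟨ sym (stripΣ-addΣ c r c 0 (chains k m) κ μ) ⟩
  stripΣ c r (λ κ′ → addΣ c 0 (λ _ → chains k m κ′) μ) κ
    ≡⟨ stripΣ-congCap r κ ps (λ κ′ p _ → sym (chains-suc k m κ′ μ k≤c p qs)) ⟩
  stripΣ c r (λ κ′ → chains k (suc m) κ′ μ) κ ∎
  where
  move : ∀ a b c d → a + (b + suc c) + d ≡ a + (b + c) + suc d
  move = ℕ-solve-∀

-- A box is a vertical strip of size 1, so a step of a chain can be transferred from μ to κ; doing
-- this for each step exchanges their roles.
chains-comm : ∀ {c} k m κ μ → k ≤ c → Cap c κ → Cap c μ → size κ + size μ + m ≡ k * k → chains k m κ μ ≡ chains k m μ κ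
chains-comm k zero    κ μ k≤c ps qs e = chains-0-comm k κ μ ps qs
chains-comm {c} k (suc m) κ μ k≤c ps qs e = begin
  chains k (suc m) κ μ
    ≡⟨ trans (chains-suc k m κ μ k≤c ps qs) (sym (stripΣ-1 c 0 (chains k m κ) μ)) ⟩
  stripΣ c 1 (chains k m κ) μ
    ≡⟨ strip-chains 1 k m κ μ k≤c ps qs (trans (sym (ℕP.+-suc (size κ + size μ) m)) e) ⟩
  stripΣ c 1 (λ κ′ → chains k m κ′ μ) κ
    ≡⟨ stripΣ-congCap 1 κ ps (λ κ′ p s → chains-comm k m κ′ μ k≤c p qs (trans (cong (λ z → z + size μ + m) s) (trans (sym (ℕP.+-suc (size κ + size μ) m)) e))) ⟩
  stripΣ c 1 (chains k m μ) κ
    ≡⟨ trans (stripΣ-1 c 0 (chains k m μ) κ) (sym (chains-suc k m μ κ k≤c qs ps)) ⟩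
  chains k (suc m) μ κ ∎

-- Conjugation

-- Puts a column of length x in front of a diagram with at most x rows. It serves to build the
-- conjugate and, in `strip-split`, as the full vertical strip.
col : ℕ → List ℕ → List ℕ
col zero    ys       = ys
col (suc x) []       = 1 ∷ col x []
col (suc x) (y ∷ ys) = suc y ∷ col x ys

transpose : List ℕ → List ℕ
transpose []       = []
transpose (x ∷ xs) = col x (transpose xs)

length-col : ∀ x ys → length ys ≤ x → length (col x ys) ≡ x
length-col zero    []       _       = refl
length-col (suc x) []       _       = cong suc (length-col x [] z≤n)
length-col (suc x) (y ∷ ys) (s≤s p) = cong suc (length-col x ys p)

size-col : ∀ x ys → size (col x ys) ≡ x + size ys
size-col zero    ys       = refl
size-col (suc x) []       = cong suc (size-col x [])
size-col (suc x) (y ∷ ys) = trans (cong (λ z → suc y + z) (size-col x ys)) (move y x (size ys))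
  where
  move : ∀ a b c → suc a + (b + c) ≡ suc b + (a + c)
  move = ℕ-solve-∀

col-Cap : ∀ {c} x ys → Cap c ys → Cap (suc c) (col x ys)
col-Cap zero    ys       ps       = Cap-≤ (ℕP.n≤1+n _) ps
col-Cap (suc x) []       ps       = s≤s z≤n ∷ col-Cap x [] []
col-Cap (suc x) (y ∷ ys) (p ∷ ps) = s≤s p ∷ col-Cap x ys ps

transpose-Cap : ∀ xs → Cap (length xs) (transpose xs)
transpose-Cap []       = []
transpose-Cap (x ∷ xs) = col-Cap x (transpose xs) (transpose-Cap xs)

length-transpose : ∀ {c} xs → Cap c xs → length (transpose xs) ≡ headOr0 xs
length-transpose []       _        = refl
length-transpose (x ∷ xs) (_ ∷ ps) = length-col x (transpose xs) (subst (_≤ x) (sym (length-transpose xs ps)) (Cap-head ps))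

length-transpose-≤ : ∀ {c} xs → Cap c xs → length (transpose xs) ≤ c
length-transpose-≤ {c} xs ps = subst (_≤ c) (sym (length-transpose xs ps)) (Cap-head ps)

size-transpose : ∀ xs → size (transpose xs) ≡ size xs
size-transpose []       = refl
size-transpose (x ∷ xs) = trans (size-col x (transpose xs)) (cong (λ z → x + z) (size-transpose xs))

headOr0-col-<ᵇ : ∀ x y ys → length ys ≤ x → (headOr0 (col x ys) <ᵇ suc (suc y)) ≡ (headOr0 ys <ᵇ suc y)
headOr0-col-<ᵇ zero    y []       p = refl
headOr0-col-<ᵇ (suc x) y []       p = refl
headOr0-col-<ᵇ (suc x) y (z ∷ ys) p = refl

-- A removable box either comes from ys or is the bottom of the new column, and the latter is
-- removable only if the column is longer than all others.
remΣ-col : ∀ {c} x φ ys → Cap c ys → length ys ≤ x → remΣ φ (col x ys) ≡ remΣ (φ ∘ col x) ys ⊕ when (length ys <ᵇ x) (φ (col (pred x) ys))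
remΣ-col zero          φ []       _ _ = sym (+-identityʳ _)
remΣ-col (suc zero)    φ []       _ _ = +-comm _ _
remΣ-col (suc (suc x)) φ []       _ _ = cong₂ _⊕_ refl (trans (remΣ-col {0} (suc x) (φ ∘ (1 ∷_)) [] [] z≤n) (+-identityˡ _))
remΣ-col (suc x)       φ (suc y ∷ ys) (p ∷ ps) (s≤s q) = begin
  when (headOr0 (col x ys) <ᵇ suc (suc y)) (φ (suc y ∷ col x ys)) ⊕ remΣ (φ ∘ (suc (suc y) ∷_)) (col x ys)
    ≡⟨ cong₂ _⊕_ (trans (cong (λ b → when b (φ (suc y ∷ col x ys))) (headOr0-col-<ᵇ x y ys q)) (shrunk y ys ps)) (remΣ-col x (φ ∘ (suc (suc y) ∷_)) ys ps q) ⟩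
  when (headOr0 ys <ᵇ suc y) (φ (col (suc x) (shrink (suc y) ys))) ⊕ (remΣ (λ ν → φ (suc (suc y) ∷ col x ν)) ys ⊕ when (length ys <ᵇ x) (φ (suc (suc y) ∷ col (pred x) ys)))
    ≡⟨ trans (sym (+-assoc _ _ _)) (cong (remΣ (φ ∘ col (suc x)) (suc y ∷ ys) ⊕_) (below x q)) ⟩
  remΣ (φ ∘ col (suc x)) (suc y ∷ ys) ⊕ when (length ys <ᵇ x) (φ (col x (suc y ∷ ys))) ∎
  where
  shrunk : ∀ y ys → Cap (suc y) ys → when (headOr0 ys <ᵇ suc y) (φ (suc y ∷ col x ys)) ≡ when (headOr0 ys <ᵇ suc y) (φ (col (suc x) (shrink (suc y) ys)))
  shrunk zero    []            _             = refl
  shrunk zero    (suc zero ∷ ys) (s≤s z≤n ∷ _) = refl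
  shrunk (suc y) ys            _             = refl
  below : ∀ x → length ys ≤ x → when (length ys <ᵇ x) (φ (suc (suc y) ∷ col (pred x) ys)) ≡ when (length ys <ᵇ x) (φ (col x (suc y ∷ ys)))
  below zero    _ = refl
  below (suc x) _ = refl

remΣ-transpose : ∀ {c} φ xs → Cap c xs → remΣ φ (transpose xs) ≡ remΣ (φ ∘ transpose) xs
remΣ-transpose φ []           _        = refl
remΣ-transpose φ (suc x ∷ xs) (_ ∷ ps) = begin
  remΣ φ (col (suc x) (transpose xs))
    ≡⟨ remΣ-col (suc x) φ (transpose xs) (transpose-Cap xs) (length-transpose-≤ xs ps) ⟩
  remΣ (φ ∘ col (suc x)) (transpose xs) ⊕ when (length (transpose xs) <ᵇ suc x) (φ (col x (transpose xs)))
    ≡⟨ cong₂ _⊕_ (remΣ-transpose (φ ∘ col (suc x)) xs ps) (cong₂ (λ n ν → when (n <ᵇ suc x) (φ ν)) (length-transpose xs ps) (shrunk x)) ⟩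
  remΣ (φ ∘ transpose ∘ (suc x ∷_)) xs ⊕ when (headOr0 xs <ᵇ suc x) (φ (transpose (shrink (suc x) xs)))
    ≡⟨ +-comm _ _ ⟩
  remΣ (φ ∘ transpose) (suc x ∷ xs) ∎
  where
  shrunk : ∀ x → col x (transpose xs) ≡ transpose (shrink (suc x) xs)
  shrunk zero    = refl
  shrunk (suc x) = refl

transpose-col : ∀ x ys → length ys ≤ suc x → transpose (col (suc x) ys) ≡ suc x ∷ transpose ys
transpose-col zero    []       _       = refl
transpose-col (suc x) []       _       = cong (col 1) (transpose-col x [] z≤n)
transpose-col zero    (y ∷ []) _       = refl
transpose-col zero    (y ∷ _ ∷ _) (s≤s ())
transpose-col (suc x) (y ∷ ys) (s≤s p) = cong (col (suc y)) (transpose-col x ys p)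

transpose-involutive : ∀ {c} xs → Cap c xs → transpose (transpose xs) ≡ xs
transpose-involutive []           _        = refl
transpose-involutive (suc x ∷ xs) (_ ∷ ps) = trans (transpose-col x (transpose xs) (length-transpose-≤ xs ps)) (cong (suc x ∷_) (transpose-involutive xs ps))

Dim-transpose : ∀ {c d} m μ ν → Cap c μ → Cap d ν → Dim m μ (transpose ν) ≡ Dim m (transpose μ) ν
Dim-transpose zero μ ν ps qs = go (≡-dec ℕP._≟_ μ (transpose ν))
  where
  go : Dec (μ ≡ transpose ν) → Dim 0 μ (transpose ν) ≡ Dim 0 (transpose μ) ν
  go (yes refl) = trans (Dim-0-≡ (transpose ν)) (sym (trans (cong (λ z → Dim 0 z ν) (transpose-involutive ν qs)) (Dim-0-≡ ν)))
  go (no h)     = trans (Dim-0-≢ μ (transpose ν) h) (sym (Dim-0-≢ (transpose μ) ν λ { refl → h (sym (transpose-involutive μ ps)) }))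
Dim-transpose (suc m) μ ν ps qs = begin
  Dim (suc m) μ (transpose ν)              ≡⟨ Dim-suc m μ (transpose ν) ⟩
  remΣ (Dim m μ) (transpose ν)             ≡⟨ remΣ-transpose (Dim m μ) ν qs ⟩
  remΣ (λ ν′ → Dim m μ (transpose ν′)) ν   ≡⟨ remΣ-congCap ν qs (λ ν′ q _ → Dim-transpose m μ ν′ ps q) ⟩
  remΣ (Dim m (transpose μ)) ν             ≡⟨ sym (Dim-suc m (transpose μ) ν) ⟩
  Dim (suc m) (transpose μ) ν ∎

at-col-< : ∀ x ys j → j < x → at (col x ys) j ≡ suc (at ys j)
at-col-< (suc x) []       zero    _       = refl
at-col-< (suc x) []       (suc j) (s≤s p) = at-col-< x [] j p
at-col-< (suc x) (y ∷ ys) zero    _       = refl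
at-col-< (suc x) (y ∷ ys) (suc j) (s≤s p) = at-col-< x ys j p

at-transpose-to : ∀ {c} xs i j → Cap c xs → i < at (transpose xs) j → j < at xs i
at-transpose-to (x ∷ xs) i j (_ ∷ ps) p with j <? x
... | no h = ⊥-elim (ℕP.n≮0 (subst (i <_) (at-beyond (col x (transpose xs)) j (ℕP.≤-trans (ℕP.≤-reflexive (length-col x (transpose xs) (length-transpose-≤ xs ps))) (ℕP.≮⇒≥ h))) p))
at-transpose-to (x ∷ xs) zero    j (_ ∷ ps) p | yes h = h
at-transpose-to (x ∷ xs) (suc i) j (_ ∷ ps) p | yes h = at-transpose-to xs i j ps (ℕP.≤-pred (subst (suc i <_) (at-col-< x (transpose xs) j h) p))

at-transpose-from : ∀ {c} xs i j → Cap c xs → j < at xs i → i < at (transpose xs) j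
at-transpose-from (x ∷ xs) zero    j _        p = subst (0 <_) (sym (at-col-< x (transpose xs) j p)) (s≤s z≤n)
at-transpose-from (x ∷ xs) (suc i) j (_ ∷ ps) p = subst (suc i <_) (sym (at-col-< x (transpose xs) j (ℕP.<-≤-trans p (at-head xs i ps)))) (s≤s (at-transpose-from xs i j ps p))

<-∸ : ∀ {k a} i → i < k ∸ a → a ≤ k ∸ suc i
<-∸ {k} {a} i p = ℕP.m+n≤o⇒m≤o∸n a (subst (_≤ k) (ℕP.+-comm (suc i) a) (ℕP.m≤o∸n⇒m+n≤o (suc i) (ℕP.<⇒≤ (ℕP.m∸n≢0⇒n<m (ℕP.m<n⇒n≢0 p))) p))

≤-∸ : ∀ {k a} i → i < k → a ≤ k ∸ suc i → i < k ∸ a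
≤-∸ {k} {a} i q p = ℕP.m+n≤o⇒m≤o∸n (suc i) (subst (_≤ k) (ℕP.+-comm a (suc i)) (ℕP.m≤o∸n⇒m+n≤o a q p))

InBox-transpose : ∀ {c} k κ → Cap c κ → InBox k κ → InBox k (transpose κ)
InBox-transpose k κ ps (p , q) = ℕP.≤-trans (Cap-head (transpose-Cap κ)) q , subst (_≤ k) (sym (length-transpose κ ps)) p

<-ext : ∀ {a b} → (∀ i → i < a → i < b) → (∀ i → i < b → i < a) → a ≡ b
<-ext {a} {b} f g with ℕP.<-cmp a b
... | tri< a<b _ _ = ⊥-elim (ℕP.<-irrefl refl (g a a<b))
... | tri≈ _ a≡b _ = a≡b
... | tri> _ _ b<a = ⊥-elim (ℕP.<-irrefl refl (f b b<a))

-- Box (i, j) of the square lies in the complement when (k - 1 - i, k - 1 - j) is not in κ, and this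
-- is symmetric in rows and columns.
transpose-comp : ∀ {c} k κ → Cap c κ → transpose (comp k κ) ≡ comp k (transpose κ)
transpose-comp k κ ps = at-injective _ _ (transpose-Cap (comp k κ)) (comp-Cap k (transpose κ) (transpose-Cap κ)) (λ j → <-ext (to j) (from j))
  where
  to : ∀ j i → i < at (transpose (comp k κ)) j → i < at (comp k (transpose κ)) j
  to j i p with at-transpose-to (comp k κ) i j (comp-Cap k κ ps) p | i <? k | j <? k
  ... | q | no h  | _     = ⊥-elim (ℕP.n≮0 (subst (j <_) (at-comp-≥ k κ ps i (ℕP.≮⇒≥ h)) q))
  ... | q | yes _ | no h  = ⊥-elim (h (ℕP.<-≤-trans q (at-head (comp k κ) i (comp-Cap k κ ps))))
  ... | q | yes r | yes s = subst (i <_) (sym (at-comp k (transpose κ) (transpose-Cap κ) j s))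
    (≤-∸ i r (ℕP.≮⇒≥ λ t → ℕP.<⇒≱ (at-transpose-to κ (k ∸ suc i) (k ∸ suc j) ps t) (<-∸ j (subst (j <_) (at-comp k κ ps i r) q))))
  from : ∀ j i → i < at (comp k (transpose κ)) j → i < at (transpose (comp k κ)) j
  from j i p with i <? k | j <? k
  ... | no h  | _     = ⊥-elim (h (ℕP.<-≤-trans p (at-head _ j (comp-Cap k (transpose κ) (transpose-Cap κ)))))
  ... | yes _ | no h  = ⊥-elim (ℕP.n≮0 (subst (i <_) (at-comp-≥ k (transpose κ) (transpose-Cap κ) j (ℕP.≮⇒≥ h)) p))
  ... | yes r | yes s = at-transpose-from (comp k κ) i j (comp-Cap k κ ps) (subst (j <_) (sym (at-comp k κ ps i r))
    (≤-∸ j s (ℕP.≮⇒≥ λ t → ℕP.<⇒≱ (at-transpose-from κ (k ∸ suc i) (k ∸ suc j) ps t) (<-∸ i (subst (i <_) (at-comp k (transpose κ) (transpose-Cap κ) j s) p)))))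

-- Agreement of `tilde` with the conjugated complement

count : ℕ → List ℕ → ℕ
count i ps = length (filter (λ a → suc i ≤? a) ps)

count-∷ : ∀ i x xs → i < x → count i (x ∷ xs) ≡ suc (count i xs)
count-∷ i x xs p = cong length (LP.filter-accept (λ a → suc i ≤? a) p)

count-∷-≥ : ∀ i x xs → x ≤ i → count i (x ∷ xs) ≡ count i xs
count-∷-≥ i x xs p = cong length (LP.filter-reject (λ a → suc i ≤? a) (ℕP.≤⇒≯ p))

count-beyond : ∀ {c} i xs → Cap c xs → c ≤ i → count i xs ≡ 0
count-beyond i []       _        _ = refl
count-beyond i (x ∷ xs) (p ∷ ps) q = trans (count-∷-≥ i x xs (ℕP.≤-trans p q)) (count-beyond i xs ps (ℕP.≤-trans p q))

count-zeros : ∀ i (f : ℕ → ℕ) n → (∀ j → f j ≡ 0) → count i (applyUpTo f n) ≡ 0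
count-zeros i f zero    h = refl
count-zeros i f (suc n) h = trans (count-∷-≥ i (f 0) _ (ℕP.≤-trans (ℕP.≤-reflexive (h 0)) z≤n)) (count-zeros i (f ∘ suc) n (h ∘ suc))

count-trim : ∀ i (f : ℕ → ℕ) n → (∀ i → f (suc i) ≤ f i) → count i (applyUpTo f n) ≡ count i (trim (applyUpTo f n))
count-trim i f zero    anti = refl
count-trim i f (suc n) anti with f 0 in e
... | zero  = trans (count-∷-≥ i 0 (applyUpTo (f ∘ suc) n) z≤n) (count-zeros i (f ∘ suc) n (antitone-0 f anti e ∘ suc))
... | suc x with suc i ≤? suc x
...   | yes p = trans (count-∷ i (suc x) _ p) (trans (cong suc (count-trim i (f ∘ suc) n (anti ∘ suc))) (sym (count-∷ i (suc x) _ p)))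
...   | no p  = trans (count-∷-≥ i (suc x) _ (ℕP.≮⇒≥ p)) (trans (count-trim i (f ∘ suc) n (anti ∘ suc)) (sym (count-∷-≥ i (suc x) _ (ℕP.≮⇒≥ p))))

applyUpTo-cong : ∀ {f h : ℕ → ℕ} n → (∀ i → i < n → f i ≡ h i) → applyUpTo f n ≡ applyUpTo h n
applyUpTo-cong zero    e = refl
applyUpTo-cong (suc n) e = cong₂ _∷_ (e 0 (s≤s z≤n)) (applyUpTo-cong n (λ i p → e (suc i) (s≤s p)))

col-applyUpTo : ∀ n x (f : ℕ → ℕ) → n ≤ x → (∀ i → n ≤ i → f i ≡ 0) → col x (applyUpTo f n) ≡ applyUpTo (suc ∘ f) x
col-applyUpTo zero    zero    f _       h = refl
col-applyUpTo zero    (suc x) f _       h = cong₂ _∷_ (cong suc (sym (h 0 z≤n))) (col-applyUpTo zero x (f ∘ suc) z≤n (λ i _ → h (suc i) z≤n))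
col-applyUpTo (suc n) (suc x) f (s≤s p) h = cong (suc (f 0) ∷_) (col-applyUpTo n x (f ∘ suc) p (λ i q → h (suc i) (s≤s q)))

-- A new first row of length x raises the first x column counts by one, which is what `col` does.
applyUpTo-count : ∀ {c} xs → Cap c xs → applyUpTo (λ i → count i xs) (headOr0 xs) ≡ transpose xs
applyUpTo-count []       _        = refl
applyUpTo-count (x ∷ xs) (_ ∷ ps) = begin
  applyUpTo (λ i → count i (x ∷ xs)) x
    ≡⟨ applyUpTo-cong x (λ i → count-∷ i x xs) ⟩
  applyUpTo (λ i → suc (count i xs)) x
    ≡⟨ sym (col-applyUpTo (headOr0 xs) x (λ i → count i xs) (Cap-head ps) (λ i → count-beyond i xs (Cap-headOr0 ps))) ⟩
  col x (applyUpTo (λ i → count i xs) (headOr0 xs))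
    ≡⟨ cong (col x) (applyUpTo-count xs ps) ⟩
  transpose (x ∷ xs) ∎

headOr0-trim : ∀ xs → headOr0 (trim xs) ≡ headOr0 xs
headOr0-trim []           = refl
headOr0-trim (zero ∷ xs)  = refl
headOr0-trim (suc x ∷ xs) = refl

tilde≡ : ∀ {c} k κ → Cap c κ → length κ ≤ k → tilde k κ ≡ transpose (comp k κ)
tilde≡ k κ ps p = begin
  conj (reverse (map (k ∸_) (κ ++ replicate (k ∸ length κ) 0)))
    ≡⟨ cong (conj ∘ reverse) (trans (cong (map (k ∸_)) (sym (applyUpTo-at κ k p))) (LP.map-applyUpTo (at κ) (k ∸_) k)) ⟩
  conj (reverse (applyUpTo (λ i → k ∸ at κ i) k))
    ≡⟨ cong conj (trans (LP.reverse-applyUpTo (λ i → k ∸ at κ i) k) (sym (applyUpTo-reflect (λ i → k ∸ at κ i) k))) ⟩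
  conj rows
    ≡⟨ LP.map-upTo (λ i → count i rows) (headOr0 rows) ⟩
  applyUpTo (λ i → count i rows) (headOr0 rows)
    ≡⟨ trans (cong (applyUpTo (λ i → count i rows)) (sym (headOr0-trim rows))) (applyUpTo-cong (headOr0 (comp k κ)) (λ i _ → count-trim i row k (row-antitone k κ ps))) ⟩
  applyUpTo (λ i → count i (comp k κ)) (headOr0 (comp k κ))
    ≡⟨ applyUpTo-count (comp k κ) (comp-Cap k κ ps) ⟩
  transpose (comp k κ) ∎
  where
  row : ℕ → ℕ
  row i = k ∸ at κ (k ∸ suc i)
  rows = applyUpTo row k

-- Polynomiality

addPoly : List ℚ → List ℚ → List ℚ
addPoly []       q        = q
addPoly (a ∷ p)  []       = a ∷ p
addPoly (a ∷ p)  (b ∷ q)  = (a ⊕ b) ∷ addPoly p q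

length-addPoly : ∀ n p q → length p ≤ n → length q ≤ n → length (addPoly p q) ≤ n
length-addPoly n       []      q       _       v       = v
length-addPoly n       (_ ∷ _) []      u       _       = u
length-addPoly (suc n) (_ ∷ p) (_ ∷ q) (s≤s u) (s≤s v) = s≤s (length-addPoly n p q u v)

scalePoly : ℚ → List ℚ → List ℚ
scalePoly c = map (c ⊛_)

-- Prepending two zeros multiplies by the square of the variable, so each box costs two
-- coefficients.
rowPoly : ℕ → ℕ → List ℚ → List ℚ
rowPoly i zero    p = p
rowPoly i (suc x) p = addPoly (0ℚ ∷ 0ℚ ∷ rowPoly i x p) (scalePoly (0ℚ ⊖ (ι x ⊖ ι i) ⊛ (ι x ⊖ ι i)) (rowPoly i x p))

contentPoly : ℕ → List ℕ → List ℚ → List ℚ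
contentPoly i []       p = p
contentPoly i (x ∷ xs) p = rowPoly i x (contentPoly (suc i) xs p)

length-rowPoly : ∀ i x p → length (rowPoly i x p) ≤ 2 * x + length p
length-rowPoly i zero    p = ℕP.≤-refl
length-rowPoly i (suc x) p = ℕP.≤-trans (length-addPoly (suc (suc (length (rowPoly i x p)))) (0ℚ ∷ 0ℚ ∷ rowPoly i x p) (scalePoly _ (rowPoly i x p)) ℕP.≤-refl
    (ℕP.≤-trans (ℕP.≤-reflexive (LP.length-map _ (rowPoly i x p))) (ℕP.m≤n⇒m≤1+n (ℕP.n≤1+n _))))
  (ℕP.≤-trans (s≤s (s≤s (length-rowPoly i x p))) (ℕP.≤-reflexive (move x (length p))))
  where
  move : ∀ x l → suc (suc (2 * x + l)) ≡ 2 * suc x + l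
  move = ℕ-solve-∀

length-contentPoly : ∀ i xs p → length (contentPoly i xs p) ≤ 2 * size xs + length p
length-contentPoly i []       p = ℕP.≤-refl
length-contentPoly i (x ∷ xs) p = ℕP.≤-trans (length-rowPoly i x (contentPoly (suc i) xs p))
  (ℕP.≤-trans (ℕP.+-monoʳ-≤ (2 * x) (length-contentPoly (suc i) xs p)) (ℕP.≤-reflexive (move x (size xs) (length p))))
  where
  move : ∀ x s l → 2 * x + (2 * s + l) ≡ 2 * (x + s) + l
  move = ℕ-solve-∀

opaque
  unfolding _⊕_

  evalPoly-add : ∀ p q x → evalPoly (addPoly p q) x ≡ evalPoly p x ⊕ evalPoly q x
  evalPoly-add []      q       x = sym (ℚP.+-identityˡ _)
  evalPoly-add (a ∷ p) []      x = sym (ℚP.+-identityʳ _)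
  evalPoly-add (a ∷ p) (b ∷ q) x = trans (cong (λ z → (a ⊕ b) ⊕ x ⊛ z) (evalPoly-add p q x)) (lemma a b x (evalPoly p x) (evalPoly q x))
    where
    lemma : ∀ a b x u v → (a ⊕ b) ⊕ x ⊛ (u ⊕ v) ≡ (a ⊕ x ⊛ u) ⊕ (b ⊕ x ⊛ v)
    lemma = solve-∀ ring

  evalPoly-scale : ∀ c p x → evalPoly (scalePoly c p) x ≡ c ⊛ evalPoly p x
  evalPoly-scale c []      x = sym (ℚP.*-zeroʳ c)
  evalPoly-scale c (a ∷ p) x = trans (cong (λ z → c ⊛ a ⊕ x ⊛ z) (evalPoly-scale c p x)) (lemma c a x (evalPoly p x))
    where
    lemma : ∀ c a x u → c ⊛ a ⊕ x ⊛ (c ⊛ u) ≡ c ⊛ (a ⊕ x ⊛ u)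
    lemma = solve-∀ ring

  evalPoly-constant : ∀ a x → evalPoly (a ∷ []) x ≡ a
  evalPoly-constant a x = trans (cong (a ℚ.+_) (ℚP.*-zeroʳ x)) (ℚP.+-identityʳ a)

  private
    factor-arith : ∀ x e s → (0ℚ ⊕ x ⊛ (0ℚ ⊕ x ⊛ e)) ⊕ (0ℚ ⊖ s) ⊛ e ≡ (x ⊛ x ⊖ s) ⊛ e
    factor-arith = solve-∀ ring

  evalPoly-shift : ∀ s p y → evalPoly (addPoly (0ℚ ∷ 0ℚ ∷ p) (scalePoly (0ℚ ⊖ s) p)) y ≡ (y ⊛ y ⊖ s) ⊛ evalPoly p y
  evalPoly-shift s p y = trans (evalPoly-add (0ℚ ∷ 0ℚ ∷ p) (scalePoly (0ℚ ⊖ s) p) y)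
    (trans (cong (evalPoly (0ℚ ∷ 0ℚ ∷ p) y ⊕_) (evalPoly-scale (0ℚ ⊖ s) p y)) (factor-arith y (evalPoly p y) s))

  private
    difference-arith : ∀ a b f → (a ⊖ b) ⊛ f ≡ a ⊛ f ⊕ (0ℚ ⊖ 1ℚ) ⊛ (b ⊛ f)
    difference-arith = solve-∀ ring

    scale-out : ∀ a b g → g ⊛ a ⊕ (0ℚ ⊖ 1ℚ) ⊛ (g ⊛ b) ≡ g ⊛ (a ⊕ (0ℚ ⊖ 1ℚ) ⊛ b)
    scale-out = solve-∀ ring

    add-sub : ∀ a b → (a ⊕ b) ⊖ b ≡ a
    add-sub = solve-∀ ring

    base-arith : ∀ g c d n → g ⊛ (c ⊛ (d ⊛ n)) ≡ n ⊛ (g ⊛ (c ⊛ d))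
    base-arith = solve-∀ ring

evalPoly-rowPoly : ∀ i x p y → evalPoly (rowPoly i x p) y ≡ rowProd (y ⊛ y) i x ⊛ evalPoly p y
evalPoly-rowPoly i zero    p y = sym (*-identityˡ _)
evalPoly-rowPoly i (suc x) p y = begin
  evalPoly (rowPoly i (suc x) p) y
    ≡⟨ evalPoly-shift s (rowPoly i x p) y ⟩
  (y ⊛ y ⊖ s) ⊛ evalPoly (rowPoly i x p) y
    ≡⟨ trans (cong ((y ⊛ y ⊖ s) ⊛_) (evalPoly-rowPoly i x p y)) (trans (sym (*-assoc _ _ _)) (cong (_⊛ evalPoly p y) (*-comm _ _))) ⟩
  rowProd (y ⊛ y) i (suc x) ⊛ evalPoly p y ∎
  where
  s : ℚ
  s = (ι x ⊖ ι i) ⊛ (ι x ⊖ ι i)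

evalPoly-contentPoly : ∀ i xs p y → evalPoly (contentPoly i xs p) y ≡ contentProd (y ⊛ y) i xs ⊛ evalPoly p y
evalPoly-contentPoly i []       p y = sym (*-identityˡ _)
evalPoly-contentPoly i (x ∷ xs) p y = trans (evalPoly-rowPoly i x (contentPoly (suc i) xs p) y)
  (trans (cong (rowProd (y ⊛ y) i x ⊛_) (evalPoly-contentPoly (suc i) xs p y)) (sym (*-assoc _ _ _)))

-- The form claimed in the theorem, with the denominator cleared. As `g k` and `fallingSq k N` are
-- common to all sequences with the same N, linear combinations of such sequences have this form
-- again.
Good : ℕ → (ℕ → ℚ) → Set
Good N a = Σ (List ℚ) λ B → length B ≤ suc (2 * N) × (∀ k → 0 < k → N ≤ k * k → a k ⊛ fallingSq k N ≡ g k ⊛ evalPoly B (ι k))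

Good-resp : ∀ {N a b} → (∀ k → 0 < k → N ≤ k * k → b k ≡ a k) → Good N a → Good N b
Good-resp {N} h (B , l , e) = B , l , λ k p q → trans (cong (_⊛ fallingSq k N) (h k p q)) (e k p q)

Good-0 : ∀ {N} → Good N (λ _ → 0ℚ)
Good-0 = [] , z≤n , λ k _ _ → trans (*-zeroˡ _) (sym (*-zeroʳ _))

Good-+ : ∀ {N a b} → Good N a → Good N b → Good N (λ k → a k ⊕ b k)
Good-+ (A , l , e) (B , m , f) = addPoly A B , length-addPoly _ A B l m , λ k p q →
  trans (*-distribʳ-+ _ _ _) (trans (cong₂ _⊕_ (e k p q) (f k p q)) (trans (sym (*-distribˡ-+ _ _ _)) (cong (g k ⊛_) (sym (evalPoly-add A B (ι k))))))

Good-⊖ : ∀ {N a b} → Good N a → Good N b → Good N (λ k → a k ⊖ b k)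
Good-⊖ (A , l , e) (B , m , f) = addPoly A (scalePoly (0ℚ ⊖ 1ℚ) B) , length-addPoly _ A _ l (ℕP.≤-trans (ℕP.≤-reflexive (LP.length-map _ B)) m) , λ k p q →
  trans (difference-arith _ _ _) (trans (cong₂ (λ x y → x ⊕ (0ℚ ⊖ 1ℚ) ⊛ y) (e k p q) (f k p q)) (trans (scale-out _ _ _)
  (cong (g k ⊛_) (sym (trans (evalPoly-add A (scalePoly (0ℚ ⊖ 1ℚ) B) (ι k)) (cong (evalPoly A (ι k) ⊕_) (evalPoly-scale (0ℚ ⊖ 1ℚ) B (ι k))))))))

Good-when : ∀ {N a} b → Good N a → Good N (λ k → when b (a k))
Good-when true  h = h
Good-when false h = Good-0

Good-Dim-square : ∀ {c} μ → Cap c μ → Good (size μ) (λ k → Dim (k * k ∸ size μ) μ (square k))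
-- The constant d is d_μ / n!; the n! stems from `Dim-to-square`.
Good-Dim-square {c} μ ps = contentPoly 0 μ (d ∷ []) , ℕP.≤-trans (length-contentPoly 0 μ (d ∷ [])) (ℕP.≤-reflexive (ℕP.+-comm (2 * n) 1)) , λ k p q →
  *-cancelˡ-pos (ι (n !)) (ι-pos _ (!-pos n)) (begin
    ι (n !) ⊛ (Dim (k * k ∸ n) μ (square k) ⊛ fallingSq k n)
      ≡⟨ *-comm _ _ ⟩
    Dim (k * k ∸ n) μ (square k) ⊛ fallingSq k n ⊛ ι (n !)
      ≡⟨ Dim-to-square (k * k ∸ n) k μ p (ℕP.m≤n+m k c) (Cap-≤ (ℕP.m≤m+n c k) ps) (ℕP.m+[n∸m]≡n q) ⟩
    g k ⊛ (contentProd (ι (k * k)) 0 μ ⊛ Dim n [] μ)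
      ≡⟨ cong₂ (λ x y → g k ⊛ (contentProd x 0 μ ⊛ y)) (ι-* k k) (sym (/-* (dimAux n [] μ) (n !) {{n ℕP.!≢0}})) ⟩
    g k ⊛ (contentProd (ι k ⊛ ι k) 0 μ ⊛ (d ⊛ ι (n !)))
      ≡⟨ base-arith _ _ _ _ ⟩
    ι (n !) ⊛ (g k ⊛ (contentProd (ι k ⊛ ι k) 0 μ ⊛ d))
      ≡⟨ cong (λ z → ι (n !) ⊛ (g k ⊛ z)) (sym (trans (evalPoly-contentPoly 0 μ (d ∷ []) (ι k)) (cong (contentProd (ι k ⊛ ι k) 0 μ ⊛_) (evalPoly-constant d (ι k))))) ⟩
    ι (n !) ⊛ (g k ⊛ evalPoly (contentPoly 0 μ (d ∷ [])) (ι k)) ∎)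
  where
  n = size μ
  d = ℚ._/_ (+ (dimAux n [] μ)) (n !) {{n ℕP.!≢0}}

-- As a strip has at most one box in each row, ν has at least r rows. `strip-split` uses this to see
-- that a strip which skips one of the upper rows creates more than r rows.
Good-strip : ∀ {N c} (a : List ℕ → ℕ → ℚ) r xs → Cap c xs → (∀ ν → Cap c ν → size ν ≡ r + size xs → r ≤ length ν → Good N (a ν)) →
  Good N (λ k → stripΣ c r (λ ν → a ν k) xs)
Good-strip a zero xs ps h = h xs ps refl z≤n
Good-strip {c = zero}  a (suc r) [] _ h = Good-0
Good-strip {c = suc c} a (suc r) [] _ h = Good-strip (a ∘ (1 ∷_)) r [] [] (λ ν q e l → h (1 ∷ ν) (s≤s z≤n ∷ q) (cong suc e) (s≤s l))
Good-strip {N} {c} a (suc r) (suc x ∷ xs) (p ∷ ps) h = Good-+ (shifted (ℕP.m≤n⇒m<n∨m≡n p))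
  (Good-strip (a ∘ (suc x ∷_)) (suc r) xs ps (λ ν q e l → h (suc x ∷ ν) (p ∷ q) (trans (cong (λ z → suc x + z) e) (move x r (size xs))) (ℕP.m≤n⇒m≤1+n l)))
  where
  move : ∀ x r s → suc x + (suc r + s) ≡ suc r + (suc x + s)
  move = ℕ-solve-∀
  move′ : ∀ x r s → suc (suc x) + (r + s) ≡ suc r + (suc x + s)
  move′ = ℕ-solve-∀
  shifted : suc x < c ⊎ suc x ≡ c → Good N (λ k → when (suc x <ᵇ c) (stripΣ (suc (suc x)) r (λ ν → a (suc (suc x) ∷ ν) k) xs))
  shifted (inj₁ q) = Good-when (suc x <ᵇ c) (Good-strip (a ∘ (suc (suc x) ∷_)) r xs (Cap-≤ (ℕP.n≤1+n _) ps)
    (λ ν s e l → h (suc (suc x) ∷ ν) (q ∷ s) (trans (cong (λ z → suc (suc x) + z) e) (move′ x r (size xs))) (s≤s l)))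
  shifted (inj₂ refl) = Good-resp (λ k _ _ → cong (λ b → when b (stripΣ (suc (suc x)) r (λ ν → a (suc (suc x) ∷ ν) k) xs)) (<ᵇ-false (ℕP.≤-refl {x}))) Good-0

-- Among the strips of size r ≥ length xs, exactly one does not create more than r rows: a full column.
strip-split : ∀ {N c} (a : List ℕ → ℕ → ℚ) r xs → Cap c xs → headOr0 xs < c → length xs ≤ r →
  (∀ ν → Cap c ν → size ν ≡ r + size xs → r < length ν → Good N (a ν)) →
  Σ (ℕ → ℚ) λ R → Good N R × (∀ k → stripΣ c r (λ ν → a ν k) xs ≡ a (col r xs) k ⊕ R k)
strip-split a zero    []       _ _ _ h = (λ _ → 0ℚ) , Good-0 , λ k → sym (+-identityʳ _)
strip-split {c = suc c} a (suc r) [] _ q _ h with strip-split (a ∘ (1 ∷_)) r [] [] (s≤s z≤n) z≤n (λ ν s e l → h (1 ∷ ν) (s≤s z≤n ∷ s) (cong suc e) (s≤s l))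
... | R , good , e = R , good , e
strip-split {N} {c} a (suc r) (suc x ∷ xs) (p ∷ ps) q (s≤s l) h
  with strip-split (a ∘ (suc (suc x) ∷_)) r xs (Cap-≤ (ℕP.n≤1+n _) ps) (s≤s (Cap-head ps)) l (λ ν s e m → h (suc (suc x) ∷ ν) (q ∷ s) (trans (cong (λ z → suc (suc x) + z) e) (move′ x r (size xs))) (s≤s m))
  where
  move′ : ∀ x r s → suc (suc x) + (r + s) ≡ suc r + (suc x + s)
  move′ = ℕ-solve-∀
... | R , good , e = (λ k → R k ⊕ stripΣ (suc x) (suc r) (λ ν → a (suc x ∷ ν) k) xs) ,
  Good-+ good (Good-strip (a ∘ (suc x ∷_)) (suc r) xs ps (λ ν s e m → h (suc x ∷ ν) (p ∷ s) (trans (cong (λ z → suc x + z) e) (move x r (size xs))) (s≤s m))) ,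
  λ k → trans (cong (_⊕ stripΣ (suc x) (suc r) (λ ν → a (suc x ∷ ν) k) xs) (trans (cong (λ b → when b (stripΣ (suc (suc x)) r (λ ν → a (suc (suc x) ∷ ν) k) xs)) (<ᵇ-true q)) (e k))) (+-assoc _ _ _)
  where
  move : ∀ x r s → suc x + (suc r + s) ≡ suc r + (suc x + s)
  move = ℕ-solve-∀

-- Induction on the first column

uncol : List ℕ → List ℕ
uncol []                 = []
uncol (zero ∷ xs)        = []
uncol (suc zero ∷ xs)    = []
uncol (suc (suc x) ∷ xs) = suc x ∷ uncol xs

uncol-Cap : ∀ {c} xs → Cap c xs → Cap (pred c) (uncol xs)
uncol-Cap []                 _              = []
uncol-Cap (suc zero ∷ xs)    _              = []
uncol-Cap (suc (suc x) ∷ xs) (s≤s p ∷ ps)   = p ∷ uncol-Cap xs ps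

length-uncol : ∀ xs → length (uncol xs) ≤ length xs
length-uncol []                 = z≤n
length-uncol (zero ∷ xs)        = z≤n
length-uncol (suc zero ∷ xs)    = z≤n
length-uncol (suc (suc x) ∷ xs) = s≤s (length-uncol xs)

col-uncol : ∀ {c} xs → Cap c xs → col (length xs) (uncol xs) ≡ xs
col-uncol []                 _        = refl
col-uncol (suc zero ∷ xs)    (_ ∷ ps) = cong (1 ∷_) (ones xs ps)
  where
  ones : ∀ xs → Cap 1 xs → col (length xs) [] ≡ xs
  ones []        _              = refl
  ones (.1 ∷ xs) (s≤s z≤n ∷ ps) = cong (1 ∷_) (ones xs ps)
col-uncol (suc (suc x) ∷ xs) (_ ∷ ps) = cong (suc (suc x) ∷_) (col-uncol xs ps)

size-uncol : ∀ {c} xs → Cap c xs → size xs ≡ length xs + size (uncol xs)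
size-uncol xs ps = trans (cong size (sym (col-uncol xs ps))) (size-col (length xs) (uncol xs))

uncol-Cap′ : ∀ {c} xs → Cap c xs → Cap (suc c) (uncol xs)
uncol-Cap′ {c} xs ps = Cap-≤ (ℕP.≤-trans ℕP.pred[n]≤n (ℕP.n≤1+n c)) (uncol-Cap xs ps)

size-uncol-< : ∀ {c} xs n → Cap c xs → size xs ≤ suc n → size (uncol xs) ≤ n
size-uncol-< []       n _  _ = z≤n
size-uncol-< (x ∷ xs) n ps u = ℕP.≤-trans (ℕP.m≤n+m (size (uncol (x ∷ xs))) (length xs)) (ℕP.≤-pred (subst (_≤ suc n) (size-uncol (x ∷ xs) ps) u))

length≤size : ∀ {c} xs → Cap c xs → length xs ≤ size xs
length≤size []           _        = z≤n
length≤size (suc x ∷ xs) (_ ∷ ps) = s≤s (ℕP.≤-trans (length≤size xs ps) (ℕP.m≤n+m (size xs) x))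

comp-[] : ∀ k → comp k [] ≡ square k
comp-[] zero    = refl
comp-[] (suc k) = constant (suc k)
  where
  constant : ∀ n → trim (applyUpTo (λ _ → suc k) n) ≡ replicate n (suc k)
  constant zero    = refl
  constant (suc n) = cong (suc k ∷_) (constant n)

GoodChains : ℕ → List ℕ → List ℕ → Set
GoodChains N κ μ = Good N (λ k → chains k (k * k ∸ N) κ μ)

-- Removing the first column of κ and adding it back as a vertical strip yields κ and diagrams of the same
-- size with more rows; strip-chains moves the strip over to μ.
good-chains-step : ∀ {c} κ μ → Cap c κ → Cap c μ → (∀ ν → Cap (suc c) ν → GoodChains (size (uncol κ) + size ν) (uncol κ) ν) →
  (∀ ν → Cap (suc c) ν → size ν ≡ size κ → length κ < length ν → GoodChains (size κ + size μ) ν μ) → GoodChains (size κ + size μ) κ μ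
good-chains-step {c} κ μ ps qs shorter longer = Good-resp rewritten (Good-⊖ onμ (proj₁ (proj₂ split)))
  where
  N = size κ + size μ
  r = length κ
  κ⁻ = uncol κ

  κ⁻-Cap : Cap (suc c) κ⁻
  κ⁻-Cap = uncol-Cap′ κ ps

  head<c : ∀ {xs} → Cap c xs → headOr0 xs < suc c
  head<c q = s≤s (Cap-head q)

  split = strip-split (λ ν k → chains k (k * k ∸ N) ν μ) r κ⁻ κ⁻-Cap (s≤s (ℕP.≤-trans (Cap-head (uncol-Cap κ ps)) ℕP.pred[n]≤n)) (length-uncol κ) (λ ν s e l → longer ν s (trans e (sym (size-uncol κ ps))) l)

  size-N : ∀ s → size κ⁻ + (r + s) ≡ size κ + s
  size-N s = trans (move (size κ⁻) r s) (cong (_+ s) (sym (size-uncol κ ps)))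
    where
    move : ∀ a b c → a + (b + c) ≡ b + a + c
    move = ℕ-solve-∀

  onμ : Good N (λ k → stripΣ (suc c) r (chains k (k * k ∸ N) κ⁻) μ)
  onμ = Good-strip (λ ν k → chains k (k * k ∸ N) κ⁻ ν) r μ (Cap-≤ (ℕP.n≤1+n c) qs) λ ν s e _ →
    subst (λ z → GoodChains z κ⁻ ν) (trans (cong (λ z → size κ⁻ + z) e) (size-N (size μ)))
      (shorter ν s)

  rewritten : ∀ k → 0 < k → N ≤ k * k → chains k (k * k ∸ N) κ μ ≡ stripΣ (suc c) r (chains k (k * k ∸ N) κ⁻) μ ⊖ proj₁ split k
  rewritten k _ N≤k² = begin
    chains k m κ μ
      ≡⟨ sym (trans (cong (λ z → (z ⊖ proj₁ split k)) (trans (proj₂ (proj₂ split) k) (cong (λ ν → chains k m ν μ ⊕ proj₁ split k) (col-uncol κ ps)))) (add-sub _ _)) ⟩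
    stripΣ (suc c) r (λ ν → chains k m ν μ) κ⁻ ⊖ proj₁ split k
      -- `strip-chains` needs a bound of at least k, but the strips behind the polynomial have to be
      -- enumerated once for all k, under the bound `suc c`. Both bounds leave the first rows free,
      -- so they can be interchanged.
      ≡⟨ cong (_⊖ proj₁ split k) (trans (stripΣ-free r _ κ⁻ head⁻ (ℕP.≤-trans head⁻ sc≤C))
           (trans (sym (strip-chains r k m κ⁻ μ (ℕP.m≤n+m k (suc c)) (Cap-≤ sc≤C κ⁻-Cap) (Cap-≤ (ℕP.≤-trans (ℕP.n≤1+n c) sc≤C) qs) total))
             (stripΣ-free r _ μ (ℕP.≤-trans (head<c qs) sc≤C) (head<c qs)))) ⟩
    stripΣ (suc c) r (chains k m κ⁻) μ ⊖ proj₁ split k ∎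
    where
    m = k * k ∸ N
    sc≤C : suc c ≤ suc c + k
    sc≤C = ℕP.m≤m+n (suc c) k
    head⁻ : headOr0 κ⁻ < suc c
    head⁻ = s≤s (ℕP.≤-trans (Cap-head (uncol-Cap κ ps)) ℕP.pred[n]≤n)
    total : r + (size κ⁻ + size μ) + m ≡ k * k
    total = trans (cong (_+ m) (trans (sym (ℕP.+-assoc r (size κ⁻) (size μ))) (cong (_+ size μ) (sym (size-uncol κ ps))))) (ℕP.m+[n∸m]≡n N≤k²)

-- Lexicographic induction: n bounds the size of κ and d the excess of this size over the number of
-- rows. Removing the column lowers n; diagrams of equal size with more rows lower d. For d = 0, κ
-- is a single column, and no diagram of its size has more rows.
good-chains : ∀ n d {c} κ μ → Cap c κ → Cap c μ → size κ ≤ n → size κ ≤ length κ + d → GoodChains (size κ + size μ) κ μ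
good-chains n       d [] μ ps qs _ _ = Good-resp (λ k _ _ → cong (Dim (k * k ∸ size μ) μ) (comp-[] k)) (Good-Dim-square μ qs)
good-chains zero    d (suc x ∷ xs) μ (_ ∷ _) qs () _
good-chains (suc n) zero κ@(_ ∷ _) μ ps qs u v = good-chains-step κ μ ps qs
  (λ ν s → good-chains n (size (uncol κ)) (uncol κ) ν (uncol-Cap′ κ ps) s (size-uncol-< κ n ps u) (ℕP.m≤n+m (size (uncol κ)) (length (uncol κ))))
  (λ ν s e l → ⊥-elim (ℕP.<-irrefl (sym e) (ℕP.≤-<-trans v (ℕP.<-≤-trans (subst (_< length ν) (sym (ℕP.+-identityʳ (length κ))) l) (length≤size ν s)))))
good-chains (suc n) (suc d) {c} κ@(_ ∷ _) μ ps qs u v = good-chains-step κ μ ps qs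
  (λ ν s → good-chains n (size (uncol κ)) (uncol κ) ν (uncol-Cap′ κ ps) s (size-uncol-< κ n ps u) (ℕP.m≤n+m (size (uncol κ)) (length (uncol κ))))
  (λ ν s e l → subst (λ z → GoodChains (z + size μ) ν μ) e (good-chains (suc n) d ν μ s (Cap-≤ (ℕP.n≤1+n c) qs) (ℕP.≤-trans (ℕP.≤-reflexive e) u)
    (ℕP.≤-trans (ℕP.≤-reflexive e) (ℕP.≤-trans v (ℕP.≤-trans (ℕP.≤-reflexive (ℕP.+-suc (length κ) d)) (ℕP.+-monoˡ-≤ d l))))))

-- Return to `dim` and `tilde`

ι-injective : ∀ {m n} → ι m ≡ ι n → m ≡ n
ι-injective {zero}  {zero}  e = refl
ι-injective {zero}  {suc n} e = ⊥-elim (0-not-pos (subst ℚ.Positive (sym e) (ι-pos (suc n) (s≤s z≤n))))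
ι-injective {suc m} {zero}  e = ⊥-elim (0-not-pos (subst ℚ.Positive e (ι-pos (suc m) (s≤s z≤n))))
ι-injective {suc m} {suc n} e = cong suc (ι-injective (trans (sym (sub-add 1ℚ (ι m))) (trans (cong (_⊖ 1ℚ) e) (sub-add 1ℚ (ι n)))))

FitsIn⇒InBox : ∀ k κ → FitsIn k κ → InBox k κ
FitsIn⇒InBox k []      (l , _)     = z≤n , l
FitsIn⇒InBox k (x ∷ κ) (l , p ∷ _) = p , l

chains-InBox : ∀ k m κ μ → InBox k κ → chains k m κ μ ≡ Dim m μ (comp k κ)
chains-InBox k m κ μ p = cong (λ b → when b (Dim m μ (comp k κ))) (dec-true (inBox? k κ) p)

dim-tilde : ∀ {c d} k κ μ → Cap c κ → Cap d μ → InBox k κ →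
  ι (dim μ (tilde k κ)) ≡ chains k (k * k ∸ (size κ + size μ)) κ (transpose μ)
dim-tilde k κ μ ps qs p = begin
  Dim (size (tilde k κ) ∸ size μ) μ (tilde k κ)
    ≡⟨ cong₂ (λ m ν → Dim m μ ν) steps (tilde≡ k κ ps (proj₂ p)) ⟩
  Dim (k * k ∸ (size κ + size μ)) μ (transpose (comp k κ))
    ≡⟨ Dim-transpose (k * k ∸ (size κ + size μ)) μ (comp k κ) qs (comp-Cap k κ ps) ⟩
  Dim (k * k ∸ (size κ + size μ)) (transpose μ) (comp k κ)
    ≡⟨ sym (chains-InBox k (k * k ∸ (size κ + size μ)) κ (transpose μ) p) ⟩
  chains k (k * k ∸ (size κ + size μ)) κ (transpose μ) ∎
  where
  steps : size (tilde k κ) ∸ size μ ≡ k * k ∸ (size κ + size μ)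
  steps = begin
    size (tilde k κ) ∸ size μ
      ≡⟨ cong (_∸ size μ) (trans (cong size (tilde≡ k κ ps (proj₂ p))) (size-transpose (comp k κ))) ⟩
    size (comp k κ) ∸ size μ
      ≡⟨ cong (_∸ size μ) (trans (sym (ℕP.m+n∸n≡m (size (comp k κ)) (size κ))) (cong (_∸ size κ) (size-comp k κ ps p))) ⟩
    k * k ∸ size κ ∸ size μ
      ≡⟨ ℕP.∸-+-assoc (k * k) (size κ) (size μ) ⟩
    k * k ∸ (size κ + size μ) ∎

chains-transpose : ∀ {c d} k m κ μ → Cap c κ → Cap d μ → InBox k κ → InBox k μ → chains k m (transpose κ) μ ≡ chains k m κ (transpose μ)
chains-transpose k m κ μ ps qs p q = begin
  chains k m (transpose κ) μ              ≡⟨ chains-InBox k m (transpose κ) μ (InBox-transpose k κ ps p) ⟩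
  Dim m μ (comp k (transpose κ))          ≡⟨ cong (Dim m μ) (sym (transpose-comp k κ ps)) ⟩
  Dim m μ (transpose (comp k κ))          ≡⟨ Dim-transpose m μ (comp k κ) qs (comp-Cap k κ ps) ⟩
  Dim m (transpose μ) (comp k κ)          ≡⟨ sym (chains-InBox k m κ (transpose μ) p) ⟩
  chains k m κ (transpose μ) ∎

-- `chains-comm` leaves the conjugate on the diagram whose complement is taken; conjugating whole
-- chains moves it back to the other one.
dim-tilde-comm : ∀ {c d} k κ μ → Cap c κ → Cap d μ → InBox k κ → InBox k μ → size κ + size μ ≤ k * k → dim μ (tilde k κ) ≡ dim κ (tilde k μ)
dim-tilde-comm k κ μ ps qs p q N≤k² = ι-injective (begin
  ι (dim μ (tilde k κ))
    ≡⟨ dim-tilde k κ μ ps qs p ⟩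
  chains k (k * k ∸ (size κ + size μ)) κ (transpose μ)
    ≡⟨ chains-comm k (k * k ∸ (size κ + size μ)) κ (transpose μ) ℕP.≤-refl
         (Cap-≤ (proj₁ p) (Cap-headOr0 ps)) (Cap-≤ (proj₂ q) (transpose-Cap μ))
         (trans (cong (λ z → size κ + z + (k * k ∸ (size κ + size μ))) (size-transpose μ)) (ℕP.m+[n∸m]≡n N≤k²)) ⟩
  chains k (k * k ∸ (size κ + size μ)) (transpose μ) κ
    ≡⟨ chains-transpose k (k * k ∸ (size κ + size μ)) μ κ qs ps q p ⟩
  chains k (k * k ∸ (size κ + size μ)) μ (transpose κ)
    ≡⟨ cong (λ z → chains k (k * k ∸ z) μ (transpose κ)) (ℕP.+-comm (size κ) (size μ)) ⟩
  chains k (k * k ∸ (size μ + size κ)) μ (transpose κ)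
    ≡⟨ sym (dim-tilde k μ κ qs ps q) ⟩
  ι (dim κ (tilde k μ)) ∎)

opaque
  unfolding _⊕_

  toℚ-form : ∀ n f h B k → ι n ⊛ f ≡ h ⊛ evalPoly B (ι k) → toℚ n *ℚ f ≡ h *ℚ evalPoly B (toℚ k)
  toℚ-form n f h B k e = trans (cong (_*ℚ f) (sym (ι≡toℚ n))) (trans e (cong (λ x → h *ℚ evalPoly B x) (ι≡toℚ k)))

theorem1p4 : (κ λ′ : List ℕ) → IsPartition κ → IsPartition λ′ →
    Σ (List ℚ) (λ B →
    (length B ≤ suc (2 * (size κ + size λ′))) ×
    ((k : ℕ) → 1 ≤ k → FitsIn k κ → FitsIn k λ′ → size κ + size λ′ ≤ k * k →
    (dim λ′ (tilde k κ) ≡ dim κ (tilde k λ′)) ×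
    (toℚ (dim λ′ (tilde k κ)) *ℚ fallingSq k (size κ + size λ′) ≡ g k *ℚ evalPoly B (toℚ k))))
theorem1p4 κ λ′ κ-partition λ-partition = B , length-B , λ k k≥1 κ-fits λ-fits N≤k² →
  let κ-box = FitsIn⇒InBox k κ κ-fits
      λ-box = FitsIn⇒InBox k λ′ λ-fits
  in dim-tilde-comm k κ λ′ κ-Cap λ-Cap κ-box λ-box N≤k² ,
     toℚ-form (dim λ′ (tilde k κ)) _ _ B k (trans (cong (_⊛ fallingSq k (size κ + size λ′)) (dim-tilde k κ λ′ κ-Cap λ-Cap κ-box)) (B-eval k k≥1 N≤k²))
  where
  κ-Cap = isPartition⇒Cap κ-partition
  λ-Cap = isPartition⇒Cap λ-partition
  c = headOr0 κ + length λ′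
  good : GoodChains (size κ + size λ′) κ (transpose λ′)
  good = subst (λ z → GoodChains (size κ + z) κ (transpose λ′)) (size-transpose λ′)
    (good-chains (size κ) (size κ) κ (transpose λ′) (Cap-≤ (ℕP.m≤m+n (headOr0 κ) (length λ′)) κ-Cap) (Cap-≤ (ℕP.m≤n+m (length λ′) (headOr0 κ)) (transpose-Cap λ′)) ℕP.≤-refl (ℕP.m≤n+m (size κ) (length κ)))
  B = proj₁ good
  length-B = proj₁ (proj₂ good)
  B-eval = proj₂ (proj₂ good)
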